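{- Let $m$ be an odd integer with $5 \le m \le 49$. Then the complete symmetric digraph $K_{2m}^\ast$ admits a resolvable decomposition into directed $m$-cycles.
   Context: $K_n^\ast$ denotes the complete symmetric digraph of order $n$: it has $n$ vertices and, for each pair of distinct vertices $u,v$, both arcs $(u,v)$ and $(v,u)$ (no loops, no multiple arcs). A decomposition of a digraph $D$ is a collection of subdigraphs whose arc sets partition the arc set of $D$. A resolution class of a decomposition is a subcollection whose members' vertex sets partition the vertex set of $D$; a decomposition is resolvable if it can be partitioned into resolution classes. A directed $m$-cycle is a directed cycle of length $m$. -}

module Defs where

open import Data.Nat using (ℕ; zero; suc; _<_; s≤s; _<?_)
open import Data.Fin using (Fin; toℕ; fromℕ<)
open import Data.Product using (Σ; _×_; ∃)
open import Relation.Binary.PropositionalEquality using (_≡_)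
open import Relation.Nullary using (¬_; yes; no)
open import Function.Definitions using (Injective)

next : ∀ {m} → Fin m → Fin m
next {suc k} i with suc (toℕ i) <? suc k
... | yes p = fromℕ< p
... | no _  = Fin.zero

-- A directed m-cycle in a digraph on vertex set Fin n: a cyclic sequence of
-- m distinct vertices c 0, c 1, …, c (m-1); its arcs are (c i , c (i+1 mod m)).
record DiCycle (n m : ℕ) : Set where
  field
    vtx  : Fin m → Fin n
    inj  : Injective _≡_ _≡_ vtx

open DiCycle public

OnCycle : ∀ {n m} → DiCycle n m → Fin n → Set
OnCycle C v = ∃ λ i → vtx C i ≡ v

ArcOf : ∀ {n m} → DiCycle n m → Fin n → Fin n → Set
ArcOf C u v = ∃ λ i → (vtx C i ≡ u) × (vtx C (next i) ≡ v)

-- A resolvable decomposition of K*_n into directed m-cycles: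
-- N cycles, each assigned to one of r resolution classes, such that
--  * (decomposition) every arc (u,v), u ≠ v, of K*_n lies in exactly one cycle;
--  * (resolution) within each class, every vertex lies in exactly one cycle.
-- (Arcs of a cycle with m ≥ 2 are automatically arcs of K*_n, since vertices are distinct.)
record ResolvableCycleDecomposition (n m : ℕ) : Set where
  field
    N      : ℕ
    cyc    : Fin N → DiCycle n m
    r      : ℕ
    class  : Fin N → Fin r
    arc-covered : ∀ (u v : Fin n) → ¬ (u ≡ v) → ∃ λ j → ArcOf (cyc j) u v
    arc-unique  : ∀ (u v : Fin n) (j j' : Fin N) →
                  ArcOf (cyc j) u v → ArcOf (cyc j') u v → j ≡ j'
    class-covers : ∀ (c : Fin r) (v : Fin n) →
                   ∃ λ j → (class j ≡ c) × OnCycle (cyc j) v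
    class-unique : ∀ (c : Fin r) (v : Fin n) (j j' : Fin N) →
                   class j ≡ c → OnCycle (cyc j) v →
                   class j' ≡ c → OnCycle (cyc j') v → j ≡ j'

-- Double every vertex x of ℤ_{m-1} ∪ {∞} to x_0, x_1. The rotations of the zigzag Hamilton
-- cycle H = (0, 1, -1, 2, -2, …, ∞) decompose K*_m, so K*_{2m} is the union of the blow-ups of
-- (H + 2j) ∪ (H + 2j + 1), 0 ≤ j < (m ∸ 1)/2, and of the 2-cycles (x_0 x_1). The blow-up of
-- H ∪ (H + 1) is 4-regular and is decomposed into four classes (the starters), which rotation
-- by 2j carries to the other blow-ups. For j = 0 alone, the blow-up together with the 2-cycles is
-- 5-regular and is decomposed into five classes (the fixed ones) instead. The starters and fixed
-- classes were found by computer search. For m = 5, all nine classes are fixed.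

module Submission where

open import Defs
open import Data.Bool using (Bool; if_then_else_; true; false; T)
open import Data.Bool.ListAction using (any; all)
open import Data.Empty using (⊥)
open import Data.Fin using (Fin; zero; suc; toℕ; fromℕ<; combine; remQuot; punchOut)
open import Data.Fin.Properties using
  ( _≟_; toℕ<n; fromℕ<-toℕ; fromℕ<-cong; pigeonhole; punchOut-injective
  ; toℕ-injective; remQuot-combine; combine-remQuot; combine-injective; <⇒≢)
open import Data.List as List using (List; []; _∷_; upTo; concatMap; length)
open import Data.List.Membership.Propositional using (_∈_)
open import Data.List.Membership.Propositional.Properties using (∈-lookup; ∈-map⁻; ∈-upTo⁺)
open import Data.List.Relation.Unary.All as All using (All; []; _∷_)
open import Data.List.Relation.Unary.All.Properties using (all⁺)
open import Data.List.Relation.Unary.Any as AnyList using (here; there)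
open import Data.List.Relation.Unary.Any.Properties as AnyList using (any⁻)
open import Data.Nat as ℕ using
  (ℕ; suc; _≤_; _<_; _+_; _*_; _∸_; _/_; _%_; _≡ᵇ_; _<ᵇ_; _<?_; s≤s; NonZero)
open import Data.Nat.DivMod using (_mod_; m<n⇒m%n≡m; m<n*o⇒m/o<n; /-monoˡ-≤; m≡m%n+[m/n]*n)
open import Data.Nat.Properties using (≡ᵇ⇒≡; n<1+n; ≮⇒≥)
open import Data.Product using (∃; ∃₂; _×_; _,_; proj₁; proj₂; uncurry)
open import Data.Sum using (_⊎_; inj₁; inj₂)
open import Data.Vec as Vec using (Vec; []; _∷_; lookup; _∷ʳ_; head)
open import Data.Vec.Membership.Propositional.Properties using (∈-toList⁻)
import Data.Vec.Relation.Unary.Any as AnyVec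
import Data.Vec.Relation.Unary.Any.Properties as AnyVec
open import Function using (_∘_; const)
open import Function.Definitions using (Injective)
open import Relation.Binary.PropositionalEquality
  using (_≡_; _≢_; refl; sym; trans; cong; subst)
open import Relation.Nullary using (yes; no; contradiction)

-- Pairing H with H + 1 answers a parity obstruction. In the blow-up of one directed Hamilton cycle,
-- a class is a choice, at each of the m steps, between keeping the indices 0, 1 and swapping them:
-- two m-cycles if the number of swaps is even, one 2m-cycle if it is odd. The remaining arcs make
-- the opposite choices, and as m is odd their number of swaps has the other parity, so a single
-- Hamilton cycle never gives two good classes. Since m - 1 is even, the rotations pair up without
-- remainder. The 2-cycles (x_0 x_1) are too short to be a class of m-cycles, so some blow-up has to
-- absorb them.
--
-- The rotations of H decompose K*_m because its differences 1, -2, 3, -4, ... run once through the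
-- nonzero residues mod m - 1. Away from ∞, an arc x → y of H has x + y equal to 0 or 1, and one of
-- H + 1 has 2 or 3; hence the swing between small and large entries in the data.
--
-- The symmetry serves to write the classes down. What is verified, by evaluation and for each m
-- separately, is that the fully developed list of 2m - 1 classes covers all vertices and arcs.

-- Counting: surjections between finite sets of equal size.

-- If `i` were missed, punching it out would turn `g` into an injection of `Fin (suc k)` into
-- `Fin k`, against the pigeonhole principle. The negative form is the one `punchOut` consumes, and
-- only a contradiction is drawn from it.
injective⇒attains : ∀ {n} {g : Fin n → Fin n} → Injective _≡_ _≡_ g →
                    ∀ i → (∀ y → i ≢ g y) → ⊥
injective⇒attains {suc k} {g} g-inj i i∉g
  with x , y , x<y , eq ← pigeonhole (n<1+n k) (punchOut ∘ i∉g)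
  = <⇒≢ x<y (g-inj (punchOut-injective (i∉g x) (i∉g y) eq))

-- A section `g` of `f` is injective, hence attains every point, hence is a two-sided inverse. The
-- sizes enter through an equation because `suc r` and `2 * m` will agree only propositionally.
surjective⇒injective : ∀ {m n} → m ≡ n → {f : Fin m → Fin n} →
                       (∀ y → ∃ λ x → f x ≡ y) → Injective _≡_ _≡_ f
surjective⇒injective {n} refl {f} f-surj {i} {j} fi≡fj =
  trans (reached i refl) (sym (reached j (sym fi≡fj)))
  where
  g : Fin n → Fin n
  g = proj₁ ∘ f-surj

  f∘g : ∀ y → f (g y) ≡ y
  f∘g = proj₂ ∘ f-surj

  g-injective : Injective _≡_ _≡_ g
  g-injective {x} {y} eq = trans (sym (f∘g x)) (trans (cong f eq) (f∘g y))

  reached : ∀ x → f x ≡ f i → x ≡ g (f i)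
  reached x fx≡fi with x ≟ g (f i)
  ... | yes eq = eq
  ... | no  ne = contradiction
    -- If `x` were `g y`, then applying `f` would give `y ≡ f i`, so `x ≡ g (f i)` after all; hence
    -- `g` would miss `x`.
    (λ y x≡gy → ne (trans x≡gy (cong g (trans (sym (f∘g y)) (trans (cong f (sym x≡gy)) fx≡fi)))))
    (injective⇒attains g-injective x)

-- From covering to a resolvable decomposition.

-- Each class is a surjection from the 2m positions onto the 2m vertices, and at
-- each vertex u the r = 2m ∸ 1 successors together with u itself exhaust the 2m
-- vertices, so both uniqueness conditions follow from covering by counting.
module FromCovering
  {m r : ℕ} (size : suc r ≡ 2 * m) (vertex : Fin r → Fin 2 → Fin m → Fin (2 * m))
  (vertices-covered : ∀ c v → ∃₂ λ b i → vertex c b i ≡ v)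
  (arcs-covered : ∀ u v → u ≢ v →
    ∃ λ c → ∃₂ λ b i → vertex c b i ≡ u × vertex c b (next i) ≡ v)
  where

  -- Once the position (b, i) is flattened to one index, a class is a self-map of `Fin (2 * m)`, and
  -- covering makes it injective. For b = b′ this says that a cycle repeats no vertex, for b ≠ b′
  -- that the two cycles of a class are disjoint.
  vertex-injective : ∀ c {b i b′ i′} → vertex c b i ≡ vertex c b′ i′ → b ≡ b′ × i ≡ i′
  vertex-injective c {b} {i} {b′} {i′} eq =
    combine-injective b i b′ i′ (surjective⇒injective refl at-surjective
      (trans (at-combine b i) (trans eq (sym (at-combine b′ i′)))))
    where
    at : Fin (2 * m) → Fin (2 * m)
    at = uncurry (vertex c) ∘ remQuot m

    at-combine : ∀ b i → at (combine b i) ≡ vertex c b i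
    at-combine b i = cong (uncurry (vertex c)) (remQuot-combine b i)

    at-surjective : ∀ v → ∃ λ p → at p ≡ v
    at-surjective v with b , i , eq ← vertices-covered c v =
      combine b i , trans (at-combine b i) eq

  -- Read off at the position of `u` that the covering happens to supply; `successor-vertex` shows
  -- that every other description of that position gives the same value.
  successor : Fin r → Fin (2 * m) → Fin (2 * m)
  successor c u = let b , i , _ = vertices-covered c u in vertex c b (next i)

  successor-vertex : ∀ c {b i u v} → vertex c b i ≡ u → vertex c b (next i) ≡ v →
                     successor c u ≡ v
  successor-vertex c {b} {i} {u} at-u at-v
    with b′ , i′ , at-u′ ← vertices-covered c u
    with refl , refl ← vertex-injective c {b′} {i′} {b} {i} (trans at-u′ (sym at-u))
    = at-v

  -- The index `zero` stands in for the missing loop at `u`. It raises the number of indices to that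
  -- of the vertices, which is what the counting needs.
  successor⁺ : Fin (2 * m) → Fin (suc r) → Fin (2 * m)
  successor⁺ u zero    = u
  successor⁺ u (suc c) = successor c u

  successor⁺-surjective : ∀ u v → ∃ λ c → successor⁺ u c ≡ v
  successor⁺-surjective u v with u ≟ v
  ... | yes u≡v = zero , u≡v
  ... | no  u≢v with c , b , i , at-u , at-v ← arcs-covered u v u≢v
    = suc c , successor-vertex c at-u at-v

  -- Distinct classes leave `u` along distinct arcs, so an arc determines its class.
  successor-injective : ∀ u {c c′} → successor c u ≡ successor c′ u → c ≡ c′
  successor-injective u eq
    with refl ← surjective⇒injective size (successor⁺-surjective u) {suc _} {suc _} eq = refl

  decomposition : ResolvableCycleDecomposition (2 * m) m
  decomposition = record
    { N            = r * 2
    ; cyc          = cycle ∘ remQuot 2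
    ; r            = r
    ; class        = proj₁ ∘ remQuot {r} 2
    ; arc-covered  = λ u v u≢v →
        let c , b , i , arc = arcs-covered u v u≢v in
        combine c b , subst (λ cb → ArcOf (cycle cb) u v) (sym (remQuot-combine c b)) (i , arc)
    ; arc-unique   = λ u v j j′ arc arc′ → remQuot-injective (arc-unique′ u v _ _ arc arc′)
    ; class-covers = λ c v →
        let b , on = vertices-covered c v in
        combine c b , cong proj₁ (remQuot-combine c b) ,
        subst (λ cb → OnCycle (cycle cb) v) (sym (remQuot-combine c b)) on
    ; class-unique = λ c v j j′ j∈c on j′∈c on′ →
        remQuot-injective (class-unique′ v _ _ (trans j∈c (sym j′∈c)) on on′)
    }
    where
    cycle : Fin r × Fin 2 → DiCycle (2 * m) m
    cycle (c , b) = record { vtx = vertex c b ; inj = proj₂ ∘ vertex-injective c }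

    remQuot-injective : ∀ {j j′} → remQuot {r} 2 j ≡ remQuot 2 j′ → j ≡ j′
    remQuot-injective {j} {j′} eq =
      trans (sym (combine-remQuot {r} 2 j))
        (trans (cong (uncurry combine) eq) (combine-remQuot {r} 2 j′))

    class-unique′ : ∀ v cb cb′ → proj₁ cb ≡ proj₁ cb′ →
                    OnCycle (cycle cb) v → OnCycle (cycle cb′) v → cb ≡ cb′
    class-unique′ v (c , _) (_ , _) refl (i , at-v) (i′ , at-v′) =
      cong (c ,_) (proj₁ (vertex-injective c (trans at-v (sym at-v′))))

    -- The arc fixes the class, since different classes have different successors at `u`; inside
    -- that class, `u` alone fixes the cycle.
    arc-unique′ : ∀ u v cb cb′ → ArcOf (cycle cb) u v → ArcOf (cycle cb′) u v → cb ≡ cb′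
    arc-unique′ u v cb@(c , _) cb′@(c′ , _) (i , at-u , at-v) (i′ , at-u′ , at-v′) =
      class-unique′ u cb cb′
        (successor-injective u
          (trans (successor-vertex c at-u at-v) (sym (successor-vertex c′ at-u′ at-v′))))
        (i , at-u) (i′ , at-u′)

-- Successors along cycles given as vectors of numbers.

first : ∀ {A : Set} {k} → A → Vec A k → A
first z []      = z
first z (x ∷ _) = x

-- The entry after u in the vector, where z follows the last entry; d if u does not occur.
follow : ∀ {k} → ℕ → ℕ → ℕ → Vec ℕ k → ℕ
follow u d z []       = d
follow u d z (x ∷ xs) = if u ≡ᵇ x then first z xs else follow u d z xs

first-∷ʳ : ∀ {k} (z : ℕ) (xs : Vec ℕ k) → lookup (xs ∷ʳ z) zero ≡ first z xs
first-∷ʳ z []      = refl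
first-∷ʳ z (_ ∷ _) = refl

-- Appending `z` makes the return to the start an ordinary step from `i` to `suc i`, a form that
-- survives the recursion on `xs`. The wrap-around in `next` is recovered afterwards by
-- `lookup-next`.
follow-index : ∀ {k} u d z (xs : Vec ℕ k) → follow u d z xs ≡ d ⊎
               ∃ λ i → lookup xs i ≡ u × lookup (xs ∷ʳ z) (suc i) ≡ follow u d z xs
follow-index u d z []       = inj₁ refl
follow-index u d z (x ∷ xs) with u ≡ᵇ x in eq
... | true  = inj₂ (zero , sym (≡ᵇ⇒≡ u x (subst T (sym eq) _)) , first-∷ʳ z xs)
... | false with follow-index u d z xs
...   | inj₁ eq′            = inj₁ eq′
...   | inj₂ (i , at , then) = inj₂ (suc i , at , then)

lookup-∷ʳ-fromℕ< : ∀ {k} (xs : Vec ℕ k) z (i : Fin (suc k)) (i<k : toℕ i ℕ.< k) →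
                   lookup (xs ∷ʳ z) i ≡ lookup xs (fromℕ< i<k)
lookup-∷ʳ-fromℕ< (x ∷ xs) z zero    _         = refl
lookup-∷ʳ-fromℕ< (x ∷ xs) z (suc i) (s≤s i<k) = lookup-∷ʳ-fromℕ< xs z i i<k

lookup-∷ʳ-last : ∀ {k} (xs : Vec ℕ k) z (i : Fin (suc k)) → k ≤ toℕ i →
                 lookup (xs ∷ʳ z) i ≡ z
lookup-∷ʳ-last []       z zero    _         = refl
lookup-∷ʳ-last (x ∷ xs) z (suc i) (s≤s k≤i) = lookup-∷ʳ-last xs z i k≤i

-- The split is on the test that defines `next`. If it succeeds, the appended entry is not reached;
-- if it fails, `suc i` points exactly at that entry, which is the head.
lookup-next : ∀ {k} (xs : Vec ℕ (suc k)) i → lookup (xs ∷ʳ head xs) (suc i) ≡ lookup xs (next i)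
lookup-next {k} xs@(x ∷ _) i with suc (toℕ i) <? suc k
... | yes i<k = lookup-∷ʳ-fromℕ< xs x (suc i) i<k
... | no  i≮k = lookup-∷ʳ-last xs x (suc i) (≮⇒≥ i≮k)

TwoCycles : ℕ → Set
TwoCycles m = Vec (Vec ℕ m) 2

-- The successor of u; u itself if u lies on no cycle.
image : ∀ {k l} → ℕ → Vec (Vec ℕ (suc k)) l → ℕ
image u []       = u
image u (xs ∷ c) = follow u (image u c) (head xs) xs

-- The search in one cycle has the search in the remaining cycles as its default, so a miss hands
-- over to the induction hypothesis, and only a miss in all cycles returns `u`.
image-index : ∀ {k l} u (c : Vec (Vec ℕ (suc k)) l) → image u c ≡ u ⊎
              ∃₂ λ b i → lookup (lookup c b) i ≡ u × lookup (lookup c b) (next i) ≡ image u c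
image-index u []       = inj₁ refl
image-index u (xs ∷ c) with follow-index u (image u c) (head xs) xs
... | inj₂ (i , at , then) = inj₂ (zero , i , at , trans (sym (lookup-next xs i)) then)
... | inj₁ eq with image-index u c
...   | inj₁ eq′                = inj₁ (trans eq eq′)
...   | inj₂ (b , i , at , then) = inj₂ (suc b , i , at , trans then (sym eq))

-- Boolean certificates and their soundness.

entries : ∀ {m} → TwoCycles m → List ℕ
entries = Vec.toList ∘ Vec.concat

-- The leading `u` takes the place of the loop. It is also the value of `image` at a miss, so a
-- missing arc contributes nothing new and cannot help the list to exhaust the vertices.
images : ∀ {k} → List (TwoCycles (suc k)) → ℕ → List ℕ
images cs u = u ∷ List.map (image u) cs

-- Plain Booleans on ℕ, much faster to evaluate than decision procedures on Fin.
exhausts : ℕ → List ℕ → Bool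
exhausts n vs = all (λ v → any (v ≡ᵇ_) vs) (upTo n)

exhausts-sound : ∀ n vs → T (exhausts n vs) → ∀ {v} → v < n → v ∈ vs
exhausts-sound n vs t {v} v<n =
  AnyList.map (λ {x} → ≡ᵇ⇒≡ v x) (any⁻ (v ≡ᵇ_) vs (All.lookup (all⁺ _ (upTo n) t) (∈-upTo⁺ v<n)))

-- Everything that has to be known about one m. The two tests ask for covering only, but they are
-- tight: a class has exactly `n` entries by its type, and by `size` each list `images cs u` has
-- exactly `n` elements.
record Covering (k : ℕ) (cs : List (TwoCycles (suc k))) : Set where
  n : ℕ
  n = 2 * suc k
  field
    size     : suc (length cs) ≡ n
    vertices : T (all (λ c → exhausts n (entries c)) cs)
    arcs     : T (all (λ u → exhausts n (images cs u)) (upTo n))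

toℕ-mod : ∀ {n} .{{_ : NonZero n}} (v : Fin n) → toℕ v mod n ≡ v
toℕ-mod {n} v = trans (fromℕ<-cong _ _ (m<n⇒m%n≡m (toℕ<n v)) _ (toℕ<n v)) (fromℕ<-toℕ v (toℕ<n v))

module _ {k} {cs : List (TwoCycles (suc k))} (cov : Covering k cs) where
  open Covering cov

  -- Reduction mod `n` makes a vertex of any number, so no range check on the data is required. It
  -- changes nothing at the entries that the tests exhibit, each of which equals some `toℕ v`.
  vertex : Fin (length cs) → Fin 2 → Fin (suc k) → Fin n
  vertex c b i = lookup (lookup (List.lookup cs c) b) i mod n

  vertex-toℕ : ∀ {c b i} {v : Fin n} → lookup (lookup (List.lookup cs c) b) i ≡ toℕ v →
               vertex c b i ≡ v
  vertex-toℕ {v = v} eq = trans (cong (_mod n) eq) (toℕ-mod v)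

  vertices-covered : ∀ c v → ∃₂ λ b i → vertex c b i ≡ v
  vertices-covered c v =
    AnyVec.index on , AnyVec.index on′ , vertex-toℕ {c} (sym (AnyVec.lookup-index on′))
    where
    -- Membership in the concatenation splits into the cycle, the index of `on`, and the position on
    -- that cycle, the index of `on′`.
    on  = AnyVec.concat⁻ (List.lookup cs c) (∈-toList⁻
            (exhausts-sound n (entries (List.lookup cs c))
              (All.lookup (all⁺ _ cs vertices) (∈-lookup c)) (toℕ<n v)))
    on′ = AnyVec.lookup-index on

  arcs-covered : ∀ u v → u ≢ v →
    ∃ λ c → ∃₂ λ b i → vertex c b i ≡ u × vertex c b (next i) ≡ v
  arcs-covered u v u≢v
    with exhausts-sound n (images cs (toℕ u))
           (All.lookup (all⁺ _ (upTo n) arcs) (∈-upTo⁺ (toℕ<n u))) (toℕ<n v)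
  ... | here v≡u  = contradiction (sym (toℕ-injective v≡u)) u≢v
  ... | there v∈ with c , c∈cs , v≡image ← ∈-map⁻ (image (toℕ u)) v∈
                 with image-index (toℕ u) c
  -- Here `image` may have fallen back on its default; then `v` would be `u` itself.
  ...   | inj₁ image≡u = contradiction (sym (toℕ-injective (trans v≡image image≡u))) u≢v
  -- The class `c` comes as a member of `cs`; the arc is transported to the lookup at its index, the
  -- form in which `vertex` refers to classes.
  ...   | inj₂ arc with b , i , at , then ← subst
            (λ c → ∃₂ λ b i → lookup (lookup c b) i ≡ toℕ u ×
                              lookup (lookup c b) (next i) ≡ image (toℕ u) c)
            (AnyList.lookup-index c∈cs) arc
    = AnyList.index c∈cs , b , i , vertex-toℕ {AnyList.index c∈cs} at ,
      vertex-toℕ {AnyList.index c∈cs}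
        (trans then (trans (cong (image (toℕ u)) (sym (AnyList.lookup-index c∈cs))) (sym v≡image)))

  decomposition : ResolvableCycleDecomposition n (suc k)
  decomposition = FromCovering.decomposition size vertex vertices-covered arcs-covered

-- Developing starters by rotation.

-- x_e ↦ (x + s)_e, where x_e is coded as 2x + e and ∞ as m ∸ 1.
rotate : ℕ → ℕ → ℕ → ℕ
rotate (suc (suc q)) s v = let p = 2 * suc q in if v <ᵇ p then (v + 2 * s) % p else v
rotate _ _ v = v

-- The shifts are 2, 4, ..., m - 3: shift 0 is left out because the fixed classes occupy the first
-- blow-up. Five fixed classes and four starters thus give 5 + 4 · (m - 3)/2 = 2m - 1 classes.
develop : ∀ m → List (TwoCycles m) → List (TwoCycles m) → List (TwoCycles m)
develop m fixed starters = fixed List.++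
  concatMap (λ j → List.map (Vec.map (Vec.map (rotate m (2 * suc j)))) starters) (upTo ((m ∸ 3) / 2))

-- The checks are implicit arguments: evaluation turns them into ⊤.
resolve : ∀ k fixed starters → let n = 2 * suc k; cs = develop (suc k) fixed starters in
          suc (length cs) ≡ n →
          {T (all (λ c → exhausts n (entries c)) cs)} →
          {T (all (λ u → exhausts n (images cs u)) (upTo n))} →
          ResolvableCycleDecomposition n (suc k)
resolve k fixed starters size {vertices} {arcs} = decomposition
  {cs = develop (suc k) fixed starters} (record { size = size ; vertices = vertices ; arcs = arcs })

-- The designs for m = 5, 7, ..., 49.

K*10 : ResolvableCycleDecomposition 10 5
K*10 = resolve 4
  (((0 ∷ 6 ∷ 1 ∷ 9 ∷ 3 ∷ []) ∷
    (2 ∷ 5 ∷ 4 ∷ 7 ∷ 8 ∷ []) ∷ []) ∷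
   ((0 ∷ 1 ∷ 8 ∷ 3 ∷ 2 ∷ []) ∷
    (4 ∷ 9 ∷ 7 ∷ 5 ∷ 6 ∷ []) ∷ []) ∷
   ((0 ∷ 7 ∷ 3 ∷ 8 ∷ 6 ∷ []) ∷
    (1 ∷ 5 ∷ 9 ∷ 4 ∷ 2 ∷ []) ∷ []) ∷
   ((0 ∷ 8 ∷ 9 ∷ 6 ∷ 5 ∷ []) ∷
    (1 ∷ 7 ∷ 2 ∷ 4 ∷ 3 ∷ []) ∷ []) ∷
   ((0 ∷ 2 ∷ 6 ∷ 7 ∷ 9 ∷ []) ∷
    (1 ∷ 3 ∷ 5 ∷ 8 ∷ 4 ∷ []) ∷ []) ∷
   ((0 ∷ 4 ∷ 8 ∷ 7 ∷ 1 ∷ []) ∷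
    (2 ∷ 3 ∷ 6 ∷ 9 ∷ 5 ∷ []) ∷ []) ∷
   ((0 ∷ 3 ∷ 9 ∷ 2 ∷ 7 ∷ []) ∷
    (1 ∷ 4 ∷ 6 ∷ 8 ∷ 5 ∷ []) ∷ []) ∷
   ((0 ∷ 9 ∷ 1 ∷ 2 ∷ 8 ∷ []) ∷
    (3 ∷ 4 ∷ 5 ∷ 7 ∷ 6 ∷ []) ∷ []) ∷
   ((0 ∷ 5 ∷ 3 ∷ 7 ∷ 4 ∷ []) ∷
    (1 ∷ 6 ∷ 2 ∷ 9 ∷ 8 ∷ []) ∷ []) ∷
   [])
  -- Without starters `develop` adds nothing; the nine classes above are already 2 · 5 - 1.
  []
  refl

K*14 : ResolvableCycleDecomposition 14 7
K*14 = resolve 6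
  (((0 ∷ 6 ∷ 10 ∷ 9 ∷ 7 ∷ 11 ∷ 4 ∷ []) ∷
    -- The steps 3, 2 and 12, 13 are 1_1 → 1_0 and ∞_0 → ∞_1, arcs of the 2-cycles that the fixed
    -- classes absorb.
    (1 ∷ 3 ∷ 2 ∷ 5 ∷ 8 ∷ 12 ∷ 13 ∷ []) ∷ []) ∷
   ((0 ∷ 2 ∷ 11 ∷ 9 ∷ 8 ∷ 6 ∷ 12 ∷ []) ∷
    (1 ∷ 7 ∷ 13 ∷ 3 ∷ 10 ∷ 5 ∷ 4 ∷ []) ∷ []) ∷
   ((0 ∷ 1 ∷ 6 ∷ 7 ∷ 10 ∷ 11 ∷ 5 ∷ []) ∷
    (2 ∷ 3 ∷ 4 ∷ 8 ∷ 9 ∷ 13 ∷ 12 ∷ []) ∷ []) ∷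
   ((0 ∷ 3 ∷ 11 ∷ 8 ∷ 7 ∷ 12 ∷ 1 ∷ []) ∷
    (2 ∷ 10 ∷ 4 ∷ 5 ∷ 9 ∷ 6 ∷ 13 ∷ []) ∷ []) ∷
   ((0 ∷ 7 ∷ 6 ∷ 11 ∷ 10 ∷ 8 ∷ 13 ∷ []) ∷
    (1 ∷ 2 ∷ 4 ∷ 9 ∷ 12 ∷ 3 ∷ 5 ∷ []) ∷ []) ∷
   [])
  -- Over ℤ_6, H is (0, 1, 5, 2, 4, 3, ∞) and H + 1 is (1, 2, 0, 3, 5, 4, ∞). The entries 0, 3, 11
  -- read 0_0, 1_1, 5_1 and follow H; the next step, to 9 or 4_1, belongs to H + 1.
  (((0 ∷ 3 ∷ 11 ∷ 9 ∷ 13 ∷ 2 ∷ 5 ∷ []) ∷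
    (1 ∷ 7 ∷ 10 ∷ 4 ∷ 8 ∷ 6 ∷ 12 ∷ []) ∷ []) ∷
   ((0 ∷ 7 ∷ 11 ∷ 8 ∷ 12 ∷ 2 ∷ 4 ∷ []) ∷
    (1 ∷ 3 ∷ 10 ∷ 5 ∷ 9 ∷ 6 ∷ 13 ∷ []) ∷ []) ∷
   ((0 ∷ 6 ∷ 11 ∷ 4 ∷ 9 ∷ 7 ∷ 12 ∷ []) ∷
    (1 ∷ 2 ∷ 10 ∷ 8 ∷ 13 ∷ 3 ∷ 5 ∷ []) ∷ []) ∷
   ((0 ∷ 2 ∷ 11 ∷ 5 ∷ 8 ∷ 7 ∷ 13 ∷ []) ∷
    (1 ∷ 6 ∷ 10 ∷ 9 ∷ 12 ∷ 3 ∷ 4 ∷ []) ∷ []) ∷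
   [])
  -- 5 fixed classes and 2 rotations of 4 starters make 13, one less than the number of vertices.
  refl

K*18 : ResolvableCycleDecomposition 18 9
K*18 = resolve 8
  (((0 ∷ 3 ∷ 14 ∷ 9 ∷ 16 ∷ 17 ∷ 1 ∷ 2 ∷ 5 ∷ []) ∷
    (4 ∷ 12 ∷ 11 ∷ 10 ∷ 8 ∷ 13 ∷ 6 ∷ 7 ∷ 15 ∷ []) ∷ []) ∷
   ((0 ∷ 7 ∷ 14 ∷ 8 ∷ 12 ∷ 6 ∷ 15 ∷ 5 ∷ 1 ∷ []) ∷
    (2 ∷ 3 ∷ 4 ∷ 13 ∷ 10 ∷ 11 ∷ 9 ∷ 17 ∷ 16 ∷ []) ∷ []) ∷
   ((0 ∷ 1 ∷ 7 ∷ 6 ∷ 11 ∷ 16 ∷ 3 ∷ 5 ∷ 4 ∷ []) ∷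
    (2 ∷ 14 ∷ 15 ∷ 8 ∷ 9 ∷ 13 ∷ 12 ∷ 10 ∷ 17 ∷ []) ∷ []) ∷
   ((0 ∷ 2 ∷ 4 ∷ 1 ∷ 6 ∷ 10 ∷ 9 ∷ 8 ∷ 16 ∷ []) ∷
    (3 ∷ 15 ∷ 14 ∷ 5 ∷ 12 ∷ 13 ∷ 7 ∷ 11 ∷ 17 ∷ []) ∷ []) ∷
   ((0 ∷ 6 ∷ 14 ∷ 4 ∷ 5 ∷ 13 ∷ 11 ∷ 8 ∷ 17 ∷ []) ∷
    (1 ∷ 3 ∷ 2 ∷ 15 ∷ 9 ∷ 12 ∷ 7 ∷ 10 ∷ 16 ∷ []) ∷ []) ∷
   [])
  (((0 ∷ 7 ∷ 11 ∷ 8 ∷ 17 ∷ 1 ∷ 3 ∷ 15 ∷ 5 ∷ []) ∷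
    (2 ∷ 4 ∷ 13 ∷ 6 ∷ 14 ∷ 9 ∷ 12 ∷ 10 ∷ 16 ∷ []) ∷ []) ∷
   ((0 ∷ 2 ∷ 14 ∷ 5 ∷ 1 ∷ 6 ∷ 10 ∷ 8 ∷ 16 ∷ []) ∷
    (3 ∷ 4 ∷ 12 ∷ 7 ∷ 15 ∷ 9 ∷ 13 ∷ 11 ∷ 17 ∷ []) ∷ []) ∷
   ((0 ∷ 3 ∷ 5 ∷ 13 ∷ 10 ∷ 17 ∷ 2 ∷ 15 ∷ 4 ∷ []) ∷
    (1 ∷ 7 ∷ 14 ∷ 8 ∷ 12 ∷ 6 ∷ 11 ∷ 9 ∷ 16 ∷ []) ∷ []) ∷
   ((0 ∷ 6 ∷ 15 ∷ 8 ∷ 13 ∷ 7 ∷ 10 ∷ 9 ∷ 17 ∷ []) ∷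
    (1 ∷ 2 ∷ 5 ∷ 12 ∷ 11 ∷ 16 ∷ 3 ∷ 14 ∷ 4 ∷ []) ∷ []) ∷
   [])
  refl

K*22 : ResolvableCycleDecomposition 22 11
K*22 = resolve 10
  (((0 ∷ 2 ∷ 4 ∷ 17 ∷ 10 ∷ 11 ∷ 21 ∷ 3 ∷ 18 ∷ 19 ∷ 5 ∷ []) ∷
    (1 ∷ 6 ∷ 14 ∷ 8 ∷ 9 ∷ 16 ∷ 7 ∷ 15 ∷ 13 ∷ 12 ∷ 20 ∷ []) ∷ []) ∷
   ((0 ∷ 3 ∷ 4 ∷ 5 ∷ 17 ∷ 7 ∷ 6 ∷ 15 ∷ 9 ∷ 13 ∷ 20 ∷ []) ∷
    (1 ∷ 2 ∷ 19 ∷ 18 ∷ 8 ∷ 16 ∷ 11 ∷ 10 ∷ 14 ∷ 12 ∷ 21 ∷ []) ∷ []) ∷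
   ((0 ∷ 6 ∷ 19 ∷ 4 ∷ 16 ∷ 17 ∷ 11 ∷ 15 ∷ 14 ∷ 13 ∷ 21 ∷ []) ∷
    (1 ∷ 7 ∷ 18 ∷ 9 ∷ 8 ∷ 12 ∷ 10 ∷ 20 ∷ 3 ∷ 2 ∷ 5 ∷ []) ∷ []) ∷
   ((0 ∷ 7 ∷ 14 ∷ 9 ∷ 17 ∷ 16 ∷ 6 ∷ 18 ∷ 5 ∷ 4 ∷ 1 ∷ []) ∷
    (2 ∷ 3 ∷ 19 ∷ 8 ∷ 13 ∷ 10 ∷ 15 ∷ 12 ∷ 11 ∷ 20 ∷ 21 ∷ []) ∷ []) ∷
   ((0 ∷ 1 ∷ 3 ∷ 5 ∷ 16 ∷ 10 ∷ 21 ∷ 20 ∷ 2 ∷ 18 ∷ 4 ∷ []) ∷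
    (6 ∷ 7 ∷ 19 ∷ 9 ∷ 12 ∷ 13 ∷ 11 ∷ 14 ∷ 15 ∷ 8 ∷ 17 ∷ []) ∷ []) ∷
   [])
  (((0 ∷ 2 ∷ 19 ∷ 9 ∷ 16 ∷ 10 ∷ 15 ∷ 8 ∷ 12 ∷ 11 ∷ 21 ∷ []) ∷
    (1 ∷ 7 ∷ 18 ∷ 5 ∷ 17 ∷ 6 ∷ 14 ∷ 13 ∷ 20 ∷ 3 ∷ 4 ∷ []) ∷ []) ∷
   ((0 ∷ 7 ∷ 14 ∷ 8 ∷ 13 ∷ 11 ∷ 15 ∷ 12 ∷ 20 ∷ 2 ∷ 4 ∷ []) ∷
    (1 ∷ 3 ∷ 19 ∷ 5 ∷ 16 ∷ 6 ∷ 18 ∷ 9 ∷ 17 ∷ 10 ∷ 21 ∷ []) ∷ []) ∷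
   ((0 ∷ 3 ∷ 18 ∷ 4 ∷ 16 ∷ 11 ∷ 14 ∷ 9 ∷ 12 ∷ 10 ∷ 20 ∷ []) ∷
    (1 ∷ 6 ∷ 19 ∷ 8 ∷ 17 ∷ 7 ∷ 15 ∷ 13 ∷ 21 ∷ 2 ∷ 5 ∷ []) ∷ []) ∷
   ((0 ∷ 6 ∷ 15 ∷ 9 ∷ 13 ∷ 10 ∷ 14 ∷ 12 ∷ 21 ∷ 3 ∷ 5 ∷ []) ∷
    (1 ∷ 2 ∷ 18 ∷ 8 ∷ 16 ∷ 7 ∷ 19 ∷ 4 ∷ 17 ∷ 11 ∷ 20 ∷ []) ∷ []) ∷
   [])
  refl

K*26 : ResolvableCycleDecomposition 26 13
K*26 = resolve 12
  (((0 ∷ 3 ∷ 23 ∷ 8 ∷ 17 ∷ 10 ∷ 14 ∷ 13 ∷ 16 ∷ 15 ∷ 12 ∷ 24 ∷ 25 ∷ []) ∷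
    (1 ∷ 2 ∷ 5 ∷ 21 ∷ 11 ∷ 19 ∷ 18 ∷ 9 ∷ 20 ∷ 6 ∷ 7 ∷ 22 ∷ 4 ∷ []) ∷ []) ∷
   ((0 ∷ 6 ∷ 19 ∷ 9 ∷ 21 ∷ 10 ∷ 18 ∷ 12 ∷ 13 ∷ 17 ∷ 14 ∷ 24 ∷ 1 ∷ []) ∷
    (2 ∷ 4 ∷ 5 ∷ 20 ∷ 7 ∷ 23 ∷ 22 ∷ 8 ∷ 16 ∷ 11 ∷ 15 ∷ 25 ∷ 3 ∷ []) ∷ []) ∷
   ((0 ∷ 7 ∷ 18 ∷ 19 ∷ 8 ∷ 20 ∷ 21 ∷ 6 ∷ 22 ∷ 5 ∷ 1 ∷ 3 ∷ 4 ∷ []) ∷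
    (2 ∷ 23 ∷ 9 ∷ 16 ∷ 14 ∷ 12 ∷ 17 ∷ 11 ∷ 10 ∷ 15 ∷ 13 ∷ 25 ∷ 24 ∷ []) ∷ []) ∷
   ((0 ∷ 1 ∷ 6 ∷ 23 ∷ 4 ∷ 20 ∷ 10 ∷ 11 ∷ 18 ∷ 13 ∷ 24 ∷ 3 ∷ 5 ∷ []) ∷
    (2 ∷ 22 ∷ 9 ∷ 8 ∷ 21 ∷ 7 ∷ 19 ∷ 12 ∷ 16 ∷ 17 ∷ 15 ∷ 14 ∷ 25 ∷ []) ∷ []) ∷
   ((0 ∷ 2 ∷ 3 ∷ 22 ∷ 23 ∷ 5 ∷ 4 ∷ 21 ∷ 20 ∷ 11 ∷ 14 ∷ 15 ∷ 24 ∷ []) ∷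
    (1 ∷ 7 ∷ 6 ∷ 18 ∷ 8 ∷ 9 ∷ 17 ∷ 16 ∷ 10 ∷ 19 ∷ 13 ∷ 12 ∷ 25 ∷ []) ∷ []) ∷
   [])
  (((0 ∷ 7 ∷ 18 ∷ 9 ∷ 21 ∷ 6 ∷ 22 ∷ 8 ∷ 16 ∷ 11 ∷ 14 ∷ 12 ∷ 24 ∷ []) ∷
    (1 ∷ 2 ∷ 5 ∷ 20 ∷ 10 ∷ 19 ∷ 13 ∷ 17 ∷ 15 ∷ 25 ∷ 3 ∷ 23 ∷ 4 ∷ []) ∷ []) ∷
   ((0 ∷ 2 ∷ 23 ∷ 5 ∷ 1 ∷ 6 ∷ 18 ∷ 8 ∷ 21 ∷ 11 ∷ 19 ∷ 12 ∷ 25 ∷ []) ∷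
    (3 ∷ 4 ∷ 20 ∷ 7 ∷ 22 ∷ 9 ∷ 17 ∷ 14 ∷ 13 ∷ 16 ∷ 10 ∷ 15 ∷ 24 ∷ []) ∷ []) ∷
   ((0 ∷ 6 ∷ 19 ∷ 8 ∷ 20 ∷ 11 ∷ 18 ∷ 13 ∷ 25 ∷ 1 ∷ 3 ∷ 22 ∷ 5 ∷ []) ∷
    (2 ∷ 4 ∷ 21 ∷ 7 ∷ 23 ∷ 9 ∷ 16 ∷ 15 ∷ 12 ∷ 17 ∷ 10 ∷ 14 ∷ 24 ∷ []) ∷ []) ∷
   ((0 ∷ 3 ∷ 5 ∷ 21 ∷ 10 ∷ 18 ∷ 12 ∷ 16 ∷ 14 ∷ 25 ∷ 2 ∷ 22 ∷ 4 ∷ []) ∷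
    (1 ∷ 7 ∷ 19 ∷ 9 ∷ 20 ∷ 6 ∷ 23 ∷ 8 ∷ 17 ∷ 11 ∷ 15 ∷ 13 ∷ 24 ∷ []) ∷ []) ∷
   [])
  refl

K*30 : ResolvableCycleDecomposition 30 15
K*30 = resolve 14
  (((0 ∷ 2 ∷ 26 ∷ 4 ∷ 25 ∷ 11 ∷ 23 ∷ 13 ∷ 17 ∷ 16 ∷ 28 ∷ 29 ∷ 1 ∷ 3 ∷ 5 ∷ []) ∷
    (6 ∷ 7 ∷ 27 ∷ 8 ∷ 21 ∷ 14 ∷ 15 ∷ 18 ∷ 19 ∷ 12 ∷ 20 ∷ 10 ∷ 22 ∷ 9 ∷ 24 ∷ []) ∷ []) ∷
   ((0 ∷ 1 ∷ 6 ∷ 23 ∷ 12 ∷ 13 ∷ 20 ∷ 11 ∷ 10 ∷ 19 ∷ 18 ∷ 16 ∷ 17 ∷ 14 ∷ 28 ∷ []) ∷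
    (2 ∷ 3 ∷ 26 ∷ 27 ∷ 5 ∷ 4 ∷ 24 ∷ 25 ∷ 7 ∷ 22 ∷ 8 ∷ 9 ∷ 21 ∷ 15 ∷ 29 ∷ []) ∷ []) ∷
   ((0 ∷ 7 ∷ 26 ∷ 9 ∷ 20 ∷ 21 ∷ 11 ∷ 22 ∷ 23 ∷ 8 ∷ 25 ∷ 6 ∷ 27 ∷ 4 ∷ 1 ∷ []) ∷
    (2 ∷ 5 ∷ 24 ∷ 10 ∷ 18 ∷ 13 ∷ 12 ∷ 17 ∷ 15 ∷ 19 ∷ 16 ∷ 14 ∷ 29 ∷ 28 ∷ 3 ∷ []) ∷ []) ∷
   ((0 ∷ 6 ∷ 22 ∷ 13 ∷ 21 ∷ 10 ∷ 11 ∷ 18 ∷ 12 ∷ 16 ∷ 15 ∷ 28 ∷ 1 ∷ 2 ∷ 4 ∷ []) ∷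
    (3 ∷ 27 ∷ 26 ∷ 5 ∷ 25 ∷ 24 ∷ 7 ∷ 23 ∷ 9 ∷ 8 ∷ 20 ∷ 14 ∷ 19 ∷ 17 ∷ 29 ∷ []) ∷ []) ∷
   ((0 ∷ 3 ∷ 4 ∷ 5 ∷ 1 ∷ 7 ∷ 6 ∷ 26 ∷ 8 ∷ 24 ∷ 11 ∷ 19 ∷ 13 ∷ 16 ∷ 29 ∷ []) ∷
    (2 ∷ 27 ∷ 9 ∷ 25 ∷ 10 ∷ 23 ∷ 22 ∷ 12 ∷ 21 ∷ 20 ∷ 15 ∷ 14 ∷ 18 ∷ 17 ∷ 28 ∷ []) ∷ []) ∷
   [])
  (((0 ∷ 2 ∷ 4 ∷ 25 ∷ 7 ∷ 22 ∷ 12 ∷ 17 ∷ 14 ∷ 19 ∷ 16 ∷ 28 ∷ 3 ∷ 26 ∷ 5 ∷ []) ∷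
    (1 ∷ 6 ∷ 27 ∷ 8 ∷ 20 ∷ 11 ∷ 23 ∷ 9 ∷ 24 ∷ 10 ∷ 18 ∷ 13 ∷ 21 ∷ 15 ∷ 29 ∷ []) ∷ []) ∷
   ((0 ∷ 7 ∷ 23 ∷ 8 ∷ 25 ∷ 11 ∷ 22 ∷ 13 ∷ 16 ∷ 14 ∷ 18 ∷ 12 ∷ 20 ∷ 15 ∷ 28 ∷ []) ∷
    (1 ∷ 2 ∷ 27 ∷ 5 ∷ 24 ∷ 6 ∷ 26 ∷ 9 ∷ 21 ∷ 10 ∷ 19 ∷ 17 ∷ 29 ∷ 3 ∷ 4 ∷ []) ∷ []) ∷
   ((0 ∷ 3 ∷ 5 ∷ 25 ∷ 6 ∷ 23 ∷ 13 ∷ 17 ∷ 15 ∷ 18 ∷ 16 ∷ 29 ∷ 2 ∷ 26 ∷ 4 ∷ []) ∷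
    (1 ∷ 7 ∷ 27 ∷ 9 ∷ 20 ∷ 10 ∷ 22 ∷ 8 ∷ 24 ∷ 11 ∷ 19 ∷ 12 ∷ 21 ∷ 14 ∷ 28 ∷ []) ∷ []) ∷
   ((0 ∷ 6 ∷ 22 ∷ 9 ∷ 25 ∷ 10 ∷ 23 ∷ 12 ∷ 16 ∷ 15 ∷ 19 ∷ 13 ∷ 20 ∷ 14 ∷ 29 ∷ []) ∷
    (1 ∷ 3 ∷ 27 ∷ 4 ∷ 24 ∷ 7 ∷ 26 ∷ 8 ∷ 21 ∷ 11 ∷ 18 ∷ 17 ∷ 28 ∷ 2 ∷ 5 ∷ []) ∷ []) ∷
   [])
  refl

K*34 : ResolvableCycleDecomposition 34 17
K*34 = resolve 16
  (((0 ∷ 6 ∷ 31 ∷ 9 ∷ 24 ∷ 15 ∷ 23 ∷ 12 ∷ 13 ∷ 25 ∷ 14 ∷ 19 ∷ 17 ∷ 32 ∷ 2 ∷ 30 ∷ 4 ∷ []) ∷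
    (1 ∷ 3 ∷ 5 ∷ 28 ∷ 7 ∷ 26 ∷ 27 ∷ 8 ∷ 29 ∷ 10 ∷ 11 ∷ 22 ∷ 16 ∷ 21 ∷ 20 ∷ 18 ∷ 33 ∷ []) ∷ []) ∷
   ((0 ∷ 3 ∷ 2 ∷ 31 ∷ 4 ∷ 29 ∷ 11 ∷ 23 ∷ 13 ∷ 24 ∷ 10 ∷ 26 ∷ 8 ∷ 28 ∷ 6 ∷ 30 ∷ 5 ∷ []) ∷
    (1 ∷ 7 ∷ 27 ∷ 9 ∷ 25 ∷ 15 ∷ 14 ∷ 22 ∷ 12 ∷ 21 ∷ 18 ∷ 16 ∷ 17 ∷ 20 ∷ 19 ∷ 33 ∷ 32 ∷ []) ∷ []) ∷
   ((0 ∷ 1 ∷ 2 ∷ 3 ∷ 4 ∷ 5 ∷ 29 ∷ 6 ∷ 7 ∷ 30 ∷ 31 ∷ 8 ∷ 24 ∷ 14 ∷ 18 ∷ 32 ∷ 33 ∷ []) ∷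
    (9 ∷ 28 ∷ 10 ∷ 23 ∷ 17 ∷ 21 ∷ 19 ∷ 16 ∷ 20 ∷ 15 ∷ 22 ∷ 13 ∷ 12 ∷ 25 ∷ 11 ∷ 27 ∷ 26 ∷ []) ∷ []) ∷
   ((0 ∷ 2 ∷ 4 ∷ 28 ∷ 29 ∷ 7 ∷ 31 ∷ 5 ∷ 1 ∷ 6 ∷ 26 ∷ 13 ∷ 21 ∷ 15 ∷ 18 ∷ 19 ∷ 32 ∷ []) ∷
    (3 ∷ 30 ∷ 9 ∷ 8 ∷ 25 ∷ 24 ∷ 11 ∷ 10 ∷ 27 ∷ 12 ∷ 20 ∷ 14 ∷ 23 ∷ 22 ∷ 17 ∷ 16 ∷ 33 ∷ []) ∷ []) ∷
   ((0 ∷ 7 ∷ 6 ∷ 27 ∷ 13 ∷ 20 ∷ 21 ∷ 14 ∷ 15 ∷ 19 ∷ 18 ∷ 17 ∷ 33 ∷ 2 ∷ 5 ∷ 4 ∷ 1 ∷ []) ∷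
    (3 ∷ 31 ∷ 30 ∷ 8 ∷ 9 ∷ 29 ∷ 28 ∷ 11 ∷ 26 ∷ 12 ∷ 24 ∷ 25 ∷ 10 ∷ 22 ∷ 23 ∷ 16 ∷ 32 ∷ []) ∷ []) ∷
   [])
  (((0 ∷ 7 ∷ 26 ∷ 9 ∷ 28 ∷ 11 ∷ 22 ∷ 12 ∷ 20 ∷ 14 ∷ 23 ∷ 16 ∷ 32 ∷ 1 ∷ 3 ∷ 30 ∷ 4 ∷ []) ∷
    (2 ∷ 5 ∷ 29 ∷ 6 ∷ 31 ∷ 8 ∷ 24 ∷ 10 ∷ 27 ∷ 13 ∷ 25 ∷ 15 ∷ 19 ∷ 17 ∷ 21 ∷ 18 ∷ 33 ∷ []) ∷ []) ∷
   ((0 ∷ 3 ∷ 31 ∷ 5 ∷ 1 ∷ 6 ∷ 30 ∷ 8 ∷ 25 ∷ 10 ∷ 26 ∷ 13 ∷ 20 ∷ 15 ∷ 18 ∷ 17 ∷ 33 ∷ []) ∷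
    (2 ∷ 4 ∷ 28 ∷ 7 ∷ 27 ∷ 9 ∷ 29 ∷ 11 ∷ 23 ∷ 12 ∷ 24 ∷ 14 ∷ 22 ∷ 16 ∷ 21 ∷ 19 ∷ 32 ∷ []) ∷ []) ∷
   ((0 ∷ 2 ∷ 30 ∷ 5 ∷ 28 ∷ 6 ∷ 27 ∷ 8 ∷ 29 ∷ 10 ∷ 22 ∷ 13 ∷ 21 ∷ 15 ∷ 23 ∷ 17 ∷ 32 ∷ []) ∷
    (1 ∷ 7 ∷ 31 ∷ 9 ∷ 24 ∷ 11 ∷ 26 ∷ 12 ∷ 25 ∷ 14 ∷ 18 ∷ 16 ∷ 20 ∷ 19 ∷ 33 ∷ 3 ∷ 4 ∷ []) ∷ []) ∷
   ((0 ∷ 6 ∷ 26 ∷ 8 ∷ 28 ∷ 10 ∷ 23 ∷ 13 ∷ 24 ∷ 15 ∷ 22 ∷ 17 ∷ 20 ∷ 18 ∷ 32 ∷ 3 ∷ 5 ∷ []) ∷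
    (1 ∷ 2 ∷ 31 ∷ 4 ∷ 29 ∷ 7 ∷ 30 ∷ 9 ∷ 25 ∷ 11 ∷ 27 ∷ 12 ∷ 21 ∷ 14 ∷ 19 ∷ 16 ∷ 33 ∷ []) ∷ []) ∷
   [])
  refl

K*38 : ResolvableCycleDecomposition 38 19
K*38 = resolve 18
  (((0 ∷ 2 ∷ 4 ∷ 1 ∷ 3 ∷ 35 ∷ 34 ∷ 5 ∷ 33 ∷ 6 ∷ 7 ∷ 31 ∷ 8 ∷ 28 ∷ 14 ∷ 22 ∷ 20 ∷ 37 ∷ 36 ∷ []) ∷
    (9 ∷ 32 ∷ 11 ∷ 27 ∷ 17 ∷ 21 ∷ 18 ∷ 19 ∷ 23 ∷ 16 ∷ 25 ∷ 24 ∷ 15 ∷ 26 ∷ 12 ∷ 13 ∷ 29 ∷ 10 ∷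
     30 ∷ []) ∷ []) ∷
   ((0 ∷ 6 ∷ 30 ∷ 13 ∷ 25 ∷ 15 ∷ 14 ∷ 23 ∷ 22 ∷ 17 ∷ 24 ∷ 19 ∷ 18 ∷ 36 ∷ 1 ∷ 7 ∷ 35 ∷ 5 ∷ 4 ∷ []) ∷
    (2 ∷ 34 ∷ 9 ∷ 8 ∷ 32 ∷ 33 ∷ 10 ∷ 31 ∷ 12 ∷ 28 ∷ 29 ∷ 11 ∷ 26 ∷ 27 ∷ 16 ∷ 20 ∷ 21 ∷ 37 ∷ 3 ∷
     []) ∷ []) ∷
   ((0 ∷ 7 ∷ 30 ∷ 12 ∷ 29 ∷ 14 ∷ 15 ∷ 27 ∷ 26 ∷ 17 ∷ 16 ∷ 21 ∷ 19 ∷ 22 ∷ 23 ∷ 20 ∷ 36 ∷ 3 ∷ 5 ∷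
     []) ∷
    (1 ∷ 2 ∷ 35 ∷ 4 ∷ 33 ∷ 32 ∷ 6 ∷ 34 ∷ 8 ∷ 9 ∷ 28 ∷ 10 ∷ 11 ∷ 31 ∷ 13 ∷ 24 ∷ 25 ∷ 18 ∷ 37 ∷ []) ∷ []) ∷
   ((0 ∷ 3 ∷ 34 ∷ 4 ∷ 32 ∷ 10 ∷ 27 ∷ 12 ∷ 24 ∷ 18 ∷ 23 ∷ 21 ∷ 20 ∷ 19 ∷ 36 ∷ 37 ∷ 2 ∷ 5 ∷ 1 ∷ []) ∷
    (6 ∷ 35 ∷ 8 ∷ 29 ∷ 15 ∷ 22 ∷ 16 ∷ 17 ∷ 25 ∷ 14 ∷ 26 ∷ 13 ∷ 28 ∷ 11 ∷ 30 ∷ 31 ∷ 9 ∷ 33 ∷ 7 ∷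
     []) ∷ []) ∷
   ((0 ∷ 1 ∷ 6 ∷ 31 ∷ 30 ∷ 8 ∷ 33 ∷ 11 ∷ 10 ∷ 26 ∷ 16 ∷ 24 ∷ 14 ∷ 27 ∷ 13 ∷ 12 ∷ 25 ∷ 19 ∷ 37 ∷
     []) ∷
    (2 ∷ 3 ∷ 4 ∷ 5 ∷ 32 ∷ 7 ∷ 34 ∷ 35 ∷ 9 ∷ 29 ∷ 28 ∷ 15 ∷ 23 ∷ 17 ∷ 20 ∷ 18 ∷ 22 ∷ 21 ∷ 36 ∷ []) ∷ []) ∷
   [])
  (((0 ∷ 6 ∷ 34 ∷ 9 ∷ 32 ∷ 11 ∷ 31 ∷ 12 ∷ 24 ∷ 14 ∷ 27 ∷ 13 ∷ 29 ∷ 10 ∷ 26 ∷ 16 ∷ 20 ∷ 18 ∷ 36 ∷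
     []) ∷
    (1 ∷ 3 ∷ 4 ∷ 33 ∷ 7 ∷ 30 ∷ 8 ∷ 28 ∷ 15 ∷ 23 ∷ 17 ∷ 25 ∷ 19 ∷ 22 ∷ 21 ∷ 37 ∷ 2 ∷ 35 ∷ 5 ∷ []) ∷ []) ∷
   ((0 ∷ 7 ∷ 35 ∷ 4 ∷ 32 ∷ 10 ∷ 27 ∷ 17 ∷ 21 ∷ 18 ∷ 23 ∷ 16 ∷ 25 ∷ 14 ∷ 22 ∷ 20 ∷ 36 ∷ 3 ∷ 5 ∷ []) ∷
    (1 ∷ 2 ∷ 34 ∷ 8 ∷ 33 ∷ 6 ∷ 31 ∷ 9 ∷ 29 ∷ 15 ∷ 26 ∷ 12 ∷ 28 ∷ 11 ∷ 30 ∷ 13 ∷ 24 ∷ 19 ∷ 37 ∷ []) ∷ []) ∷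
   ((0 ∷ 3 ∷ 35 ∷ 8 ∷ 32 ∷ 6 ∷ 30 ∷ 9 ∷ 28 ∷ 10 ∷ 31 ∷ 13 ∷ 25 ∷ 15 ∷ 22 ∷ 16 ∷ 24 ∷ 18 ∷ 37 ∷ []) ∷
    (1 ∷ 7 ∷ 34 ∷ 5 ∷ 33 ∷ 11 ∷ 27 ∷ 12 ∷ 29 ∷ 14 ∷ 26 ∷ 17 ∷ 20 ∷ 19 ∷ 23 ∷ 21 ∷ 36 ∷ 2 ∷ 4 ∷ []) ∷ []) ∷
   ((0 ∷ 2 ∷ 5 ∷ 32 ∷ 7 ∷ 31 ∷ 8 ∷ 29 ∷ 11 ∷ 26 ∷ 13 ∷ 28 ∷ 14 ∷ 23 ∷ 20 ∷ 37 ∷ 3 ∷ 34 ∷ 4 ∷ []) ∷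
    (1 ∷ 6 ∷ 35 ∷ 9 ∷ 33 ∷ 10 ∷ 30 ∷ 12 ∷ 25 ∷ 18 ∷ 22 ∷ 17 ∷ 24 ∷ 15 ∷ 27 ∷ 16 ∷ 21 ∷ 19 ∷ 36 ∷
     []) ∷ []) ∷
   [])
  refl

K*42 : ResolvableCycleDecomposition 42 21
K*42 = resolve 20
  (((0 ∷ 1 ∷ 7 ∷ 6 ∷ 38 ∷ 4 ∷ 36 ∷ 37 ∷ 11 ∷ 30 ∷ 31 ∷ 17 ∷ 28 ∷ 29 ∷ 18 ∷ 19 ∷ 27 ∷ 21 ∷ 40 ∷
     2 ∷ 5 ∷ []) ∷
    (3 ∷ 39 ∷ 8 ∷ 9 ∷ 33 ∷ 10 ∷ 35 ∷ 34 ∷ 13 ∷ 12 ∷ 32 ∷ 15 ∷ 14 ∷ 26 ∷ 16 ∷ 24 ∷ 23 ∷ 20 ∷ 25 ∷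
     22 ∷ 41 ∷ []) ∷ []) ∷
   ((0 ∷ 2 ∷ 4 ∷ 5 ∷ 36 ∷ 10 ∷ 11 ∷ 31 ∷ 12 ∷ 13 ∷ 29 ∷ 28 ∷ 14 ∷ 30 ∷ 16 ∷ 17 ∷ 24 ∷ 19 ∷ 23 ∷
     41 ∷ 1 ∷ []) ∷
    (3 ∷ 38 ∷ 39 ∷ 9 ∷ 37 ∷ 6 ∷ 7 ∷ 34 ∷ 35 ∷ 8 ∷ 32 ∷ 33 ∷ 15 ∷ 27 ∷ 26 ∷ 20 ∷ 21 ∷ 25 ∷ 18 ∷
     22 ∷ 40 ∷ []) ∷ []) ∷
   ((0 ∷ 6 ∷ 35 ∷ 9 ∷ 32 ∷ 14 ∷ 27 ∷ 16 ∷ 25 ∷ 23 ∷ 21 ∷ 24 ∷ 22 ∷ 20 ∷ 41 ∷ 40 ∷ 1 ∷ 3 ∷ 2 ∷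
     39 ∷ 4 ∷ []) ∷
    (5 ∷ 37 ∷ 10 ∷ 30 ∷ 12 ∷ 28 ∷ 19 ∷ 18 ∷ 26 ∷ 17 ∷ 29 ∷ 15 ∷ 31 ∷ 13 ∷ 33 ∷ 11 ∷ 34 ∷ 8 ∷ 36 ∷
     7 ∷ 38 ∷ []) ∷ []) ∷
   ((0 ∷ 7 ∷ 39 ∷ 38 ∷ 9 ∷ 8 ∷ 37 ∷ 36 ∷ 11 ∷ 35 ∷ 13 ∷ 28 ∷ 18 ∷ 27 ∷ 20 ∷ 24 ∷ 25 ∷ 19 ∷ 22 ∷
     23 ∷ 40 ∷ []) ∷
    (1 ∷ 6 ∷ 34 ∷ 12 ∷ 33 ∷ 32 ∷ 10 ∷ 31 ∷ 30 ∷ 17 ∷ 16 ∷ 29 ∷ 14 ∷ 15 ∷ 26 ∷ 21 ∷ 41 ∷ 2 ∷ 3 ∷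
     5 ∷ 4 ∷ []) ∷ []) ∷
   ((0 ∷ 3 ∷ 4 ∷ 37 ∷ 7 ∷ 35 ∷ 12 ∷ 29 ∷ 19 ∷ 26 ∷ 27 ∷ 17 ∷ 25 ∷ 24 ∷ 18 ∷ 23 ∷ 22 ∷ 21 ∷ 20 ∷
     40 ∷ 41 ∷ []) ∷
    (1 ∷ 2 ∷ 38 ∷ 8 ∷ 33 ∷ 14 ∷ 31 ∷ 16 ∷ 28 ∷ 15 ∷ 30 ∷ 13 ∷ 32 ∷ 11 ∷ 10 ∷ 34 ∷ 9 ∷ 36 ∷ 6 ∷
     39 ∷ 5 ∷ []) ∷ []) ∷
   [])
  (((0 ∷ 3 ∷ 38 ∷ 4 ∷ 1 ∷ 7 ∷ 39 ∷ 8 ∷ 36 ∷ 6 ∷ 35 ∷ 12 ∷ 32 ∷ 11 ∷ 31 ∷ 13 ∷ 28 ∷ 18 ∷ 26 ∷ 21 ∷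
     40 ∷ []) ∷
    (2 ∷ 5 ∷ 37 ∷ 10 ∷ 34 ∷ 9 ∷ 33 ∷ 15 ∷ 30 ∷ 16 ∷ 29 ∷ 14 ∷ 27 ∷ 17 ∷ 25 ∷ 19 ∷ 22 ∷ 20 ∷ 24 ∷
     23 ∷ 41 ∷ []) ∷ []) ∷
   ((0 ∷ 6 ∷ 39 ∷ 5 ∷ 36 ∷ 11 ∷ 34 ∷ 13 ∷ 32 ∷ 10 ∷ 31 ∷ 12 ∷ 29 ∷ 15 ∷ 27 ∷ 21 ∷ 24 ∷ 22 ∷ 41 ∷
     3 ∷ 4 ∷ []) ∷
    (1 ∷ 2 ∷ 38 ∷ 9 ∷ 37 ∷ 7 ∷ 35 ∷ 8 ∷ 33 ∷ 14 ∷ 30 ∷ 17 ∷ 28 ∷ 19 ∷ 26 ∷ 16 ∷ 25 ∷ 18 ∷ 23 ∷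
     20 ∷ 40 ∷ []) ∷ []) ∷
   ((0 ∷ 7 ∷ 34 ∷ 8 ∷ 37 ∷ 6 ∷ 38 ∷ 5 ∷ 1 ∷ 3 ∷ 39 ∷ 9 ∷ 32 ∷ 14 ∷ 26 ∷ 17 ∷ 29 ∷ 19 ∷ 27 ∷ 20 ∷
     41 ∷ []) ∷
    (2 ∷ 4 ∷ 36 ∷ 10 ∷ 35 ∷ 13 ∷ 33 ∷ 11 ∷ 30 ∷ 12 ∷ 28 ∷ 15 ∷ 31 ∷ 16 ∷ 24 ∷ 18 ∷ 22 ∷ 21 ∷ 25 ∷
     23 ∷ 40 ∷ []) ∷ []) ∷
   ((0 ∷ 2 ∷ 39 ∷ 4 ∷ 37 ∷ 11 ∷ 35 ∷ 9 ∷ 36 ∷ 7 ∷ 38 ∷ 8 ∷ 32 ∷ 15 ∷ 26 ∷ 20 ∷ 25 ∷ 22 ∷ 40 ∷ 3 ∷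
     5 ∷ []) ∷
    (1 ∷ 6 ∷ 34 ∷ 12 ∷ 33 ∷ 10 ∷ 30 ∷ 13 ∷ 29 ∷ 18 ∷ 27 ∷ 16 ∷ 28 ∷ 14 ∷ 31 ∷ 17 ∷ 24 ∷ 19 ∷ 23 ∷
     21 ∷ 41 ∷ []) ∷ []) ∷
   [])
  refl

K*46 : ResolvableCycleDecomposition 46 23
K*46 = resolve 22
  (((0 ∷ 3 ∷ 43 ∷ 9 ∷ 36 ∷ 14 ∷ 31 ∷ 16 ∷ 17 ∷ 33 ∷ 15 ∷ 34 ∷ 35 ∷ 13 ∷ 37 ∷ 11 ∷ 10 ∷ 38 ∷ 8 ∷
     41 ∷ 7 ∷ 42 ∷ 5 ∷ []) ∷
    (1 ∷ 2 ∷ 4 ∷ 40 ∷ 6 ∷ 39 ∷ 12 ∷ 32 ∷ 19 ∷ 18 ∷ 30 ∷ 20 ∷ 21 ∷ 29 ∷ 28 ∷ 22 ∷ 26 ∷ 27 ∷ 25 ∷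
     24 ∷ 23 ∷ 44 ∷ 45 ∷ []) ∷ []) ∷
   ((0 ∷ 7 ∷ 6 ∷ 42 ∷ 8 ∷ 9 ∷ 41 ∷ 40 ∷ 11 ∷ 34 ∷ 16 ∷ 29 ∷ 23 ∷ 26 ∷ 25 ∷ 45 ∷ 44 ∷ 1 ∷ 3 ∷ 2 ∷
     43 ∷ 5 ∷ 4 ∷ []) ∷
    (10 ∷ 39 ∷ 38 ∷ 13 ∷ 33 ∷ 19 ∷ 30 ∷ 21 ∷ 24 ∷ 22 ∷ 27 ∷ 20 ∷ 28 ∷ 18 ∷ 31 ∷ 17 ∷ 32 ∷ 14 ∷
     15 ∷ 35 ∷ 12 ∷ 36 ∷ 37 ∷ []) ∷ []) ∷
   ((0 ∷ 2 ∷ 42 ∷ 43 ∷ 4 ∷ 41 ∷ 10 ∷ 34 ∷ 13 ∷ 12 ∷ 33 ∷ 32 ∷ 15 ∷ 14 ∷ 30 ∷ 17 ∷ 29 ∷ 18 ∷ 27 ∷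
     26 ∷ 20 ∷ 24 ∷ 45 ∷ []) ∷
    (1 ∷ 6 ∷ 38 ∷ 9 ∷ 40 ∷ 7 ∷ 39 ∷ 8 ∷ 37 ∷ 36 ∷ 11 ∷ 35 ∷ 16 ∷ 28 ∷ 19 ∷ 31 ∷ 21 ∷ 25 ∷ 23 ∷
     22 ∷ 44 ∷ 3 ∷ 5 ∷ []) ∷ []) ∷
   ((0 ∷ 6 ∷ 7 ∷ 43 ∷ 8 ∷ 36 ∷ 10 ∷ 35 ∷ 17 ∷ 28 ∷ 29 ∷ 19 ∷ 27 ∷ 21 ∷ 20 ∷ 25 ∷ 22 ∷ 23 ∷ 45 ∷
     3 ∷ 42 ∷ 4 ∷ 1 ∷ []) ∷
    (2 ∷ 5 ∷ 40 ∷ 41 ∷ 11 ∷ 38 ∷ 39 ∷ 9 ∷ 37 ∷ 15 ∷ 31 ∷ 30 ∷ 16 ∷ 33 ∷ 14 ∷ 34 ∷ 12 ∷ 13 ∷ 32 ∷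
     18 ∷ 26 ∷ 24 ∷ 44 ∷ []) ∷ []) ∷
   ((0 ∷ 1 ∷ 7 ∷ 38 ∷ 12 ∷ 37 ∷ 14 ∷ 35 ∷ 34 ∷ 17 ∷ 16 ∷ 32 ∷ 33 ∷ 18 ∷ 19 ∷ 26 ∷ 21 ∷ 28 ∷ 23 ∷
     27 ∷ 24 ∷ 25 ∷ 44 ∷ []) ∷
    (2 ∷ 3 ∷ 4 ∷ 5 ∷ 41 ∷ 6 ∷ 43 ∷ 42 ∷ 9 ∷ 8 ∷ 40 ∷ 10 ∷ 11 ∷ 39 ∷ 13 ∷ 36 ∷ 15 ∷ 30 ∷ 31 ∷ 20 ∷
     29 ∷ 22 ∷ 45 ∷ []) ∷ []) ∷
   [])
  (((0 ∷ 3 ∷ 43 ∷ 5 ∷ 41 ∷ 11 ∷ 35 ∷ 13 ∷ 36 ∷ 10 ∷ 39 ∷ 12 ∷ 32 ∷ 18 ∷ 26 ∷ 21 ∷ 24 ∷ 23 ∷ 27 ∷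
     25 ∷ 45 ∷ 2 ∷ 4 ∷ []) ∷
    (1 ∷ 7 ∷ 42 ∷ 8 ∷ 40 ∷ 6 ∷ 38 ∷ 9 ∷ 37 ∷ 14 ∷ 31 ∷ 20 ∷ 28 ∷ 19 ∷ 30 ∷ 17 ∷ 33 ∷ 15 ∷ 34 ∷
     16 ∷ 29 ∷ 22 ∷ 44 ∷ []) ∷ []) ∷
   ((0 ∷ 2 ∷ 42 ∷ 5 ∷ 1 ∷ 6 ∷ 39 ∷ 9 ∷ 41 ∷ 7 ∷ 43 ∷ 8 ∷ 37 ∷ 11 ∷ 38 ∷ 13 ∷ 33 ∷ 19 ∷ 27 ∷ 21 ∷
     25 ∷ 23 ∷ 44 ∷ []) ∷
    (3 ∷ 4 ∷ 40 ∷ 10 ∷ 35 ∷ 16 ∷ 32 ∷ 14 ∷ 34 ∷ 12 ∷ 36 ∷ 15 ∷ 30 ∷ 20 ∷ 29 ∷ 18 ∷ 31 ∷ 17 ∷ 28 ∷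
     22 ∷ 26 ∷ 24 ∷ 45 ∷ []) ∷ []) ∷
   ((0 ∷ 6 ∷ 42 ∷ 4 ∷ 41 ∷ 10 ∷ 38 ∷ 12 ∷ 33 ∷ 14 ∷ 35 ∷ 17 ∷ 32 ∷ 19 ∷ 26 ∷ 20 ∷ 25 ∷ 22 ∷ 27 ∷
     24 ∷ 44 ∷ 3 ∷ 5 ∷ []) ∷
    (1 ∷ 2 ∷ 43 ∷ 9 ∷ 40 ∷ 7 ∷ 39 ∷ 8 ∷ 36 ∷ 11 ∷ 34 ∷ 13 ∷ 37 ∷ 15 ∷ 31 ∷ 16 ∷ 28 ∷ 18 ∷ 30 ∷
     21 ∷ 29 ∷ 23 ∷ 45 ∷ []) ∷ []) ∷
   ((0 ∷ 7 ∷ 38 ∷ 8 ∷ 41 ∷ 6 ∷ 43 ∷ 4 ∷ 1 ∷ 3 ∷ 42 ∷ 9 ∷ 36 ∷ 14 ∷ 30 ∷ 16 ∷ 33 ∷ 18 ∷ 27 ∷ 20 ∷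
     24 ∷ 22 ∷ 45 ∷ []) ∷
    (2 ∷ 5 ∷ 40 ∷ 11 ∷ 39 ∷ 13 ∷ 32 ∷ 15 ∷ 35 ∷ 12 ∷ 37 ∷ 10 ∷ 34 ∷ 17 ∷ 29 ∷ 19 ∷ 31 ∷ 21 ∷ 28 ∷
     23 ∷ 26 ∷ 25 ∷ 44 ∷ []) ∷ []) ∷
   [])
  refl

K*50 : ResolvableCycleDecomposition 50 25
K*50 = resolve 24
  (((0 ∷ 2 ∷ 47 ∷ 4 ∷ 44 ∷ 7 ∷ 42 ∷ 9 ∷ 45 ∷ 11 ∷ 43 ∷ 12 ∷ 37 ∷ 36 ∷ 19 ∷ 31 ∷ 30 ∷ 25 ∷ 24 ∷
     28 ∷ 29 ∷ 26 ∷ 49 ∷ 3 ∷ 5 ∷ []) ∷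
    (1 ∷ 6 ∷ 46 ∷ 8 ∷ 41 ∷ 14 ∷ 15 ∷ 39 ∷ 13 ∷ 40 ∷ 10 ∷ 38 ∷ 17 ∷ 16 ∷ 33 ∷ 18 ∷ 34 ∷ 35 ∷ 21 ∷
     20 ∷ 32 ∷ 22 ∷ 23 ∷ 27 ∷ 48 ∷ []) ∷ []) ∷
   ((0 ∷ 3 ∷ 4 ∷ 1 ∷ 7 ∷ 6 ∷ 47 ∷ 8 ∷ 9 ∷ 44 ∷ 11 ∷ 38 ∷ 13 ∷ 36 ∷ 18 ∷ 35 ∷ 34 ∷ 20 ∷ 29 ∷ 28 ∷
     22 ∷ 26 ∷ 27 ∷ 25 ∷ 49 ∷ []) ∷
    (2 ∷ 46 ∷ 5 ∷ 45 ∷ 10 ∷ 43 ∷ 42 ∷ 12 ∷ 41 ∷ 40 ∷ 15 ∷ 14 ∷ 39 ∷ 16 ∷ 17 ∷ 37 ∷ 19 ∷ 30 ∷ 21 ∷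
     33 ∷ 32 ∷ 23 ∷ 31 ∷ 24 ∷ 48 ∷ []) ∷ []) ∷
   ((0 ∷ 6 ∷ 43 ∷ 13 ∷ 37 ∷ 18 ∷ 31 ∷ 25 ∷ 28 ∷ 23 ∷ 30 ∷ 20 ∷ 21 ∷ 29 ∷ 22 ∷ 27 ∷ 26 ∷ 24 ∷ 49 ∷
     48 ∷ 3 ∷ 2 ∷ 4 ∷ 5 ∷ 1 ∷ []) ∷
    (7 ∷ 47 ∷ 46 ∷ 9 ∷ 41 ∷ 15 ∷ 35 ∷ 16 ∷ 32 ∷ 33 ∷ 19 ∷ 34 ∷ 17 ∷ 36 ∷ 14 ∷ 38 ∷ 39 ∷ 12 ∷ 40 ∷
     11 ∷ 10 ∷ 42 ∷ 8 ∷ 44 ∷ 45 ∷ []) ∷ []) ∷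
   ((0 ∷ 1 ∷ 3 ∷ 47 ∷ 9 ∷ 40 ∷ 14 ∷ 34 ∷ 16 ∷ 36 ∷ 37 ∷ 15 ∷ 38 ∷ 12 ∷ 13 ∷ 41 ∷ 11 ∷ 42 ∷ 43 ∷
     8 ∷ 45 ∷ 6 ∷ 7 ∷ 46 ∷ 4 ∷ []) ∷
    (2 ∷ 5 ∷ 44 ∷ 10 ∷ 39 ∷ 17 ∷ 32 ∷ 18 ∷ 19 ∷ 35 ∷ 20 ∷ 33 ∷ 22 ∷ 30 ∷ 31 ∷ 21 ∷ 28 ∷ 27 ∷ 24 ∷
     25 ∷ 29 ∷ 23 ∷ 26 ∷ 48 ∷ 49 ∷ []) ∷ []) ∷
   ((0 ∷ 7 ∷ 43 ∷ 9 ∷ 8 ∷ 40 ∷ 41 ∷ 10 ∷ 11 ∷ 39 ∷ 38 ∷ 16 ∷ 37 ∷ 14 ∷ 35 ∷ 17 ∷ 33 ∷ 23 ∷ 22 ∷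
     31 ∷ 20 ∷ 28 ∷ 26 ∷ 25 ∷ 48 ∷ []) ∷
    (1 ∷ 2 ∷ 3 ∷ 46 ∷ 47 ∷ 5 ∷ 4 ∷ 45 ∷ 44 ∷ 6 ∷ 42 ∷ 13 ∷ 12 ∷ 36 ∷ 15 ∷ 34 ∷ 21 ∷ 32 ∷ 19 ∷
     18 ∷ 30 ∷ 24 ∷ 29 ∷ 27 ∷ 49 ∷ []) ∷ []) ∷
   [])
  (((0 ∷ 3 ∷ 47 ∷ 9 ∷ 41 ∷ 11 ∷ 38 ∷ 13 ∷ 37 ∷ 19 ∷ 31 ∷ 21 ∷ 33 ∷ 18 ∷ 34 ∷ 16 ∷ 36 ∷ 14 ∷ 39 ∷
     17 ∷ 32 ∷ 22 ∷ 30 ∷ 25 ∷ 49 ∷ []) ∷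
    (1 ∷ 6 ∷ 46 ∷ 5 ∷ 45 ∷ 10 ∷ 43 ∷ 8 ∷ 44 ∷ 7 ∷ 42 ∷ 12 ∷ 40 ∷ 15 ∷ 35 ∷ 20 ∷ 28 ∷ 23 ∷ 27 ∷
     24 ∷ 29 ∷ 26 ∷ 48 ∷ 2 ∷ 4 ∷ []) ∷ []) ∷
   ((0 ∷ 7 ∷ 46 ∷ 8 ∷ 40 ∷ 11 ∷ 42 ∷ 9 ∷ 44 ∷ 10 ∷ 39 ∷ 12 ∷ 36 ∷ 19 ∷ 30 ∷ 21 ∷ 28 ∷ 22 ∷ 31 ∷
     24 ∷ 49 ∷ 1 ∷ 2 ∷ 47 ∷ 5 ∷ []) ∷
    (3 ∷ 4 ∷ 45 ∷ 6 ∷ 43 ∷ 13 ∷ 41 ∷ 15 ∷ 34 ∷ 20 ∷ 32 ∷ 18 ∷ 35 ∷ 16 ∷ 37 ∷ 14 ∷ 38 ∷ 17 ∷ 33 ∷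
     23 ∷ 26 ∷ 25 ∷ 29 ∷ 27 ∷ 48 ∷ []) ∷ []) ∷
   ((0 ∷ 6 ∷ 42 ∷ 13 ∷ 40 ∷ 14 ∷ 35 ∷ 17 ∷ 36 ∷ 15 ∷ 39 ∷ 16 ∷ 33 ∷ 19 ∷ 34 ∷ 21 ∷ 32 ∷ 23 ∷ 30 ∷
     20 ∷ 29 ∷ 22 ∷ 26 ∷ 24 ∷ 48 ∷ []) ∷
    (1 ∷ 3 ∷ 46 ∷ 4 ∷ 44 ∷ 11 ∷ 43 ∷ 9 ∷ 45 ∷ 7 ∷ 47 ∷ 8 ∷ 41 ∷ 10 ∷ 38 ∷ 12 ∷ 37 ∷ 18 ∷ 31 ∷
     25 ∷ 28 ∷ 27 ∷ 49 ∷ 2 ∷ 5 ∷ []) ∷ []) ∷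
   ((0 ∷ 2 ∷ 46 ∷ 9 ∷ 40 ∷ 10 ∷ 42 ∷ 8 ∷ 45 ∷ 11 ∷ 39 ∷ 13 ∷ 36 ∷ 18 ∷ 30 ∷ 24 ∷ 28 ∷ 26 ∷ 49 ∷
     3 ∷ 5 ∷ 44 ∷ 6 ∷ 47 ∷ 4 ∷ []) ∷
    (1 ∷ 7 ∷ 43 ∷ 12 ∷ 41 ∷ 14 ∷ 34 ∷ 17 ∷ 37 ∷ 15 ∷ 38 ∷ 16 ∷ 32 ∷ 19 ∷ 35 ∷ 21 ∷ 29 ∷ 23 ∷ 31 ∷
     20 ∷ 33 ∷ 22 ∷ 27 ∷ 25 ∷ 48 ∷ []) ∷ []) ∷
   [])
  refl

K*54 : ResolvableCycleDecomposition 54 27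
K*54 = resolve 26
  (((0 ∷ 3 ∷ 51 ∷ 9 ∷ 8 ∷ 49 ∷ 7 ∷ 6 ∷ 46 ∷ 47 ∷ 12 ∷ 45 ∷ 15 ∷ 39 ∷ 17 ∷ 16 ∷ 40 ∷ 41 ∷ 19 ∷
     18 ∷ 35 ∷ 34 ∷ 20 ∷ 32 ∷ 33 ∷ 26 ∷ 52 ∷ []) ∷
    (1 ∷ 2 ∷ 50 ∷ 4 ∷ 5 ∷ 48 ∷ 11 ∷ 10 ∷ 42 ∷ 43 ∷ 13 ∷ 44 ∷ 14 ∷ 38 ∷ 21 ∷ 36 ∷ 37 ∷ 23 ∷ 22 ∷
     30 ∷ 28 ∷ 27 ∷ 31 ∷ 24 ∷ 25 ∷ 29 ∷ 53 ∷ []) ∷ []) ∷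
   ((0 ∷ 6 ∷ 51 ∷ 50 ∷ 9 ∷ 49 ∷ 10 ∷ 11 ∷ 42 ∷ 17 ∷ 41 ∷ 14 ∷ 39 ∷ 20 ∷ 21 ∷ 33 ∷ 22 ∷ 23 ∷ 31 ∷
     29 ∷ 26 ∷ 30 ∷ 24 ∷ 32 ∷ 27 ∷ 52 ∷ 1 ∷ []) ∷
    (2 ∷ 5 ∷ 4 ∷ 48 ∷ 7 ∷ 47 ∷ 46 ∷ 8 ∷ 45 ∷ 44 ∷ 15 ∷ 43 ∷ 12 ∷ 13 ∷ 40 ∷ 18 ∷ 38 ∷ 16 ∷ 37 ∷
     36 ∷ 19 ∷ 34 ∷ 35 ∷ 25 ∷ 28 ∷ 53 ∷ 3 ∷ []) ∷ []) ∷
   ((0 ∷ 2 ∷ 51 ∷ 5 ∷ 1 ∷ 6 ∷ 7 ∷ 50 ∷ 8 ∷ 44 ∷ 11 ∷ 47 ∷ 13 ∷ 12 ∷ 41 ∷ 40 ∷ 15 ∷ 38 ∷ 39 ∷ 21 ∷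
     32 ∷ 22 ∷ 31 ∷ 28 ∷ 26 ∷ 27 ∷ 53 ∷ []) ∷
    (3 ∷ 4 ∷ 49 ∷ 48 ∷ 10 ∷ 46 ∷ 9 ∷ 45 ∷ 14 ∷ 43 ∷ 42 ∷ 16 ∷ 17 ∷ 37 ∷ 19 ∷ 35 ∷ 20 ∷ 36 ∷ 18 ∷
     34 ∷ 25 ∷ 24 ∷ 33 ∷ 23 ∷ 30 ∷ 29 ∷ 52 ∷ []) ∷ []) ∷
   ((0 ∷ 7 ∷ 51 ∷ 8 ∷ 48 ∷ 49 ∷ 6 ∷ 47 ∷ 9 ∷ 44 ∷ 10 ∷ 43 ∷ 17 ∷ 36 ∷ 22 ∷ 35 ∷ 24 ∷ 29 ∷ 28 ∷
     52 ∷ 53 ∷ 2 ∷ 4 ∷ 1 ∷ 3 ∷ 50 ∷ 5 ∷ []) ∷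
    (11 ∷ 46 ∷ 12 ∷ 40 ∷ 19 ∷ 38 ∷ 20 ∷ 33 ∷ 27 ∷ 26 ∷ 31 ∷ 30 ∷ 25 ∷ 32 ∷ 23 ∷ 34 ∷ 21 ∷ 37 ∷
     18 ∷ 39 ∷ 16 ∷ 41 ∷ 15 ∷ 14 ∷ 42 ∷ 13 ∷ 45 ∷ []) ∷ []) ∷
   ((0 ∷ 1 ∷ 7 ∷ 46 ∷ 13 ∷ 41 ∷ 18 ∷ 19 ∷ 39 ∷ 38 ∷ 17 ∷ 40 ∷ 14 ∷ 15 ∷ 42 ∷ 12 ∷ 44 ∷ 45 ∷ 10 ∷
     47 ∷ 8 ∷ 9 ∷ 48 ∷ 6 ∷ 50 ∷ 51 ∷ 4 ∷ []) ∷
    (2 ∷ 3 ∷ 5 ∷ 49 ∷ 11 ∷ 43 ∷ 16 ∷ 36 ∷ 23 ∷ 35 ∷ 21 ∷ 20 ∷ 37 ∷ 22 ∷ 34 ∷ 24 ∷ 28 ∷ 29 ∷ 27 ∷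
     30 ∷ 31 ∷ 25 ∷ 33 ∷ 32 ∷ 26 ∷ 53 ∷ 52 ∷ []) ∷ []) ∷
   [])
  (((0 ∷ 2 ∷ 50 ∷ 5 ∷ 49 ∷ 7 ∷ 51 ∷ 8 ∷ 45 ∷ 11 ∷ 43 ∷ 13 ∷ 44 ∷ 14 ∷ 39 ∷ 16 ∷ 37 ∷ 19 ∷ 35 ∷
     21 ∷ 33 ∷ 23 ∷ 31 ∷ 24 ∷ 32 ∷ 27 ∷ 53 ∷ []) ∷
    (1 ∷ 6 ∷ 47 ∷ 9 ∷ 48 ∷ 10 ∷ 46 ∷ 12 ∷ 41 ∷ 15 ∷ 42 ∷ 17 ∷ 40 ∷ 18 ∷ 38 ∷ 20 ∷ 36 ∷ 22 ∷ 34 ∷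
     25 ∷ 28 ∷ 26 ∷ 30 ∷ 29 ∷ 52 ∷ 3 ∷ 4 ∷ []) ∷ []) ∷
   ((0 ∷ 3 ∷ 51 ∷ 5 ∷ 48 ∷ 6 ∷ 46 ∷ 8 ∷ 49 ∷ 11 ∷ 42 ∷ 13 ∷ 41 ∷ 14 ∷ 43 ∷ 16 ∷ 40 ∷ 19 ∷ 38 ∷
     17 ∷ 37 ∷ 22 ∷ 30 ∷ 28 ∷ 52 ∷ 2 ∷ 4 ∷ []) ∷
    (1 ∷ 7 ∷ 50 ∷ 9 ∷ 45 ∷ 10 ∷ 47 ∷ 12 ∷ 44 ∷ 15 ∷ 39 ∷ 21 ∷ 36 ∷ 18 ∷ 35 ∷ 20 ∷ 32 ∷ 23 ∷ 34 ∷
     24 ∷ 33 ∷ 27 ∷ 31 ∷ 25 ∷ 29 ∷ 26 ∷ 53 ∷ []) ∷ []) ∷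
   ((0 ∷ 6 ∷ 51 ∷ 9 ∷ 44 ∷ 11 ∷ 47 ∷ 8 ∷ 48 ∷ 7 ∷ 46 ∷ 13 ∷ 45 ∷ 14 ∷ 38 ∷ 16 ∷ 36 ∷ 23 ∷ 35 ∷
     24 ∷ 29 ∷ 27 ∷ 30 ∷ 25 ∷ 33 ∷ 26 ∷ 52 ∷ []) ∷
    (1 ∷ 3 ∷ 50 ∷ 4 ∷ 49 ∷ 10 ∷ 42 ∷ 12 ∷ 40 ∷ 15 ∷ 43 ∷ 17 ∷ 41 ∷ 19 ∷ 39 ∷ 20 ∷ 37 ∷ 18 ∷ 34 ∷
     21 ∷ 32 ∷ 22 ∷ 31 ∷ 28 ∷ 53 ∷ 2 ∷ 5 ∷ []) ∷ []) ∷
   ((0 ∷ 7 ∷ 47 ∷ 13 ∷ 40 ∷ 14 ∷ 42 ∷ 16 ∷ 41 ∷ 18 ∷ 39 ∷ 17 ∷ 36 ∷ 19 ∷ 34 ∷ 20 ∷ 33 ∷ 22 ∷ 35 ∷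
     25 ∷ 32 ∷ 26 ∷ 31 ∷ 29 ∷ 53 ∷ 3 ∷ 5 ∷ []) ∷
    (1 ∷ 2 ∷ 51 ∷ 4 ∷ 48 ∷ 11 ∷ 46 ∷ 9 ∷ 49 ∷ 6 ∷ 50 ∷ 8 ∷ 44 ∷ 10 ∷ 43 ∷ 12 ∷ 45 ∷ 15 ∷ 38 ∷
     21 ∷ 37 ∷ 23 ∷ 30 ∷ 24 ∷ 28 ∷ 27 ∷ 52 ∷ []) ∷ []) ∷
   [])
  refl

K*58 : ResolvableCycleDecomposition 58 29
K*58 = resolve 28
  (((0 ∷ 1 ∷ 7 ∷ 6 ∷ 51 ∷ 8 ∷ 9 ∷ 53 ∷ 11 ∷ 50 ∷ 12 ∷ 45 ∷ 44 ∷ 15 ∷ 42 ∷ 16 ∷ 40 ∷ 22 ∷ 23 ∷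
     38 ∷ 39 ∷ 25 ∷ 24 ∷ 32 ∷ 30 ∷ 56 ∷ 3 ∷ 54 ∷ 5 ∷ []) ∷
    (2 ∷ 55 ∷ 4 ∷ 52 ∷ 10 ∷ 47 ∷ 13 ∷ 49 ∷ 48 ∷ 14 ∷ 46 ∷ 17 ∷ 41 ∷ 18 ∷ 19 ∷ 43 ∷ 20 ∷ 21 ∷ 36 ∷
     37 ∷ 26 ∷ 27 ∷ 35 ∷ 34 ∷ 29 ∷ 28 ∷ 33 ∷ 31 ∷ 57 ∷ []) ∷ []) ∷
   ((0 ∷ 3 ∷ 2 ∷ 5 ∷ 4 ∷ 1 ∷ 6 ∷ 55 ∷ 54 ∷ 8 ∷ 53 ∷ 10 ∷ 51 ∷ 9 ∷ 52 ∷ 7 ∷ 50 ∷ 13 ∷ 48 ∷ 49 ∷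
     11 ∷ 46 ∷ 16 ∷ 41 ∷ 22 ∷ 34 ∷ 28 ∷ 57 ∷ 56 ∷ []) ∷
    (12 ∷ 44 ∷ 19 ∷ 38 ∷ 20 ∷ 36 ∷ 27 ∷ 31 ∷ 30 ∷ 29 ∷ 33 ∷ 32 ∷ 26 ∷ 35 ∷ 24 ∷ 25 ∷ 37 ∷ 23 ∷
     39 ∷ 21 ∷ 40 ∷ 18 ∷ 42 ∷ 43 ∷ 17 ∷ 45 ∷ 14 ∷ 15 ∷ 47 ∷ []) ∷ []) ∷
   ((0 ∷ 2 ∷ 4 ∷ 5 ∷ 53 ∷ 7 ∷ 54 ∷ 9 ∷ 49 ∷ 10 ∷ 46 ∷ 13 ∷ 44 ∷ 45 ∷ 15 ∷ 14 ∷ 43 ∷ 42 ∷ 21 ∷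
     20 ∷ 37 ∷ 22 ∷ 38 ∷ 25 ∷ 33 ∷ 27 ∷ 26 ∷ 30 ∷ 57 ∷ []) ∷
    (1 ∷ 3 ∷ 55 ∷ 8 ∷ 52 ∷ 6 ∷ 50 ∷ 51 ∷ 12 ∷ 48 ∷ 11 ∷ 47 ∷ 16 ∷ 17 ∷ 40 ∷ 41 ∷ 19 ∷ 18 ∷ 39 ∷
     24 ∷ 36 ∷ 23 ∷ 34 ∷ 35 ∷ 28 ∷ 29 ∷ 32 ∷ 31 ∷ 56 ∷ []) ∷ []) ∷
   ((0 ∷ 6 ∷ 7 ∷ 51 ∷ 13 ∷ 12 ∷ 49 ∷ 14 ∷ 42 ∷ 20 ∷ 41 ∷ 40 ∷ 23 ∷ 22 ∷ 35 ∷ 25 ∷ 32 ∷ 27 ∷ 34 ∷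
     24 ∷ 33 ∷ 30 ∷ 28 ∷ 56 ∷ 2 ∷ 54 ∷ 55 ∷ 5 ∷ 1 ∷ []) ∷
    (3 ∷ 4 ∷ 53 ∷ 52 ∷ 11 ∷ 10 ∷ 50 ∷ 9 ∷ 8 ∷ 48 ∷ 15 ∷ 46 ∷ 47 ∷ 17 ∷ 44 ∷ 18 ∷ 43 ∷ 16 ∷ 45 ∷
     19 ∷ 39 ∷ 38 ∷ 21 ∷ 37 ∷ 36 ∷ 26 ∷ 31 ∷ 29 ∷ 57 ∷ []) ∷ []) ∷
   ((0 ∷ 7 ∷ 55 ∷ 9 ∷ 48 ∷ 10 ∷ 11 ∷ 51 ∷ 50 ∷ 8 ∷ 49 ∷ 15 ∷ 43 ∷ 21 ∷ 41 ∷ 23 ∷ 35 ∷ 29 ∷ 56 ∷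
     57 ∷ 1 ∷ 2 ∷ 3 ∷ 5 ∷ 52 ∷ 53 ∷ 6 ∷ 54 ∷ 4 ∷ []) ∷
    (12 ∷ 13 ∷ 45 ∷ 18 ∷ 38 ∷ 24 ∷ 37 ∷ 27 ∷ 30 ∷ 31 ∷ 28 ∷ 32 ∷ 33 ∷ 26 ∷ 34 ∷ 25 ∷ 36 ∷ 22 ∷
     39 ∷ 20 ∷ 40 ∷ 19 ∷ 42 ∷ 17 ∷ 16 ∷ 44 ∷ 14 ∷ 47 ∷ 46 ∷ []) ∷ []) ∷
   [])
  -- Each of these starters passes the two copies of ∞, coded 56 and 57, once as 14 → ∞ → 0 along H
  -- and once as 15 → ∞ → 1 along H + 1. Rotation moves these neighbours and keeps ∞ in place.
  (((0 ∷ 2 ∷ 55 ∷ 8 ∷ 52 ∷ 11 ∷ 46 ∷ 12 ∷ 44 ∷ 15 ∷ 43 ∷ 16 ∷ 45 ∷ 18 ∷ 42 ∷ 21 ∷ 40 ∷ 19 ∷ 38 ∷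
     24 ∷ 37 ∷ 26 ∷ 35 ∷ 25 ∷ 32 ∷ 27 ∷ 30 ∷ 28 ∷ 57 ∷ []) ∷
    (1 ∷ 7 ∷ 54 ∷ 4 ∷ 53 ∷ 6 ∷ 51 ∷ 9 ∷ 48 ∷ 10 ∷ 50 ∷ 13 ∷ 49 ∷ 14 ∷ 47 ∷ 17 ∷ 41 ∷ 22 ∷ 39 ∷
     20 ∷ 36 ∷ 23 ∷ 34 ∷ 29 ∷ 33 ∷ 31 ∷ 56 ∷ 3 ∷ 5 ∷ []) ∷ []) ∷
   ((0 ∷ 6 ∷ 55 ∷ 9 ∷ 53 ∷ 10 ∷ 51 ∷ 12 ∷ 48 ∷ 14 ∷ 46 ∷ 16 ∷ 40 ∷ 18 ∷ 43 ∷ 17 ∷ 44 ∷ 19 ∷ 39 ∷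
     21 ∷ 37 ∷ 22 ∷ 34 ∷ 24 ∷ 36 ∷ 26 ∷ 31 ∷ 28 ∷ 56 ∷ []) ∷
    (1 ∷ 2 ∷ 54 ∷ 5 ∷ 52 ∷ 7 ∷ 50 ∷ 8 ∷ 49 ∷ 11 ∷ 47 ∷ 13 ∷ 45 ∷ 15 ∷ 42 ∷ 20 ∷ 41 ∷ 23 ∷ 38 ∷
     25 ∷ 33 ∷ 27 ∷ 35 ∷ 29 ∷ 32 ∷ 30 ∷ 57 ∷ 3 ∷ 4 ∷ []) ∷ []) ∷
   ((0 ∷ 3 ∷ 55 ∷ 5 ∷ 53 ∷ 7 ∷ 51 ∷ 8 ∷ 48 ∷ 11 ∷ 50 ∷ 12 ∷ 49 ∷ 15 ∷ 47 ∷ 16 ∷ 41 ∷ 18 ∷ 38 ∷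
     21 ∷ 36 ∷ 22 ∷ 35 ∷ 24 ∷ 32 ∷ 31 ∷ 57 ∷ 2 ∷ 4 ∷ []) ∷
    (1 ∷ 6 ∷ 54 ∷ 9 ∷ 52 ∷ 10 ∷ 46 ∷ 13 ∷ 44 ∷ 14 ∷ 42 ∷ 17 ∷ 45 ∷ 19 ∷ 43 ∷ 20 ∷ 40 ∷ 23 ∷ 39 ∷
     25 ∷ 37 ∷ 27 ∷ 34 ∷ 28 ∷ 33 ∷ 26 ∷ 30 ∷ 29 ∷ 56 ∷ []) ∷ []) ∷
   ((0 ∷ 7 ∷ 55 ∷ 4 ∷ 52 ∷ 6 ∷ 50 ∷ 9 ∷ 49 ∷ 10 ∷ 47 ∷ 12 ∷ 45 ∷ 14 ∷ 43 ∷ 21 ∷ 41 ∷ 19 ∷ 42 ∷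
     16 ∷ 44 ∷ 18 ∷ 39 ∷ 24 ∷ 33 ∷ 30 ∷ 56 ∷ 2 ∷ 5 ∷ []) ∷
    (1 ∷ 3 ∷ 54 ∷ 8 ∷ 53 ∷ 11 ∷ 51 ∷ 13 ∷ 48 ∷ 15 ∷ 46 ∷ 17 ∷ 40 ∷ 22 ∷ 38 ∷ 20 ∷ 37 ∷ 23 ∷ 35 ∷
     28 ∷ 32 ∷ 26 ∷ 34 ∷ 25 ∷ 36 ∷ 27 ∷ 31 ∷ 29 ∷ 57 ∷ []) ∷ []) ∷
   [])
  refl

K*62 : ResolvableCycleDecomposition 62 31
K*62 = resolve 30
  (((0 ∷ 2 ∷ 5 ∷ 4 ∷ 56 ∷ 7 ∷ 54 ∷ 13 ∷ 12 ∷ 52 ∷ 14 ∷ 15 ∷ 51 ∷ 17 ∷ 44 ∷ 19 ∷ 43 ∷ 42 ∷ 24 ∷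
     40 ∷ 22 ∷ 39 ∷ 28 ∷ 29 ∷ 37 ∷ 36 ∷ 30 ∷ 34 ∷ 33 ∷ 60 ∷ 1 ∷ []) ∷
    (3 ∷ 59 ∷ 58 ∷ 9 ∷ 57 ∷ 6 ∷ 55 ∷ 8 ∷ 53 ∷ 11 ∷ 10 ∷ 50 ∷ 16 ∷ 49 ∷ 48 ∷ 18 ∷ 46 ∷ 47 ∷ 21 ∷
     20 ∷ 45 ∷ 23 ∷ 38 ∷ 25 ∷ 41 ∷ 26 ∷ 27 ∷ 35 ∷ 32 ∷ 31 ∷ 61 ∷ []) ∷ []) ∷
   ((0 ∷ 3 ∷ 4 ∷ 1 ∷ 6 ∷ 7 ∷ 58 ∷ 8 ∷ 9 ∷ 56 ∷ 57 ∷ 10 ∷ 54 ∷ 55 ∷ 13 ∷ 48 ∷ 15 ∷ 47 ∷ 20 ∷ 40 ∷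
     26 ∷ 38 ∷ 28 ∷ 32 ∷ 33 ∷ 31 ∷ 60 ∷ 61 ∷ 2 ∷ 59 ∷ 5 ∷ []) ∷
    (11 ∷ 51 ∷ 16 ∷ 45 ∷ 22 ∷ 43 ∷ 25 ∷ 37 ∷ 30 ∷ 35 ∷ 34 ∷ 29 ∷ 36 ∷ 27 ∷ 39 ∷ 24 ∷ 41 ∷ 23 ∷
     42 ∷ 21 ∷ 44 ∷ 18 ∷ 19 ∷ 46 ∷ 17 ∷ 49 ∷ 14 ∷ 50 ∷ 12 ∷ 53 ∷ 52 ∷ []) ∷ []) ∷
   ((0 ∷ 6 ∷ 54 ∷ 12 ∷ 48 ∷ 49 ∷ 19 ∷ 42 ∷ 43 ∷ 21 ∷ 45 ∷ 18 ∷ 47 ∷ 17 ∷ 16 ∷ 44 ∷ 23 ∷ 22 ∷ 38 ∷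
     24 ∷ 37 ∷ 26 ∷ 39 ∷ 25 ∷ 36 ∷ 31 ∷ 35 ∷ 29 ∷ 28 ∷ 33 ∷ 61 ∷ []) ∷
    (1 ∷ 7 ∷ 59 ∷ 8 ∷ 57 ∷ 56 ∷ 11 ∷ 50 ∷ 51 ∷ 13 ∷ 53 ∷ 10 ∷ 55 ∷ 9 ∷ 52 ∷ 15 ∷ 14 ∷ 46 ∷ 20 ∷
     41 ∷ 40 ∷ 27 ∷ 34 ∷ 32 ∷ 30 ∷ 60 ∷ 3 ∷ 2 ∷ 58 ∷ 4 ∷ 5 ∷ []) ∷ []) ∷
   ((0 ∷ 1 ∷ 3 ∷ 5 ∷ 57 ∷ 7 ∷ 55 ∷ 12 ∷ 49 ∷ 18 ∷ 42 ∷ 25 ∷ 24 ∷ 36 ∷ 26 ∷ 35 ∷ 33 ∷ 30 ∷ 31 ∷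
     34 ∷ 28 ∷ 37 ∷ 27 ∷ 38 ∷ 39 ∷ 29 ∷ 32 ∷ 61 ∷ 60 ∷ 2 ∷ 4 ∷ []) ∷
    (6 ∷ 58 ∷ 59 ∷ 9 ∷ 53 ∷ 15 ∷ 46 ∷ 21 ∷ 40 ∷ 41 ∷ 22 ∷ 23 ∷ 43 ∷ 20 ∷ 44 ∷ 45 ∷ 19 ∷ 47 ∷ 16 ∷
     17 ∷ 48 ∷ 14 ∷ 51 ∷ 50 ∷ 13 ∷ 52 ∷ 10 ∷ 11 ∷ 54 ∷ 8 ∷ 56 ∷ []) ∷ []) ∷
   ((0 ∷ 7 ∷ 6 ∷ 59 ∷ 4 ∷ 57 ∷ 11 ∷ 55 ∷ 54 ∷ 9 ∷ 8 ∷ 52 ∷ 53 ∷ 14 ∷ 47 ∷ 46 ∷ 16 ∷ 48 ∷ 19 ∷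
     18 ∷ 43 ∷ 24 ∷ 25 ∷ 40 ∷ 23 ∷ 39 ∷ 38 ∷ 29 ∷ 33 ∷ 32 ∷ 60 ∷ []) ∷
    (1 ∷ 2 ∷ 3 ∷ 58 ∷ 5 ∷ 56 ∷ 10 ∷ 51 ∷ 12 ∷ 13 ∷ 49 ∷ 15 ∷ 50 ∷ 17 ∷ 45 ∷ 44 ∷ 22 ∷ 42 ∷ 20 ∷
     21 ∷ 41 ∷ 27 ∷ 26 ∷ 34 ∷ 35 ∷ 28 ∷ 36 ∷ 37 ∷ 31 ∷ 30 ∷ 61 ∷ []) ∷ []) ∷
   [])
  (((0 ∷ 2 ∷ 58 ∷ 4 ∷ 56 ∷ 6 ∷ 59 ∷ 8 ∷ 57 ∷ 10 ∷ 55 ∷ 9 ∷ 52 ∷ 11 ∷ 50 ∷ 16 ∷ 48 ∷ 19 ∷ 43 ∷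
     25 ∷ 41 ∷ 26 ∷ 38 ∷ 29 ∷ 37 ∷ 27 ∷ 34 ∷ 33 ∷ 60 ∷ 3 ∷ 5 ∷ []) ∷
    (1 ∷ 7 ∷ 54 ∷ 13 ∷ 53 ∷ 14 ∷ 51 ∷ 12 ∷ 49 ∷ 15 ∷ 46 ∷ 20 ∷ 45 ∷ 18 ∷ 47 ∷ 17 ∷ 44 ∷ 23 ∷ 42 ∷
     21 ∷ 40 ∷ 22 ∷ 39 ∷ 24 ∷ 36 ∷ 30 ∷ 35 ∷ 28 ∷ 32 ∷ 31 ∷ 61 ∷ []) ∷ []) ∷
   ((0 ∷ 7 ∷ 59 ∷ 5 ∷ 1 ∷ 3 ∷ 58 ∷ 9 ∷ 56 ∷ 11 ∷ 51 ∷ 13 ∷ 52 ∷ 14 ∷ 46 ∷ 21 ∷ 45 ∷ 23 ∷ 43 ∷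
     24 ∷ 40 ∷ 27 ∷ 39 ∷ 29 ∷ 36 ∷ 26 ∷ 34 ∷ 28 ∷ 33 ∷ 30 ∷ 61 ∷ []) ∷
    (2 ∷ 4 ∷ 57 ∷ 6 ∷ 55 ∷ 8 ∷ 53 ∷ 10 ∷ 54 ∷ 12 ∷ 48 ∷ 15 ∷ 50 ∷ 17 ∷ 49 ∷ 19 ∷ 47 ∷ 16 ∷ 44 ∷
     18 ∷ 42 ∷ 20 ∷ 41 ∷ 22 ∷ 38 ∷ 25 ∷ 37 ∷ 31 ∷ 35 ∷ 32 ∷ 60 ∷ []) ∷ []) ∷
   ((0 ∷ 6 ∷ 58 ∷ 5 ∷ 56 ∷ 7 ∷ 55 ∷ 12 ∷ 53 ∷ 15 ∷ 47 ∷ 20 ∷ 44 ∷ 19 ∷ 46 ∷ 16 ∷ 49 ∷ 14 ∷ 50 ∷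
     13 ∷ 48 ∷ 18 ∷ 43 ∷ 21 ∷ 41 ∷ 27 ∷ 35 ∷ 33 ∷ 61 ∷ 3 ∷ 4 ∷ []) ∷
    (1 ∷ 2 ∷ 59 ∷ 9 ∷ 57 ∷ 11 ∷ 54 ∷ 8 ∷ 52 ∷ 10 ∷ 51 ∷ 17 ∷ 45 ∷ 22 ∷ 42 ∷ 25 ∷ 40 ∷ 23 ∷ 38 ∷
     24 ∷ 37 ∷ 26 ∷ 39 ∷ 28 ∷ 36 ∷ 31 ∷ 34 ∷ 29 ∷ 32 ∷ 30 ∷ 60 ∷ []) ∷ []) ∷
   ((0 ∷ 3 ∷ 59 ∷ 4 ∷ 1 ∷ 6 ∷ 54 ∷ 9 ∷ 53 ∷ 11 ∷ 55 ∷ 13 ∷ 49 ∷ 18 ∷ 46 ∷ 17 ∷ 48 ∷ 14 ∷ 47 ∷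
     21 ∷ 44 ∷ 22 ∷ 43 ∷ 20 ∷ 40 ∷ 26 ∷ 35 ∷ 29 ∷ 33 ∷ 31 ∷ 60 ∷ []) ∷
    (2 ∷ 5 ∷ 57 ∷ 7 ∷ 58 ∷ 8 ∷ 56 ∷ 10 ∷ 50 ∷ 12 ∷ 52 ∷ 15 ∷ 51 ∷ 16 ∷ 45 ∷ 19 ∷ 42 ∷ 24 ∷ 41 ∷
     23 ∷ 39 ∷ 25 ∷ 36 ∷ 27 ∷ 38 ∷ 28 ∷ 37 ∷ 30 ∷ 34 ∷ 32 ∷ 61 ∷ []) ∷ []) ∷
   [])
  refl

K*66 : ResolvableCycleDecomposition 66 33
K*66 = resolve 32
  (((0 ∷ 2 ∷ 63 ∷ 9 ∷ 57 ∷ 10 ∷ 59 ∷ 8 ∷ 61 ∷ 60 ∷ 11 ∷ 55 ∷ 12 ∷ 56 ∷ 15 ∷ 14 ∷ 54 ∷ 17 ∷ 49 ∷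
     48 ∷ 23 ∷ 47 ∷ 46 ∷ 24 ∷ 45 ∷ 27 ∷ 42 ∷ 29 ∷ 37 ∷ 36 ∷ 31 ∷ 34 ∷ 65 ∷ []) ∷
    (1 ∷ 6 ∷ 7 ∷ 58 ∷ 13 ∷ 52 ∷ 19 ∷ 51 ∷ 16 ∷ 53 ∷ 18 ∷ 50 ∷ 20 ∷ 21 ∷ 44 ∷ 22 ∷ 43 ∷ 25 ∷ 41 ∷
     26 ∷ 39 ∷ 38 ∷ 28 ∷ 40 ∷ 30 ∷ 35 ∷ 33 ∷ 32 ∷ 64 ∷ 3 ∷ 62 ∷ 5 ∷ 4 ∷ []) ∷ []) ∷
   ((0 ∷ 7 ∷ 63 ∷ 62 ∷ 8 ∷ 9 ∷ 61 ∷ 11 ∷ 54 ∷ 12 ∷ 52 ∷ 53 ∷ 14 ∷ 15 ∷ 51 ∷ 50 ∷ 21 ∷ 20 ∷ 49 ∷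
     18 ∷ 19 ∷ 47 ∷ 24 ∷ 41 ∷ 27 ∷ 39 ∷ 28 ∷ 36 ∷ 34 ∷ 64 ∷ 1 ∷ 2 ∷ 4 ∷ []) ∷
    (3 ∷ 5 ∷ 60 ∷ 6 ∷ 58 ∷ 59 ∷ 13 ∷ 57 ∷ 56 ∷ 10 ∷ 55 ∷ 17 ∷ 16 ∷ 48 ∷ 22 ∷ 46 ∷ 25 ∷ 44 ∷ 45 ∷
     23 ∷ 42 ∷ 43 ∷ 29 ∷ 40 ∷ 26 ∷ 38 ∷ 32 ∷ 33 ∷ 37 ∷ 30 ∷ 31 ∷ 35 ∷ 65 ∷ []) ∷ []) ∷
   ((0 ∷ 3 ∷ 4 ∷ 61 ∷ 10 ∷ 54 ∷ 16 ∷ 52 ∷ 18 ∷ 46 ∷ 47 ∷ 21 ∷ 48 ∷ 49 ∷ 19 ∷ 50 ∷ 17 ∷ 53 ∷ 15 ∷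
     55 ∷ 13 ∷ 12 ∷ 57 ∷ 11 ∷ 59 ∷ 58 ∷ 8 ∷ 60 ∷ 7 ∷ 6 ∷ 63 ∷ 5 ∷ 1 ∷ []) ∷
    (2 ∷ 62 ∷ 9 ∷ 56 ∷ 14 ∷ 51 ∷ 20 ∷ 44 ∷ 23 ∷ 22 ∷ 42 ∷ 24 ∷ 25 ∷ 45 ∷ 26 ∷ 43 ∷ 28 ∷ 41 ∷ 40 ∷
     27 ∷ 38 ∷ 29 ∷ 36 ∷ 35 ∷ 34 ∷ 32 ∷ 37 ∷ 31 ∷ 30 ∷ 39 ∷ 33 ∷ 64 ∷ 65 ∷ []) ∷ []) ∷
   ((0 ∷ 6 ∷ 59 ∷ 9 ∷ 8 ∷ 56 ∷ 57 ∷ 14 ∷ 50 ∷ 51 ∷ 21 ∷ 49 ∷ 22 ∷ 23 ∷ 46 ∷ 20 ∷ 45 ∷ 44 ∷ 26 ∷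
     27 ∷ 43 ∷ 42 ∷ 28 ∷ 29 ∷ 41 ∷ 30 ∷ 38 ∷ 33 ∷ 36 ∷ 37 ∷ 34 ∷ 35 ∷ 64 ∷ []) ∷
    (1 ∷ 3 ∷ 2 ∷ 5 ∷ 61 ∷ 7 ∷ 62 ∷ 63 ∷ 4 ∷ 60 ∷ 10 ∷ 11 ∷ 58 ∷ 12 ∷ 13 ∷ 53 ∷ 52 ∷ 15 ∷ 54 ∷
     55 ∷ 16 ∷ 17 ∷ 48 ∷ 19 ∷ 18 ∷ 47 ∷ 25 ∷ 24 ∷ 40 ∷ 31 ∷ 39 ∷ 32 ∷ 65 ∷ []) ∷ []) ∷
   ((0 ∷ 1 ∷ 7 ∷ 59 ∷ 12 ∷ 53 ∷ 19 ∷ 46 ∷ 21 ∷ 45 ∷ 22 ∷ 47 ∷ 20 ∷ 48 ∷ 18 ∷ 51 ∷ 17 ∷ 52 ∷ 14 ∷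
     55 ∷ 54 ∷ 13 ∷ 56 ∷ 11 ∷ 10 ∷ 58 ∷ 9 ∷ 60 ∷ 61 ∷ 6 ∷ 62 ∷ 4 ∷ 5 ∷ []) ∷
    (2 ∷ 3 ∷ 63 ∷ 8 ∷ 57 ∷ 15 ∷ 50 ∷ 16 ∷ 49 ∷ 23 ∷ 43 ∷ 24 ∷ 44 ∷ 27 ∷ 26 ∷ 42 ∷ 25 ∷ 40 ∷ 41 ∷
     31 ∷ 38 ∷ 39 ∷ 29 ∷ 28 ∷ 37 ∷ 35 ∷ 32 ∷ 36 ∷ 30 ∷ 34 ∷ 33 ∷ 65 ∷ 64 ∷ []) ∷ []) ∷
   [])
  (((0 ∷ 2 ∷ 62 ∷ 8 ∷ 61 ∷ 11 ∷ 55 ∷ 12 ∷ 53 ∷ 18 ∷ 51 ∷ 16 ∷ 48 ∷ 19 ∷ 46 ∷ 21 ∷ 49 ∷ 23 ∷ 42 ∷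
     24 ∷ 45 ∷ 26 ∷ 39 ∷ 33 ∷ 36 ∷ 34 ∷ 64 ∷ 3 ∷ 4 ∷ 60 ∷ 6 ∷ 63 ∷ 5 ∷ []) ∷
    (1 ∷ 7 ∷ 59 ∷ 13 ∷ 57 ∷ 10 ∷ 58 ∷ 9 ∷ 56 ∷ 15 ∷ 54 ∷ 17 ∷ 52 ∷ 14 ∷ 50 ∷ 20 ∷ 44 ∷ 22 ∷ 47 ∷
     25 ∷ 41 ∷ 30 ∷ 38 ∷ 29 ∷ 40 ∷ 27 ∷ 43 ∷ 28 ∷ 37 ∷ 31 ∷ 35 ∷ 32 ∷ 65 ∷ []) ∷ []) ∷
   ((0 ∷ 7 ∷ 63 ∷ 9 ∷ 60 ∷ 10 ∷ 59 ∷ 12 ∷ 56 ∷ 14 ∷ 55 ∷ 13 ∷ 53 ∷ 19 ∷ 51 ∷ 21 ∷ 44 ∷ 23 ∷ 47 ∷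
     24 ∷ 41 ∷ 31 ∷ 39 ∷ 28 ∷ 40 ∷ 26 ∷ 43 ∷ 25 ∷ 45 ∷ 27 ∷ 38 ∷ 33 ∷ 65 ∷ []) ∷
    (1 ∷ 3 ∷ 62 ∷ 4 ∷ 61 ∷ 6 ∷ 58 ∷ 8 ∷ 57 ∷ 11 ∷ 54 ∷ 16 ∷ 52 ∷ 15 ∷ 50 ∷ 17 ∷ 48 ∷ 18 ∷ 46 ∷
     20 ∷ 49 ∷ 22 ∷ 42 ∷ 29 ∷ 37 ∷ 30 ∷ 34 ∷ 32 ∷ 36 ∷ 35 ∷ 64 ∷ 2 ∷ 5 ∷ []) ∷ []) ∷
   ((0 ∷ 6 ∷ 59 ∷ 8 ∷ 60 ∷ 7 ∷ 62 ∷ 9 ∷ 57 ∷ 14 ∷ 51 ∷ 17 ∷ 53 ∷ 15 ∷ 55 ∷ 16 ∷ 49 ∷ 19 ∷ 50 ∷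
     21 ∷ 48 ∷ 22 ∷ 43 ∷ 24 ∷ 40 ∷ 31 ∷ 38 ∷ 32 ∷ 64 ∷ 1 ∷ 2 ∷ 63 ∷ 4 ∷ []) ∷
    (3 ∷ 5 ∷ 61 ∷ 10 ∷ 54 ∷ 13 ∷ 56 ∷ 11 ∷ 58 ∷ 12 ∷ 52 ∷ 18 ∷ 47 ∷ 20 ∷ 45 ∷ 23 ∷ 46 ∷ 25 ∷ 44 ∷
     26 ∷ 42 ∷ 28 ∷ 41 ∷ 27 ∷ 39 ∷ 29 ∷ 36 ∷ 30 ∷ 35 ∷ 33 ∷ 37 ∷ 34 ∷ 65 ∷ []) ∷ []) ∷
   ((0 ∷ 3 ∷ 63 ∷ 8 ∷ 56 ∷ 10 ∷ 55 ∷ 17 ∷ 49 ∷ 18 ∷ 50 ∷ 16 ∷ 53 ∷ 14 ∷ 54 ∷ 12 ∷ 57 ∷ 15 ∷ 51 ∷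
     20 ∷ 48 ∷ 23 ∷ 43 ∷ 29 ∷ 41 ∷ 26 ∷ 38 ∷ 28 ∷ 36 ∷ 31 ∷ 34 ∷ 33 ∷ 64 ∷ []) ∷
    (1 ∷ 6 ∷ 62 ∷ 5 ∷ 60 ∷ 11 ∷ 59 ∷ 9 ∷ 61 ∷ 7 ∷ 58 ∷ 13 ∷ 52 ∷ 19 ∷ 47 ∷ 21 ∷ 45 ∷ 22 ∷ 46 ∷
     24 ∷ 44 ∷ 27 ∷ 42 ∷ 25 ∷ 40 ∷ 30 ∷ 39 ∷ 32 ∷ 37 ∷ 35 ∷ 65 ∷ 2 ∷ 4 ∷ []) ∷ []) ∷
   [])
  refl

K*70 : ResolvableCycleDecomposition 70 35
K*70 = resolve 34
  (((0 ∷ 6 ∷ 62 ∷ 12 ∷ 13 ∷ 60 ∷ 14 ∷ 55 ∷ 20 ∷ 52 ∷ 53 ∷ 19 ∷ 54 ∷ 21 ∷ 49 ∷ 22 ∷ 23 ∷ 47 ∷ 28 ∷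
     29 ∷ 41 ∷ 30 ∷ 31 ∷ 43 ∷ 32 ∷ 40 ∷ 34 ∷ 35 ∷ 39 ∷ 38 ∷ 37 ∷ 68 ∷ 1 ∷ 2 ∷ 4 ∷ []) ∷
    (3 ∷ 67 ∷ 5 ∷ 64 ∷ 7 ∷ 66 ∷ 9 ∷ 65 ∷ 11 ∷ 10 ∷ 63 ∷ 8 ∷ 61 ∷ 15 ∷ 59 ∷ 58 ∷ 17 ∷ 16 ∷ 56 ∷
     57 ∷ 18 ∷ 50 ∷ 51 ∷ 25 ∷ 48 ∷ 27 ∷ 46 ∷ 24 ∷ 44 ∷ 45 ∷ 26 ∷ 42 ∷ 33 ∷ 36 ∷ 69 ∷ []) ∷ []) ∷
   ((0 ∷ 7 ∷ 63 ∷ 13 ∷ 57 ∷ 15 ∷ 54 ∷ 20 ∷ 48 ∷ 22 ∷ 47 ∷ 29 ∷ 28 ∷ 45 ∷ 27 ∷ 26 ∷ 46 ∷ 25 ∷ 44 ∷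
     31 ∷ 30 ∷ 42 ∷ 43 ∷ 33 ∷ 40 ∷ 41 ∷ 34 ∷ 38 ∷ 39 ∷ 32 ∷ 36 ∷ 37 ∷ 35 ∷ 68 ∷ 69 ∷ []) ∷
    (1 ∷ 3 ∷ 2 ∷ 67 ∷ 9 ∷ 61 ∷ 10 ∷ 58 ∷ 16 ∷ 52 ∷ 19 ∷ 51 ∷ 24 ∷ 49 ∷ 23 ∷ 50 ∷ 21 ∷ 53 ∷ 18 ∷
     55 ∷ 17 ∷ 56 ∷ 14 ∷ 59 ∷ 12 ∷ 60 ∷ 11 ∷ 62 ∷ 8 ∷ 64 ∷ 65 ∷ 6 ∷ 66 ∷ 5 ∷ 4 ∷ []) ∷ []) ∷
   ((0 ∷ 1 ∷ 7 ∷ 6 ∷ 63 ∷ 9 ∷ 60 ∷ 15 ∷ 14 ∷ 54 ∷ 17 ∷ 57 ∷ 56 ∷ 18 ∷ 19 ∷ 55 ∷ 21 ∷ 20 ∷ 49 ∷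
     27 ∷ 43 ∷ 42 ∷ 28 ∷ 41 ∷ 40 ∷ 31 ∷ 38 ∷ 33 ∷ 32 ∷ 37 ∷ 34 ∷ 68 ∷ 3 ∷ 4 ∷ 5 ∷ []) ∷
    (2 ∷ 66 ∷ 67 ∷ 8 ∷ 65 ∷ 64 ∷ 10 ∷ 62 ∷ 13 ∷ 12 ∷ 61 ∷ 11 ∷ 58 ∷ 59 ∷ 16 ∷ 53 ∷ 52 ∷ 23 ∷ 22 ∷
     51 ∷ 50 ∷ 25 ∷ 24 ∷ 48 ∷ 26 ∷ 47 ∷ 46 ∷ 29 ∷ 45 ∷ 44 ∷ 30 ∷ 39 ∷ 36 ∷ 35 ∷ 69 ∷ []) ∷ []) ∷
   ((0 ∷ 3 ∷ 66 ∷ 8 ∷ 9 ∷ 64 ∷ 6 ∷ 67 ∷ 4 ∷ 65 ∷ 7 ∷ 62 ∷ 63 ∷ 12 ∷ 56 ∷ 19 ∷ 50 ∷ 24 ∷ 45 ∷ 31 ∷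
     42 ∷ 32 ∷ 41 ∷ 35 ∷ 38 ∷ 36 ∷ 34 ∷ 39 ∷ 33 ∷ 37 ∷ 69 ∷ 68 ∷ 2 ∷ 5 ∷ 1 ∷ []) ∷
    (10 ∷ 11 ∷ 59 ∷ 17 ∷ 53 ∷ 22 ∷ 46 ∷ 28 ∷ 40 ∷ 30 ∷ 43 ∷ 29 ∷ 44 ∷ 26 ∷ 27 ∷ 47 ∷ 25 ∷ 49 ∷
     48 ∷ 23 ∷ 51 ∷ 20 ∷ 21 ∷ 52 ∷ 18 ∷ 54 ∷ 55 ∷ 16 ∷ 57 ∷ 14 ∷ 15 ∷ 58 ∷ 13 ∷ 61 ∷ 60 ∷ []) ∷ []) ∷
   ((0 ∷ 2 ∷ 3 ∷ 5 ∷ 65 ∷ 10 ∷ 59 ∷ 13 ∷ 56 ∷ 15 ∷ 55 ∷ 54 ∷ 16 ∷ 17 ∷ 52 ∷ 22 ∷ 50 ∷ 20 ∷ 53 ∷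
     23 ∷ 46 ∷ 47 ∷ 24 ∷ 25 ∷ 45 ∷ 30 ∷ 38 ∷ 32 ∷ 33 ∷ 41 ∷ 31 ∷ 39 ∷ 37 ∷ 36 ∷ 68 ∷ []) ∷
    (1 ∷ 6 ∷ 7 ∷ 67 ∷ 66 ∷ 4 ∷ 64 ∷ 11 ∷ 63 ∷ 62 ∷ 9 ∷ 8 ∷ 60 ∷ 61 ∷ 14 ∷ 58 ∷ 12 ∷ 57 ∷ 19 ∷
     18 ∷ 51 ∷ 21 ∷ 48 ∷ 49 ∷ 26 ∷ 43 ∷ 28 ∷ 44 ∷ 27 ∷ 42 ∷ 29 ∷ 40 ∷ 35 ∷ 34 ∷ 69 ∷ []) ∷ []) ∷
   [])
  -- Without the indices this starts 0, 3, 31, 4, 30, 7, with consecutive sums 3, 0, 1, 0, 3 mod 34: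
  -- the first and the last of these steps lie on H + 1, the three between them on H. Such changes
  -- within one cycle are what a single Hamilton cycle cannot offer.
  (((0 ∷ 6 ∷ 63 ∷ 9 ∷ 60 ∷ 15 ∷ 58 ∷ 12 ∷ 61 ∷ 11 ∷ 59 ∷ 17 ∷ 56 ∷ 14 ∷ 54 ∷ 16 ∷ 53 ∷ 19 ∷ 51 ∷
     25 ∷ 49 ∷ 22 ∷ 46 ∷ 28 ∷ 40 ∷ 31 ∷ 43 ∷ 32 ∷ 41 ∷ 35 ∷ 68 ∷ 1 ∷ 2 ∷ 66 ∷ 5 ∷ []) ∷
    (3 ∷ 4 ∷ 65 ∷ 7 ∷ 67 ∷ 8 ∷ 64 ∷ 10 ∷ 62 ∷ 13 ∷ 57 ∷ 18 ∷ 55 ∷ 21 ∷ 52 ∷ 23 ∷ 50 ∷ 20 ∷ 48 ∷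
     26 ∷ 42 ∷ 29 ∷ 44 ∷ 27 ∷ 47 ∷ 24 ∷ 45 ∷ 30 ∷ 39 ∷ 33 ∷ 37 ∷ 34 ∷ 38 ∷ 36 ∷ 69 ∷ []) ∷ []) ∷
   ((0 ∷ 7 ∷ 66 ∷ 9 ∷ 64 ∷ 6 ∷ 62 ∷ 8 ∷ 60 ∷ 10 ∷ 59 ∷ 13 ∷ 61 ∷ 15 ∷ 54 ∷ 17 ∷ 57 ∷ 14 ∷ 58 ∷
     16 ∷ 52 ∷ 18 ∷ 50 ∷ 21 ∷ 48 ∷ 22 ∷ 51 ∷ 24 ∷ 49 ∷ 27 ∷ 42 ∷ 33 ∷ 40 ∷ 34 ∷ 68 ∷ []) ∷
    (1 ∷ 3 ∷ 5 ∷ 65 ∷ 11 ∷ 63 ∷ 12 ∷ 56 ∷ 19 ∷ 55 ∷ 20 ∷ 53 ∷ 23 ∷ 47 ∷ 25 ∷ 45 ∷ 26 ∷ 46 ∷ 29 ∷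
     41 ∷ 30 ∷ 43 ∷ 28 ∷ 44 ∷ 31 ∷ 39 ∷ 32 ∷ 36 ∷ 35 ∷ 38 ∷ 37 ∷ 69 ∷ 2 ∷ 67 ∷ 4 ∷ []) ∷ []) ∷
   ((0 ∷ 2 ∷ 5 ∷ 64 ∷ 11 ∷ 62 ∷ 12 ∷ 57 ∷ 15 ∷ 55 ∷ 17 ∷ 53 ∷ 22 ∷ 47 ∷ 29 ∷ 45 ∷ 27 ∷ 46 ∷ 25 ∷
     44 ∷ 30 ∷ 42 ∷ 28 ∷ 41 ∷ 31 ∷ 38 ∷ 32 ∷ 40 ∷ 35 ∷ 39 ∷ 37 ∷ 68 ∷ 3 ∷ 66 ∷ 4 ∷ []) ∷
    (1 ∷ 7 ∷ 63 ∷ 8 ∷ 65 ∷ 6 ∷ 67 ∷ 9 ∷ 61 ∷ 10 ∷ 58 ∷ 13 ∷ 60 ∷ 14 ∷ 59 ∷ 16 ∷ 56 ∷ 18 ∷ 54 ∷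
     20 ∷ 52 ∷ 19 ∷ 50 ∷ 24 ∷ 48 ∷ 23 ∷ 51 ∷ 21 ∷ 49 ∷ 26 ∷ 43 ∷ 33 ∷ 36 ∷ 34 ∷ 69 ∷ []) ∷ []) ∷
   ((0 ∷ 3 ∷ 67 ∷ 5 ∷ 1 ∷ 6 ∷ 66 ∷ 8 ∷ 61 ∷ 14 ∷ 55 ∷ 16 ∷ 57 ∷ 19 ∷ 54 ∷ 21 ∷ 53 ∷ 18 ∷ 51 ∷
     20 ∷ 49 ∷ 23 ∷ 46 ∷ 24 ∷ 44 ∷ 26 ∷ 47 ∷ 28 ∷ 45 ∷ 31 ∷ 42 ∷ 32 ∷ 37 ∷ 35 ∷ 69 ∷ []) ∷
    (2 ∷ 4 ∷ 64 ∷ 7 ∷ 62 ∷ 9 ∷ 65 ∷ 10 ∷ 63 ∷ 13 ∷ 56 ∷ 15 ∷ 59 ∷ 12 ∷ 60 ∷ 11 ∷ 58 ∷ 17 ∷ 52 ∷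
     22 ∷ 50 ∷ 25 ∷ 48 ∷ 27 ∷ 43 ∷ 29 ∷ 40 ∷ 30 ∷ 38 ∷ 33 ∷ 41 ∷ 34 ∷ 39 ∷ 36 ∷ 68 ∷ []) ∷ []) ∷
   [])
  refl

K*74 : ResolvableCycleDecomposition 74 37
K*74 = resolve 36
  (((0 ∷ 7 ∷ 6 ∷ 71 ∷ 5 ∷ 69 ∷ 68 ∷ 10 ∷ 67 ∷ 12 ∷ 64 ∷ 15 ∷ 58 ∷ 59 ∷ 17 ∷ 60 ∷ 19 ∷ 18 ∷ 54 ∷
     55 ∷ 21 ∷ 20 ∷ 53 ∷ 52 ∷ 27 ∷ 46 ∷ 47 ∷ 28 ∷ 48 ∷ 30 ∷ 42 ∷ 32 ∷ 41 ∷ 38 ∷ 72 ∷ 3 ∷ 4 ∷ []) ∷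
    (1 ∷ 2 ∷ 70 ∷ 8 ∷ 9 ∷ 65 ∷ 11 ∷ 66 ∷ 13 ∷ 61 ∷ 14 ∷ 63 ∷ 62 ∷ 16 ∷ 56 ∷ 57 ∷ 23 ∷ 22 ∷ 50 ∷
     25 ∷ 24 ∷ 49 ∷ 26 ∷ 51 ∷ 29 ∷ 45 ∷ 44 ∷ 31 ∷ 43 ∷ 33 ∷ 40 ∷ 34 ∷ 35 ∷ 39 ∷ 36 ∷ 37 ∷ 73 ∷ []) ∷ []) ∷
   ((0 ∷ 3 ∷ 2 ∷ 5 ∷ 4 ∷ 69 ∷ 7 ∷ 70 ∷ 71 ∷ 8 ∷ 68 ∷ 6 ∷ 67 ∷ 66 ∷ 9 ∷ 64 ∷ 14 ∷ 59 ∷ 21 ∷ 56 ∷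
     23 ∷ 50 ∷ 28 ∷ 44 ∷ 35 ∷ 34 ∷ 43 ∷ 42 ∷ 37 ∷ 41 ∷ 40 ∷ 39 ∷ 38 ∷ 36 ∷ 73 ∷ 72 ∷ 1 ∷ []) ∷
    (10 ∷ 11 ∷ 63 ∷ 12 ∷ 61 ∷ 19 ∷ 54 ∷ 25 ∷ 52 ∷ 26 ∷ 47 ∷ 32 ∷ 33 ∷ 45 ∷ 30 ∷ 31 ∷ 46 ∷ 29 ∷
     48 ∷ 49 ∷ 27 ∷ 51 ∷ 24 ∷ 53 ∷ 22 ∷ 55 ∷ 20 ∷ 57 ∷ 18 ∷ 58 ∷ 17 ∷ 16 ∷ 60 ∷ 15 ∷ 62 ∷ 13 ∷
     65 ∷ []) ∷ []) ∷
   ((0 ∷ 2 ∷ 3 ∷ 71 ∷ 9 ∷ 68 ∷ 69 ∷ 6 ∷ 70 ∷ 4 ∷ 5 ∷ 1 ∷ 7 ∷ 66 ∷ 67 ∷ 8 ∷ 65 ∷ 15 ∷ 14 ∷ 62 ∷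
     12 ∷ 13 ∷ 64 ∷ 11 ∷ 10 ∷ 63 ∷ 17 ∷ 56 ∷ 22 ∷ 51 ∷ 28 ∷ 45 ∷ 31 ∷ 42 ∷ 36 ∷ 72 ∷ 73 ∷ []) ∷
    (16 ∷ 61 ∷ 60 ∷ 18 ∷ 55 ∷ 25 ∷ 53 ∷ 26 ∷ 46 ∷ 33 ∷ 41 ∷ 34 ∷ 38 ∷ 39 ∷ 37 ∷ 40 ∷ 35 ∷ 43 ∷
     32 ∷ 44 ∷ 30 ∷ 47 ∷ 29 ∷ 49 ∷ 48 ∷ 27 ∷ 50 ∷ 24 ∷ 52 ∷ 23 ∷ 54 ∷ 20 ∷ 21 ∷ 57 ∷ 19 ∷ 59 ∷
     58 ∷ []) ∷ []) ∷
   ((0 ∷ 1 ∷ 6 ∷ 7 ∷ 67 ∷ 9 ∷ 69 ∷ 10 ∷ 66 ∷ 8 ∷ 64 ∷ 65 ∷ 14 ∷ 58 ∷ 20 ∷ 52 ∷ 22 ∷ 54 ∷ 21 ∷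
     53 ∷ 23 ∷ 51 ∷ 50 ∷ 29 ∷ 28 ∷ 49 ∷ 31 ∷ 30 ∷ 46 ∷ 32 ∷ 45 ∷ 35 ∷ 38 ∷ 73 ∷ 3 ∷ 70 ∷ 5 ∷ []) ∷
    (2 ∷ 71 ∷ 4 ∷ 68 ∷ 11 ∷ 62 ∷ 63 ∷ 13 ∷ 12 ∷ 60 ∷ 61 ∷ 15 ∷ 59 ∷ 16 ∷ 17 ∷ 57 ∷ 56 ∷ 18 ∷ 19 ∷
     55 ∷ 24 ∷ 25 ∷ 48 ∷ 26 ∷ 27 ∷ 47 ∷ 33 ∷ 44 ∷ 34 ∷ 42 ∷ 43 ∷ 37 ∷ 36 ∷ 40 ∷ 41 ∷ 39 ∷ 72 ∷ []) ∷ []) ∷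
   ((0 ∷ 6 ∷ 66 ∷ 12 ∷ 65 ∷ 64 ∷ 10 ∷ 62 ∷ 17 ∷ 61 ∷ 18 ∷ 59 ∷ 20 ∷ 56 ∷ 19 ∷ 58 ∷ 21 ∷ 52 ∷ 53 ∷
     27 ∷ 26 ∷ 50 ∷ 51 ∷ 25 ∷ 49 ∷ 30 ∷ 43 ∷ 36 ∷ 41 ∷ 35 ∷ 42 ∷ 33 ∷ 32 ∷ 40 ∷ 38 ∷ 37 ∷ 72 ∷ []) ∷
    (1 ∷ 3 ∷ 5 ∷ 68 ∷ 7 ∷ 71 ∷ 70 ∷ 9 ∷ 8 ∷ 69 ∷ 11 ∷ 67 ∷ 13 ∷ 60 ∷ 14 ∷ 15 ∷ 63 ∷ 16 ∷ 57 ∷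
     22 ∷ 23 ∷ 55 ∷ 54 ∷ 24 ∷ 48 ∷ 31 ∷ 47 ∷ 46 ∷ 28 ∷ 29 ∷ 44 ∷ 45 ∷ 34 ∷ 39 ∷ 73 ∷ 2 ∷ 4 ∷ []) ∷ []) ∷
   [])
  (((0 ∷ 2 ∷ 70 ∷ 4 ∷ 1 ∷ 7 ∷ 71 ∷ 9 ∷ 69 ∷ 11 ∷ 66 ∷ 13 ∷ 64 ∷ 14 ∷ 58 ∷ 21 ∷ 53 ∷ 26 ∷ 50 ∷
     24 ∷ 52 ∷ 23 ∷ 51 ∷ 29 ∷ 49 ∷ 27 ∷ 47 ∷ 28 ∷ 44 ∷ 30 ∷ 46 ∷ 32 ∷ 45 ∷ 34 ∷ 42 ∷ 36 ∷ 72 ∷ []) ∷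
    (3 ∷ 5 ∷ 68 ∷ 6 ∷ 67 ∷ 8 ∷ 65 ∷ 10 ∷ 62 ∷ 12 ∷ 60 ∷ 15 ∷ 63 ∷ 17 ∷ 57 ∷ 18 ∷ 59 ∷ 16 ∷ 61 ∷
     19 ∷ 54 ∷ 20 ∷ 56 ∷ 22 ∷ 55 ∷ 25 ∷ 48 ∷ 31 ∷ 43 ∷ 33 ∷ 40 ∷ 35 ∷ 38 ∷ 37 ∷ 41 ∷ 39 ∷ 73 ∷ []) ∷ []) ∷
   ((0 ∷ 7 ∷ 66 ∷ 12 ∷ 64 ∷ 10 ∷ 63 ∷ 16 ∷ 57 ∷ 22 ∷ 54 ∷ 21 ∷ 56 ∷ 18 ∷ 58 ∷ 20 ∷ 53 ∷ 23 ∷ 50 ∷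
     25 ∷ 52 ∷ 26 ∷ 51 ∷ 28 ∷ 49 ∷ 30 ∷ 47 ∷ 29 ∷ 44 ∷ 31 ∷ 42 ∷ 32 ∷ 41 ∷ 38 ∷ 73 ∷ 2 ∷ 5 ∷ []) ∷
    (1 ∷ 3 ∷ 70 ∷ 8 ∷ 69 ∷ 6 ∷ 71 ∷ 4 ∷ 68 ∷ 11 ∷ 67 ∷ 9 ∷ 65 ∷ 14 ∷ 59 ∷ 17 ∷ 61 ∷ 15 ∷ 62 ∷
     13 ∷ 60 ∷ 19 ∷ 55 ∷ 24 ∷ 48 ∷ 27 ∷ 46 ∷ 33 ∷ 45 ∷ 35 ∷ 43 ∷ 36 ∷ 40 ∷ 34 ∷ 39 ∷ 37 ∷ 72 ∷ []) ∷ []) ∷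
   ((0 ∷ 6 ∷ 70 ∷ 5 ∷ 69 ∷ 10 ∷ 66 ∷ 9 ∷ 68 ∷ 7 ∷ 67 ∷ 13 ∷ 65 ∷ 11 ∷ 62 ∷ 17 ∷ 56 ∷ 23 ∷ 54 ∷
     24 ∷ 53 ∷ 27 ∷ 50 ∷ 29 ∷ 48 ∷ 30 ∷ 42 ∷ 33 ∷ 41 ∷ 34 ∷ 43 ∷ 37 ∷ 40 ∷ 38 ∷ 72 ∷ 3 ∷ 4 ∷ []) ∷
    (1 ∷ 2 ∷ 71 ∷ 8 ∷ 64 ∷ 15 ∷ 59 ∷ 20 ∷ 57 ∷ 19 ∷ 58 ∷ 16 ∷ 60 ∷ 14 ∷ 63 ∷ 12 ∷ 61 ∷ 18 ∷ 55 ∷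
     21 ∷ 52 ∷ 22 ∷ 51 ∷ 25 ∷ 49 ∷ 26 ∷ 46 ∷ 28 ∷ 45 ∷ 31 ∷ 47 ∷ 32 ∷ 44 ∷ 35 ∷ 39 ∷ 36 ∷ 73 ∷ []) ∷ []) ∷
   ((0 ∷ 3 ∷ 71 ∷ 5 ∷ 1 ∷ 6 ∷ 66 ∷ 8 ∷ 68 ∷ 10 ∷ 67 ∷ 12 ∷ 65 ∷ 15 ∷ 58 ∷ 17 ∷ 60 ∷ 18 ∷ 54 ∷
     25 ∷ 53 ∷ 22 ∷ 50 ∷ 28 ∷ 48 ∷ 26 ∷ 47 ∷ 33 ∷ 44 ∷ 34 ∷ 38 ∷ 36 ∷ 41 ∷ 35 ∷ 42 ∷ 37 ∷ 73 ∷ []) ∷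
    (2 ∷ 4 ∷ 69 ∷ 7 ∷ 70 ∷ 9 ∷ 64 ∷ 11 ∷ 63 ∷ 13 ∷ 61 ∷ 14 ∷ 62 ∷ 16 ∷ 56 ∷ 19 ∷ 59 ∷ 21 ∷ 57 ∷
     23 ∷ 55 ∷ 20 ∷ 52 ∷ 27 ∷ 51 ∷ 24 ∷ 49 ∷ 31 ∷ 46 ∷ 29 ∷ 45 ∷ 30 ∷ 43 ∷ 32 ∷ 40 ∷ 39 ∷ 72 ∷ []) ∷ []) ∷
   [])
  refl

K*78 : ResolvableCycleDecomposition 78 39
K*78 = resolve 38
  (((0 ∷ 6 ∷ 74 ∷ 9 ∷ 68 ∷ 11 ∷ 66 ∷ 17 ∷ 65 ∷ 14 ∷ 67 ∷ 12 ∷ 64 ∷ 18 ∷ 62 ∷ 16 ∷ 60 ∷ 19 ∷ 58 ∷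
     59 ∷ 24 ∷ 52 ∷ 53 ∷ 27 ∷ 54 ∷ 25 ∷ 56 ∷ 57 ∷ 26 ∷ 51 ∷ 32 ∷ 48 ∷ 35 ∷ 47 ∷ 46 ∷ 36 ∷ 41 ∷
     77 ∷ 1 ∷ []) ∷
    (2 ∷ 4 ∷ 5 ∷ 72 ∷ 7 ∷ 75 ∷ 8 ∷ 73 ∷ 10 ∷ 71 ∷ 70 ∷ 13 ∷ 69 ∷ 15 ∷ 63 ∷ 21 ∷ 20 ∷ 61 ∷ 23 ∷
     22 ∷ 55 ∷ 29 ∷ 28 ∷ 49 ∷ 30 ∷ 31 ∷ 50 ∷ 33 ∷ 45 ∷ 44 ∷ 34 ∷ 43 ∷ 42 ∷ 37 ∷ 40 ∷ 39 ∷ 38 ∷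
     76 ∷ 3 ∷ []) ∷ []) ∷
   ((0 ∷ 3 ∷ 4 ∷ 73 ∷ 11 ∷ 70 ∷ 71 ∷ 8 ∷ 68 ∷ 69 ∷ 14 ∷ 15 ∷ 67 ∷ 13 ∷ 12 ∷ 65 ∷ 64 ∷ 19 ∷ 59 ∷
     25 ∷ 57 ∷ 23 ∷ 55 ∷ 24 ∷ 53 ∷ 30 ∷ 47 ∷ 36 ∷ 37 ∷ 44 ∷ 45 ∷ 34 ∷ 42 ∷ 40 ∷ 38 ∷ 39 ∷ 77 ∷
     2 ∷ 5 ∷ []) ∷
    (1 ∷ 6 ∷ 7 ∷ 74 ∷ 75 ∷ 9 ∷ 72 ∷ 10 ∷ 66 ∷ 16 ∷ 17 ∷ 61 ∷ 22 ∷ 58 ∷ 20 ∷ 60 ∷ 18 ∷ 63 ∷ 62 ∷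
     21 ∷ 56 ∷ 26 ∷ 54 ∷ 28 ∷ 52 ∷ 27 ∷ 51 ∷ 50 ∷ 29 ∷ 48 ∷ 31 ∷ 46 ∷ 33 ∷ 32 ∷ 49 ∷ 35 ∷ 43 ∷
     41 ∷ 76 ∷ []) ∷ []) ∷
   ((0 ∷ 7 ∷ 71 ∷ 13 ∷ 65 ∷ 15 ∷ 62 ∷ 20 ∷ 57 ∷ 27 ∷ 26 ∷ 50 ∷ 28 ∷ 53 ∷ 52 ∷ 31 ∷ 30 ∷ 51 ∷ 29 ∷
     49 ∷ 48 ∷ 34 ∷ 35 ∷ 46 ∷ 47 ∷ 32 ∷ 33 ∷ 44 ∷ 39 ∷ 42 ∷ 36 ∷ 45 ∷ 38 ∷ 43 ∷ 37 ∷ 41 ∷ 40 ∷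
     77 ∷ 76 ∷ []) ∷
    (1 ∷ 2 ∷ 3 ∷ 74 ∷ 8 ∷ 69 ∷ 11 ∷ 67 ∷ 17 ∷ 60 ∷ 23 ∷ 54 ∷ 55 ∷ 25 ∷ 24 ∷ 56 ∷ 22 ∷ 59 ∷ 58 ∷
     21 ∷ 61 ∷ 18 ∷ 19 ∷ 63 ∷ 16 ∷ 64 ∷ 14 ∷ 66 ∷ 12 ∷ 68 ∷ 10 ∷ 70 ∷ 9 ∷ 73 ∷ 72 ∷ 6 ∷ 75 ∷ 5 ∷
     4 ∷ []) ∷ []) ∷
   ((0 ∷ 1 ∷ 7 ∷ 70 ∷ 12 ∷ 69 ∷ 68 ∷ 15 ∷ 14 ∷ 62 ∷ 63 ∷ 17 ∷ 16 ∷ 61 ∷ 60 ∷ 22 ∷ 54 ∷ 29 ∷ 52 ∷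
     26 ∷ 27 ∷ 55 ∷ 28 ∷ 48 ∷ 30 ∷ 50 ∷ 51 ∷ 33 ∷ 49 ∷ 34 ∷ 46 ∷ 32 ∷ 45 ∷ 39 ∷ 76 ∷ 2 ∷ 75 ∷
     74 ∷ 4 ∷ []) ∷
    (3 ∷ 5 ∷ 73 ∷ 6 ∷ 71 ∷ 9 ∷ 8 ∷ 72 ∷ 11 ∷ 10 ∷ 67 ∷ 66 ∷ 13 ∷ 64 ∷ 65 ∷ 19 ∷ 18 ∷ 59 ∷ 20 ∷
     21 ∷ 57 ∷ 56 ∷ 23 ∷ 58 ∷ 24 ∷ 25 ∷ 53 ∷ 31 ∷ 47 ∷ 37 ∷ 36 ∷ 44 ∷ 35 ∷ 42 ∷ 43 ∷ 40 ∷ 41 ∷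
     38 ∷ 77 ∷ []) ∷ []) ∷
   ((0 ∷ 2 ∷ 74 ∷ 5 ∷ 1 ∷ 3 ∷ 75 ∷ 4 ∷ 72 ∷ 73 ∷ 7 ∷ 6 ∷ 70 ∷ 8 ∷ 9 ∷ 69 ∷ 10 ∷ 11 ∷ 71 ∷ 12 ∷
     13 ∷ 68 ∷ 14 ∷ 63 ∷ 20 ∷ 56 ∷ 27 ∷ 50 ∷ 32 ∷ 44 ∷ 38 ∷ 42 ∷ 41 ∷ 39 ∷ 43 ∷ 36 ∷ 40 ∷ 76 ∷
     77 ∷ []) ∷
    (15 ∷ 66 ∷ 67 ∷ 16 ∷ 65 ∷ 18 ∷ 58 ∷ 25 ∷ 52 ∷ 30 ∷ 46 ∷ 37 ∷ 45 ∷ 35 ∷ 34 ∷ 47 ∷ 33 ∷ 48 ∷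
     49 ∷ 31 ∷ 51 ∷ 28 ∷ 29 ∷ 53 ∷ 26 ∷ 55 ∷ 54 ∷ 24 ∷ 57 ∷ 22 ∷ 23 ∷ 59 ∷ 21 ∷ 60 ∷ 61 ∷ 19 ∷
     62 ∷ 17 ∷ 64 ∷ []) ∷ []) ∷
   [])
  (((0 ∷ 6 ∷ 74 ∷ 5 ∷ 1 ∷ 3 ∷ 75 ∷ 8 ∷ 72 ∷ 7 ∷ 71 ∷ 13 ∷ 68 ∷ 14 ∷ 66 ∷ 12 ∷ 64 ∷ 19 ∷ 59 ∷ 24 ∷
     56 ∷ 26 ∷ 54 ∷ 25 ∷ 53 ∷ 27 ∷ 50 ∷ 28 ∷ 52 ∷ 31 ∷ 47 ∷ 33 ∷ 45 ∷ 35 ∷ 46 ∷ 37 ∷ 40 ∷ 38 ∷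
     76 ∷ []) ∷
    (2 ∷ 4 ∷ 73 ∷ 10 ∷ 70 ∷ 9 ∷ 69 ∷ 11 ∷ 67 ∷ 17 ∷ 60 ∷ 22 ∷ 58 ∷ 21 ∷ 61 ∷ 18 ∷ 62 ∷ 16 ∷ 65 ∷
     15 ∷ 63 ∷ 20 ∷ 57 ∷ 23 ∷ 55 ∷ 29 ∷ 48 ∷ 30 ∷ 51 ∷ 32 ∷ 49 ∷ 34 ∷ 42 ∷ 36 ∷ 44 ∷ 39 ∷ 43 ∷
     41 ∷ 77 ∷ []) ∷ []) ∷
   ((0 ∷ 3 ∷ 74 ∷ 8 ∷ 68 ∷ 10 ∷ 67 ∷ 12 ∷ 65 ∷ 18 ∷ 59 ∷ 21 ∷ 56 ∷ 23 ∷ 58 ∷ 25 ∷ 52 ∷ 26 ∷ 51 ∷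
     28 ∷ 53 ∷ 31 ∷ 50 ∷ 33 ∷ 44 ∷ 35 ∷ 42 ∷ 37 ∷ 45 ∷ 38 ∷ 43 ∷ 40 ∷ 76 ∷ 2 ∷ 5 ∷ 73 ∷ 7 ∷ 75 ∷
     4 ∷ []) ∷
    (1 ∷ 6 ∷ 71 ∷ 9 ∷ 72 ∷ 11 ∷ 70 ∷ 13 ∷ 69 ∷ 14 ∷ 62 ∷ 20 ∷ 60 ∷ 19 ∷ 63 ∷ 16 ∷ 64 ∷ 15 ∷ 66 ∷
     17 ∷ 61 ∷ 22 ∷ 55 ∷ 24 ∷ 57 ∷ 27 ∷ 54 ∷ 29 ∷ 49 ∷ 30 ∷ 46 ∷ 32 ∷ 48 ∷ 34 ∷ 47 ∷ 36 ∷ 41 ∷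
     39 ∷ 77 ∷ []) ∷ []) ∷
   ((0 ∷ 2 ∷ 75 ∷ 5 ∷ 72 ∷ 10 ∷ 71 ∷ 8 ∷ 73 ∷ 6 ∷ 70 ∷ 12 ∷ 69 ∷ 15 ∷ 62 ∷ 21 ∷ 60 ∷ 23 ∷ 59 ∷
     25 ∷ 57 ∷ 22 ∷ 54 ∷ 24 ∷ 53 ∷ 26 ∷ 55 ∷ 28 ∷ 49 ∷ 31 ∷ 46 ∷ 33 ∷ 48 ∷ 35 ∷ 47 ∷ 37 ∷ 44 ∷
     38 ∷ 77 ∷ []) ∷
    (1 ∷ 7 ∷ 74 ∷ 9 ∷ 68 ∷ 11 ∷ 66 ∷ 13 ∷ 64 ∷ 18 ∷ 63 ∷ 17 ∷ 65 ∷ 14 ∷ 67 ∷ 16 ∷ 61 ∷ 19 ∷ 58 ∷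
     20 ∷ 56 ∷ 27 ∷ 51 ∷ 29 ∷ 52 ∷ 30 ∷ 50 ∷ 32 ∷ 45 ∷ 34 ∷ 43 ∷ 36 ∷ 40 ∷ 39 ∷ 42 ∷ 41 ∷ 76 ∷
     3 ∷ 4 ∷ []) ∷ []) ∷
   ((0 ∷ 7 ∷ 70 ∷ 8 ∷ 69 ∷ 10 ∷ 66 ∷ 16 ∷ 60 ∷ 18 ∷ 58 ∷ 24 ∷ 52 ∷ 27 ∷ 55 ∷ 25 ∷ 56 ∷ 22 ∷ 59 ∷
     20 ∷ 61 ∷ 23 ∷ 54 ∷ 28 ∷ 48 ∷ 31 ∷ 51 ∷ 33 ∷ 49 ∷ 35 ∷ 43 ∷ 37 ∷ 41 ∷ 38 ∷ 42 ∷ 40 ∷ 77 ∷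
     3 ∷ 5 ∷ []) ∷
    (1 ∷ 2 ∷ 74 ∷ 4 ∷ 72 ∷ 6 ∷ 75 ∷ 9 ∷ 73 ∷ 11 ∷ 71 ∷ 12 ∷ 68 ∷ 15 ∷ 67 ∷ 13 ∷ 65 ∷ 19 ∷ 62 ∷
     17 ∷ 64 ∷ 14 ∷ 63 ∷ 21 ∷ 57 ∷ 26 ∷ 50 ∷ 29 ∷ 53 ∷ 30 ∷ 47 ∷ 32 ∷ 44 ∷ 34 ∷ 46 ∷ 36 ∷ 45 ∷
     39 ∷ 76 ∷ []) ∷ []) ∷
   [])
  refl

K*82 : ResolvableCycleDecomposition 82 41
K*82 = resolve 40
  (((0 ∷ 7 ∷ 78 ∷ 5 ∷ 76 ∷ 6 ∷ 79 ∷ 9 ∷ 8 ∷ 73 ∷ 14 ∷ 66 ∷ 21 ∷ 20 ∷ 60 ∷ 27 ∷ 26 ∷ 59 ∷ 24 ∷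
     61 ∷ 22 ∷ 23 ∷ 58 ∷ 29 ∷ 28 ∷ 53 ∷ 30 ∷ 51 ∷ 33 ∷ 52 ∷ 34 ∷ 50 ∷ 36 ∷ 48 ∷ 35 ∷ 47 ∷ 37 ∷
     45 ∷ 43 ∷ 81 ∷ 1 ∷ []) ∷
    (2 ∷ 4 ∷ 77 ∷ 10 ∷ 71 ∷ 70 ∷ 13 ∷ 72 ∷ 11 ∷ 74 ∷ 75 ∷ 12 ∷ 69 ∷ 68 ∷ 15 ∷ 67 ∷ 17 ∷ 16 ∷ 64 ∷
     65 ∷ 19 ∷ 18 ∷ 62 ∷ 63 ∷ 25 ∷ 56 ∷ 57 ∷ 31 ∷ 55 ∷ 54 ∷ 32 ∷ 49 ∷ 38 ∷ 39 ∷ 46 ∷ 40 ∷ 41 ∷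
     44 ∷ 42 ∷ 80 ∷ 3 ∷ []) ∷ []) ∷
   ((0 ∷ 2 ∷ 5 ∷ 1 ∷ 7 ∷ 75 ∷ 13 ∷ 69 ∷ 19 ∷ 62 ∷ 24 ∷ 56 ∷ 26 ∷ 55 ∷ 33 ∷ 53 ∷ 31 ∷ 51 ∷ 36 ∷
     37 ∷ 49 ∷ 34 ∷ 35 ∷ 50 ∷ 32 ∷ 48 ∷ 38 ∷ 47 ∷ 46 ∷ 41 ∷ 40 ∷ 45 ∷ 44 ∷ 39 ∷ 42 ∷ 43 ∷ 80 ∷
     81 ∷ 3 ∷ 79 ∷ 4 ∷ []) ∷
    (6 ∷ 78 ∷ 9 ∷ 76 ∷ 11 ∷ 71 ∷ 17 ∷ 65 ∷ 22 ∷ 58 ∷ 28 ∷ 52 ∷ 30 ∷ 54 ∷ 29 ∷ 57 ∷ 27 ∷ 59 ∷ 25 ∷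
     60 ∷ 61 ∷ 23 ∷ 63 ∷ 20 ∷ 21 ∷ 64 ∷ 18 ∷ 67 ∷ 66 ∷ 16 ∷ 68 ∷ 14 ∷ 15 ∷ 70 ∷ 12 ∷ 73 ∷ 72 ∷
     10 ∷ 74 ∷ 8 ∷ 77 ∷ []) ∷ []) ∷
   ((0 ∷ 3 ∷ 5 ∷ 4 ∷ 1 ∷ 6 ∷ 7 ∷ 74 ∷ 12 ∷ 13 ∷ 73 ∷ 15 ∷ 66 ∷ 17 ∷ 68 ∷ 69 ∷ 18 ∷ 63 ∷ 62 ∷ 21 ∷
     60 ∷ 23 ∷ 22 ∷ 59 ∷ 58 ∷ 24 ∷ 25 ∷ 57 ∷ 30 ∷ 55 ∷ 29 ∷ 53 ∷ 52 ∷ 35 ∷ 34 ∷ 47 ∷ 36 ∷ 45 ∷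
     42 ∷ 40 ∷ 81 ∷ []) ∷
    (2 ∷ 79 ∷ 78 ∷ 8 ∷ 76 ∷ 77 ∷ 11 ∷ 10 ∷ 75 ∷ 9 ∷ 72 ∷ 14 ∷ 70 ∷ 71 ∷ 16 ∷ 65 ∷ 64 ∷ 19 ∷ 67 ∷
     20 ∷ 61 ∷ 26 ∷ 27 ∷ 54 ∷ 28 ∷ 56 ∷ 31 ∷ 50 ∷ 51 ∷ 32 ∷ 33 ∷ 48 ∷ 49 ∷ 39 ∷ 38 ∷ 46 ∷ 37 ∷
     44 ∷ 43 ∷ 41 ∷ 80 ∷ []) ∷ []) ∷
   ((0 ∷ 6 ∷ 74 ∷ 13 ∷ 68 ∷ 19 ∷ 63 ∷ 21 ∷ 61 ∷ 27 ∷ 55 ∷ 28 ∷ 57 ∷ 26 ∷ 58 ∷ 25 ∷ 24 ∷ 60 ∷ 22 ∷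
     62 ∷ 20 ∷ 65 ∷ 18 ∷ 66 ∷ 67 ∷ 16 ∷ 69 ∷ 15 ∷ 14 ∷ 71 ∷ 12 ∷ 72 ∷ 73 ∷ 11 ∷ 75 ∷ 8 ∷ 9 ∷ 77 ∷
     7 ∷ 79 ∷ 5 ∷ []) ∷
    (1 ∷ 2 ∷ 3 ∷ 78 ∷ 4 ∷ 76 ∷ 10 ∷ 70 ∷ 17 ∷ 64 ∷ 23 ∷ 59 ∷ 29 ∷ 56 ∷ 30 ∷ 31 ∷ 54 ∷ 33 ∷ 32 ∷
     52 ∷ 53 ∷ 35 ∷ 51 ∷ 50 ∷ 37 ∷ 36 ∷ 49 ∷ 48 ∷ 34 ∷ 46 ∷ 47 ∷ 41 ∷ 45 ∷ 39 ∷ 43 ∷ 40 ∷ 44 ∷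
     38 ∷ 42 ∷ 81 ∷ 80 ∷ []) ∷ []) ∷
   ((0 ∷ 1 ∷ 3 ∷ 4 ∷ 5 ∷ 77 ∷ 76 ∷ 7 ∷ 6 ∷ 75 ∷ 74 ∷ 9 ∷ 73 ∷ 10 ∷ 11 ∷ 70 ∷ 16 ∷ 17 ∷ 69 ∷ 14 ∷
     67 ∷ 21 ∷ 65 ∷ 23 ∷ 62 ∷ 25 ∷ 61 ∷ 60 ∷ 26 ∷ 54 ∷ 55 ∷ 32 ∷ 53 ∷ 34 ∷ 51 ∷ 37 ∷ 48 ∷ 39 ∷
     47 ∷ 40 ∷ 80 ∷ []) ∷
    (2 ∷ 78 ∷ 79 ∷ 8 ∷ 72 ∷ 15 ∷ 71 ∷ 13 ∷ 12 ∷ 68 ∷ 18 ∷ 19 ∷ 66 ∷ 20 ∷ 64 ∷ 22 ∷ 63 ∷ 24 ∷ 57 ∷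
     56 ∷ 27 ∷ 58 ∷ 59 ∷ 28 ∷ 29 ∷ 52 ∷ 31 ∷ 30 ∷ 50 ∷ 33 ∷ 49 ∷ 35 ∷ 46 ∷ 36 ∷ 44 ∷ 45 ∷ 38 ∷
     43 ∷ 42 ∷ 41 ∷ 81 ∷ []) ∷ []) ∷
   [])
  (((0 ∷ 6 ∷ 79 ∷ 8 ∷ 72 ∷ 10 ∷ 74 ∷ 12 ∷ 73 ∷ 14 ∷ 67 ∷ 17 ∷ 69 ∷ 19 ∷ 66 ∷ 20 ∷ 64 ∷ 18 ∷ 63 ∷
     24 ∷ 56 ∷ 26 ∷ 58 ∷ 25 ∷ 60 ∷ 23 ∷ 59 ∷ 29 ∷ 52 ∷ 35 ∷ 50 ∷ 37 ∷ 49 ∷ 34 ∷ 46 ∷ 36 ∷ 44 ∷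
     43 ∷ 81 ∷ 2 ∷ 4 ∷ []) ∷
    (1 ∷ 3 ∷ 78 ∷ 5 ∷ 76 ∷ 7 ∷ 75 ∷ 9 ∷ 77 ∷ 11 ∷ 70 ∷ 13 ∷ 68 ∷ 15 ∷ 71 ∷ 16 ∷ 65 ∷ 22 ∷ 62 ∷
     21 ∷ 61 ∷ 27 ∷ 55 ∷ 28 ∷ 57 ∷ 31 ∷ 54 ∷ 33 ∷ 53 ∷ 30 ∷ 51 ∷ 32 ∷ 48 ∷ 38 ∷ 42 ∷ 40 ∷ 45 ∷
     39 ∷ 47 ∷ 41 ∷ 80 ∷ []) ∷ []) ∷
   ((0 ∷ 2 ∷ 78 ∷ 9 ∷ 76 ∷ 11 ∷ 74 ∷ 8 ∷ 73 ∷ 10 ∷ 70 ∷ 12 ∷ 72 ∷ 14 ∷ 71 ∷ 17 ∷ 68 ∷ 19 ∷ 62 ∷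
     25 ∷ 56 ∷ 27 ∷ 54 ∷ 29 ∷ 57 ∷ 30 ∷ 55 ∷ 32 ∷ 53 ∷ 35 ∷ 51 ∷ 36 ∷ 49 ∷ 39 ∷ 46 ∷ 37 ∷ 45 ∷
     38 ∷ 43 ∷ 41 ∷ 81 ∷ []) ∷
    (1 ∷ 7 ∷ 79 ∷ 5 ∷ 77 ∷ 6 ∷ 75 ∷ 13 ∷ 69 ∷ 15 ∷ 66 ∷ 21 ∷ 65 ∷ 18 ∷ 67 ∷ 16 ∷ 64 ∷ 22 ∷ 63 ∷
     20 ∷ 60 ∷ 26 ∷ 59 ∷ 24 ∷ 61 ∷ 23 ∷ 58 ∷ 28 ∷ 52 ∷ 31 ∷ 50 ∷ 33 ∷ 48 ∷ 34 ∷ 47 ∷ 40 ∷ 44 ∷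
     42 ∷ 80 ∷ 3 ∷ 4 ∷ []) ∷ []) ∷
   ((0 ∷ 3 ∷ 79 ∷ 4 ∷ 77 ∷ 7 ∷ 74 ∷ 9 ∷ 73 ∷ 11 ∷ 71 ∷ 13 ∷ 72 ∷ 15 ∷ 67 ∷ 20 ∷ 61 ∷ 22 ∷ 59 ∷
     25 ∷ 57 ∷ 26 ∷ 54 ∷ 28 ∷ 53 ∷ 34 ∷ 51 ∷ 37 ∷ 48 ∷ 39 ∷ 42 ∷ 41 ∷ 44 ∷ 38 ∷ 47 ∷ 36 ∷ 45 ∷
     43 ∷ 80 ∷ 2 ∷ 5 ∷ []) ∷
    (1 ∷ 6 ∷ 78 ∷ 8 ∷ 76 ∷ 10 ∷ 75 ∷ 12 ∷ 68 ∷ 14 ∷ 70 ∷ 16 ∷ 69 ∷ 18 ∷ 66 ∷ 17 ∷ 65 ∷ 19 ∷ 63 ∷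
     21 ∷ 64 ∷ 23 ∷ 62 ∷ 24 ∷ 60 ∷ 27 ∷ 58 ∷ 29 ∷ 56 ∷ 31 ∷ 55 ∷ 33 ∷ 52 ∷ 30 ∷ 50 ∷ 32 ∷ 49 ∷
     35 ∷ 46 ∷ 40 ∷ 81 ∷ []) ∷ []) ∷
   ((0 ∷ 7 ∷ 78 ∷ 4 ∷ 76 ∷ 6 ∷ 74 ∷ 13 ∷ 73 ∷ 15 ∷ 70 ∷ 17 ∷ 64 ∷ 19 ∷ 67 ∷ 21 ∷ 60 ∷ 22 ∷ 58 ∷
     24 ∷ 57 ∷ 27 ∷ 59 ∷ 28 ∷ 56 ∷ 30 ∷ 54 ∷ 32 ∷ 52 ∷ 34 ∷ 50 ∷ 36 ∷ 48 ∷ 35 ∷ 47 ∷ 37 ∷ 44 ∷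
     39 ∷ 43 ∷ 40 ∷ 80 ∷ []) ∷
    (1 ∷ 2 ∷ 79 ∷ 9 ∷ 72 ∷ 11 ∷ 75 ∷ 8 ∷ 77 ∷ 10 ∷ 71 ∷ 12 ∷ 69 ∷ 14 ∷ 66 ∷ 16 ∷ 68 ∷ 18 ∷ 62 ∷
     20 ∷ 65 ∷ 23 ∷ 63 ∷ 25 ∷ 61 ∷ 26 ∷ 55 ∷ 29 ∷ 53 ∷ 31 ∷ 51 ∷ 33 ∷ 49 ∷ 38 ∷ 46 ∷ 41 ∷ 45 ∷
     42 ∷ 81 ∷ 3 ∷ 5 ∷ []) ∷ []) ∷
   [])
  refl

K*86 : ResolvableCycleDecomposition 86 43
K*86 = resolve 42
  (((0 ∷ 3 ∷ 83 ∷ 82 ∷ 4 ∷ 80 ∷ 81 ∷ 7 ∷ 78 ∷ 12 ∷ 13 ∷ 77 ∷ 11 ∷ 10 ∷ 74 ∷ 75 ∷ 16 ∷ 17 ∷ 73 ∷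
     72 ∷ 18 ∷ 19 ∷ 70 ∷ 20 ∷ 68 ∷ 69 ∷ 23 ∷ 63 ∷ 62 ∷ 29 ∷ 57 ∷ 31 ∷ 30 ∷ 55 ∷ 33 ∷ 32 ∷ 52 ∷
     38 ∷ 39 ∷ 47 ∷ 40 ∷ 45 ∷ 84 ∷ []) ∷
    (1 ∷ 6 ∷ 79 ∷ 9 ∷ 8 ∷ 76 ∷ 15 ∷ 14 ∷ 71 ∷ 21 ∷ 65 ∷ 64 ∷ 22 ∷ 67 ∷ 66 ∷ 25 ∷ 24 ∷ 60 ∷ 61 ∷
     26 ∷ 27 ∷ 59 ∷ 58 ∷ 28 ∷ 56 ∷ 35 ∷ 54 ∷ 37 ∷ 53 ∷ 34 ∷ 50 ∷ 51 ∷ 36 ∷ 49 ∷ 48 ∷ 42 ∷ 46 ∷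
     41 ∷ 44 ∷ 43 ∷ 85 ∷ 2 ∷ 5 ∷ []) ∷ []) ∷
   ((0 ∷ 2 ∷ 82 ∷ 8 ∷ 77 ∷ 15 ∷ 71 ∷ 20 ∷ 65 ∷ 26 ∷ 63 ∷ 29 ∷ 28 ∷ 60 ∷ 27 ∷ 62 ∷ 24 ∷ 64 ∷ 23 ∷
     22 ∷ 66 ∷ 21 ∷ 69 ∷ 68 ∷ 18 ∷ 70 ∷ 17 ∷ 16 ∷ 73 ∷ 14 ∷ 74 ∷ 13 ∷ 76 ∷ 10 ∷ 79 ∷ 78 ∷ 9 ∷
     81 ∷ 6 ∷ 7 ∷ 83 ∷ 4 ∷ 1 ∷ []) ∷
    (3 ∷ 5 ∷ 80 ∷ 11 ∷ 75 ∷ 12 ∷ 72 ∷ 19 ∷ 67 ∷ 25 ∷ 61 ∷ 30 ∷ 58 ∷ 33 ∷ 56 ∷ 31 ∷ 59 ∷ 32 ∷ 57 ∷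
     34 ∷ 51 ∷ 37 ∷ 52 ∷ 35 ∷ 55 ∷ 54 ∷ 36 ∷ 53 ∷ 39 ∷ 38 ∷ 50 ∷ 41 ∷ 48 ∷ 49 ∷ 42 ∷ 47 ∷ 46 ∷
     40 ∷ 44 ∷ 45 ∷ 43 ∷ 84 ∷ 85 ∷ []) ∷ []) ∷
   ((0 ∷ 1 ∷ 7 ∷ 79 ∷ 13 ∷ 73 ∷ 18 ∷ 66 ∷ 20 ∷ 64 ∷ 27 ∷ 58 ∷ 59 ∷ 28 ∷ 29 ∷ 60 ∷ 26 ∷ 62 ∷ 25 ∷
     65 ∷ 23 ∷ 67 ∷ 21 ∷ 68 ∷ 19 ∷ 71 ∷ 70 ∷ 16 ∷ 72 ∷ 15 ∷ 74 ∷ 12 ∷ 77 ∷ 10 ∷ 11 ∷ 78 ∷ 8 ∷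
     81 ∷ 80 ∷ 6 ∷ 82 ∷ 5 ∷ 4 ∷ []) ∷
    (2 ∷ 83 ∷ 9 ∷ 76 ∷ 14 ∷ 75 ∷ 17 ∷ 69 ∷ 22 ∷ 63 ∷ 24 ∷ 61 ∷ 31 ∷ 55 ∷ 32 ∷ 56 ∷ 57 ∷ 30 ∷ 54 ∷
     33 ∷ 53 ∷ 52 ∷ 34 ∷ 35 ∷ 51 ∷ 41 ∷ 40 ∷ 48 ∷ 39 ∷ 50 ∷ 36 ∷ 37 ∷ 49 ∷ 38 ∷ 46 ∷ 45 ∷ 42 ∷
     43 ∷ 47 ∷ 44 ∷ 85 ∷ 84 ∷ 3 ∷ []) ∷ []) ∷
   ((0 ∷ 6 ∷ 83 ∷ 8 ∷ 80 ∷ 7 ∷ 82 ∷ 9 ∷ 77 ∷ 76 ∷ 11 ∷ 74 ∷ 16 ∷ 69 ∷ 19 ∷ 18 ∷ 67 ∷ 20 ∷ 21 ∷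
     64 ∷ 26 ∷ 58 ∷ 29 ∷ 61 ∷ 27 ∷ 63 ∷ 25 ∷ 60 ∷ 31 ∷ 54 ∷ 32 ∷ 53 ∷ 35 ∷ 34 ∷ 55 ∷ 37 ∷ 36 ∷
     48 ∷ 38 ∷ 47 ∷ 41 ∷ 45 ∷ 85 ∷ []) ∷
    (1 ∷ 2 ∷ 3 ∷ 4 ∷ 5 ∷ 81 ∷ 10 ∷ 78 ∷ 79 ∷ 12 ∷ 73 ∷ 15 ∷ 75 ∷ 13 ∷ 72 ∷ 14 ∷ 70 ∷ 71 ∷ 17 ∷
     68 ∷ 23 ∷ 66 ∷ 24 ∷ 65 ∷ 22 ∷ 62 ∷ 28 ∷ 57 ∷ 56 ∷ 30 ∷ 59 ∷ 33 ∷ 52 ∷ 39 ∷ 51 ∷ 50 ∷ 40 ∷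
     49 ∷ 43 ∷ 46 ∷ 44 ∷ 42 ∷ 84 ∷ []) ∷ []) ∷
   ((0 ∷ 7 ∷ 6 ∷ 78 ∷ 13 ∷ 12 ∷ 76 ∷ 77 ∷ 14 ∷ 15 ∷ 70 ∷ 21 ∷ 20 ∷ 69 ∷ 18 ∷ 71 ∷ 16 ∷ 68 ∷ 22 ∷
     23 ∷ 62 ∷ 63 ∷ 28 ∷ 61 ∷ 60 ∷ 30 ∷ 31 ∷ 58 ∷ 32 ∷ 33 ∷ 57 ∷ 35 ∷ 50 ∷ 37 ∷ 48 ∷ 43 ∷ 42 ∷
     85 ∷ 1 ∷ 3 ∷ 82 ∷ 83 ∷ 5 ∷ []) ∷
    (2 ∷ 4 ∷ 81 ∷ 11 ∷ 79 ∷ 8 ∷ 9 ∷ 80 ∷ 10 ∷ 75 ∷ 74 ∷ 17 ∷ 72 ∷ 73 ∷ 19 ∷ 66 ∷ 67 ∷ 24 ∷ 25 ∷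
     64 ∷ 65 ∷ 27 ∷ 26 ∷ 59 ∷ 29 ∷ 56 ∷ 34 ∷ 54 ∷ 55 ∷ 36 ∷ 52 ∷ 53 ∷ 38 ∷ 51 ∷ 40 ∷ 41 ∷ 49 ∷
     39 ∷ 46 ∷ 47 ∷ 45 ∷ 44 ∷ 84 ∷ []) ∷ []) ∷
   [])
  (((0 ∷ 3 ∷ 83 ∷ 8 ∷ 80 ∷ 11 ∷ 75 ∷ 13 ∷ 76 ∷ 10 ∷ 78 ∷ 9 ∷ 77 ∷ 15 ∷ 74 ∷ 17 ∷ 72 ∷ 14 ∷ 71 ∷
     16 ∷ 69 ∷ 19 ∷ 70 ∷ 21 ∷ 68 ∷ 22 ∷ 66 ∷ 25 ∷ 64 ∷ 27 ∷ 63 ∷ 29 ∷ 57 ∷ 34 ∷ 50 ∷ 41 ∷ 48 ∷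
     39 ∷ 46 ∷ 45 ∷ 84 ∷ 2 ∷ 4 ∷ []) ∷
    (1 ∷ 6 ∷ 82 ∷ 5 ∷ 81 ∷ 7 ∷ 79 ∷ 12 ∷ 73 ∷ 18 ∷ 67 ∷ 20 ∷ 65 ∷ 23 ∷ 62 ∷ 24 ∷ 61 ∷ 30 ∷ 58 ∷
     28 ∷ 60 ∷ 26 ∷ 59 ∷ 32 ∷ 56 ∷ 31 ∷ 54 ∷ 33 ∷ 52 ∷ 35 ∷ 55 ∷ 37 ∷ 53 ∷ 38 ∷ 51 ∷ 36 ∷ 49 ∷
     42 ∷ 47 ∷ 40 ∷ 44 ∷ 43 ∷ 85 ∷ []) ∷ []) ∷
   ((0 ∷ 7 ∷ 83 ∷ 4 ∷ 81 ∷ 11 ∷ 78 ∷ 8 ∷ 76 ∷ 14 ∷ 75 ∷ 12 ∷ 77 ∷ 10 ∷ 74 ∷ 16 ∷ 72 ∷ 18 ∷ 70 ∷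
     20 ∷ 64 ∷ 26 ∷ 62 ∷ 29 ∷ 60 ∷ 31 ∷ 55 ∷ 33 ∷ 56 ∷ 30 ∷ 59 ∷ 28 ∷ 57 ∷ 35 ∷ 50 ∷ 40 ∷ 48 ∷
     43 ∷ 47 ∷ 45 ∷ 85 ∷ 2 ∷ 5 ∷ []) ∷
    (1 ∷ 3 ∷ 82 ∷ 9 ∷ 80 ∷ 6 ∷ 79 ∷ 13 ∷ 73 ∷ 15 ∷ 71 ∷ 17 ∷ 68 ∷ 19 ∷ 67 ∷ 21 ∷ 69 ∷ 23 ∷ 66 ∷
     24 ∷ 65 ∷ 22 ∷ 63 ∷ 25 ∷ 61 ∷ 27 ∷ 58 ∷ 32 ∷ 53 ∷ 34 ∷ 54 ∷ 36 ∷ 52 ∷ 39 ∷ 51 ∷ 37 ∷ 49 ∷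
     38 ∷ 46 ∷ 41 ∷ 44 ∷ 42 ∷ 84 ∷ []) ∷ []) ∷
   ((0 ∷ 6 ∷ 83 ∷ 5 ∷ 80 ∷ 7 ∷ 78 ∷ 13 ∷ 77 ∷ 11 ∷ 74 ∷ 12 ∷ 72 ∷ 19 ∷ 66 ∷ 20 ∷ 68 ∷ 18 ∷ 71 ∷
     21 ∷ 65 ∷ 27 ∷ 62 ∷ 25 ∷ 60 ∷ 30 ∷ 55 ∷ 36 ∷ 48 ∷ 38 ∷ 50 ∷ 37 ∷ 52 ∷ 34 ∷ 51 ∷ 41 ∷ 45 ∷
     42 ∷ 46 ∷ 40 ∷ 49 ∷ 43 ∷ 84 ∷ []) ∷
    (1 ∷ 2 ∷ 82 ∷ 8 ∷ 81 ∷ 10 ∷ 79 ∷ 9 ∷ 76 ∷ 15 ∷ 75 ∷ 16 ∷ 73 ∷ 14 ∷ 70 ∷ 17 ∷ 69 ∷ 22 ∷ 67 ∷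
     24 ∷ 64 ∷ 23 ∷ 63 ∷ 28 ∷ 61 ∷ 26 ∷ 58 ∷ 29 ∷ 56 ∷ 35 ∷ 54 ∷ 32 ∷ 57 ∷ 31 ∷ 59 ∷ 33 ∷ 53 ∷
     39 ∷ 47 ∷ 44 ∷ 85 ∷ 3 ∷ 4 ∷ []) ∷ []) ∷
   ((0 ∷ 2 ∷ 83 ∷ 9 ∷ 81 ∷ 6 ∷ 78 ∷ 12 ∷ 76 ∷ 11 ∷ 79 ∷ 8 ∷ 77 ∷ 14 ∷ 74 ∷ 13 ∷ 72 ∷ 15 ∷ 70 ∷
     16 ∷ 68 ∷ 23 ∷ 67 ∷ 25 ∷ 65 ∷ 26 ∷ 63 ∷ 24 ∷ 60 ∷ 27 ∷ 59 ∷ 29 ∷ 61 ∷ 31 ∷ 58 ∷ 33 ∷ 57 ∷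
     30 ∷ 54 ∷ 37 ∷ 48 ∷ 42 ∷ 85 ∷ []) ∷
    (1 ∷ 7 ∷ 82 ∷ 4 ∷ 80 ∷ 10 ∷ 75 ∷ 17 ∷ 73 ∷ 19 ∷ 71 ∷ 20 ∷ 69 ∷ 18 ∷ 66 ∷ 21 ∷ 64 ∷ 22 ∷ 62 ∷
     28 ∷ 56 ∷ 34 ∷ 55 ∷ 32 ∷ 52 ∷ 38 ∷ 47 ∷ 41 ∷ 49 ∷ 39 ∷ 50 ∷ 36 ∷ 53 ∷ 35 ∷ 51 ∷ 40 ∷ 45 ∷
     43 ∷ 46 ∷ 44 ∷ 84 ∷ 3 ∷ 5 ∷ []) ∷ []) ∷
   [])
  refl

K*90 : ResolvableCycleDecomposition 90 45
K*90 = resolve 44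
  (((0 ∷ 1 ∷ 2 ∷ 4 ∷ 5 ∷ 85 ∷ 6 ∷ 83 ∷ 82 ∷ 13 ∷ 77 ∷ 15 ∷ 74 ∷ 16 ∷ 73 ∷ 22 ∷ 23 ∷ 71 ∷ 20 ∷
     21 ∷ 68 ∷ 27 ∷ 67 ∷ 66 ∷ 29 ∷ 28 ∷ 65 ∷ 64 ∷ 30 ∷ 31 ∷ 58 ∷ 32 ∷ 61 ∷ 60 ∷ 35 ∷ 34 ∷ 59 ∷
     37 ∷ 53 ∷ 43 ∷ 50 ∷ 44 ∷ 48 ∷ 46 ∷ 88 ∷ []) ∷
    (3 ∷ 87 ∷ 9 ∷ 84 ∷ 7 ∷ 86 ∷ 8 ∷ 81 ∷ 80 ∷ 10 ∷ 11 ∷ 79 ∷ 78 ∷ 12 ∷ 76 ∷ 14 ∷ 75 ∷ 17 ∷ 72 ∷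
     19 ∷ 18 ∷ 70 ∷ 24 ∷ 25 ∷ 69 ∷ 26 ∷ 63 ∷ 62 ∷ 33 ∷ 56 ∷ 57 ∷ 39 ∷ 38 ∷ 54 ∷ 55 ∷ 36 ∷ 52 ∷
     42 ∷ 51 ∷ 40 ∷ 41 ∷ 49 ∷ 47 ∷ 45 ∷ 89 ∷ []) ∷ []) ∷
   ((0 ∷ 2 ∷ 3 ∷ 4 ∷ 84 ∷ 11 ∷ 78 ∷ 13 ∷ 76 ∷ 18 ∷ 71 ∷ 25 ∷ 65 ∷ 31 ∷ 59 ∷ 32 ∷ 57 ∷ 34 ∷ 54 ∷
     36 ∷ 56 ∷ 38 ∷ 55 ∷ 37 ∷ 52 ∷ 39 ∷ 50 ∷ 40 ∷ 48 ∷ 43 ∷ 51 ∷ 41 ∷ 53 ∷ 42 ∷ 47 ∷ 44 ∷ 45 ∷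
     49 ∷ 46 ∷ 89 ∷ 88 ∷ 1 ∷ 6 ∷ 86 ∷ 5 ∷ []) ∷
    (7 ∷ 87 ∷ 8 ∷ 80 ∷ 15 ∷ 75 ∷ 20 ∷ 69 ∷ 22 ∷ 67 ∷ 28 ∷ 61 ∷ 35 ∷ 58 ∷ 33 ∷ 60 ∷ 30 ∷ 62 ∷ 63 ∷
     29 ∷ 64 ∷ 27 ∷ 26 ∷ 66 ∷ 24 ∷ 68 ∷ 23 ∷ 70 ∷ 21 ∷ 72 ∷ 73 ∷ 19 ∷ 74 ∷ 17 ∷ 16 ∷ 77 ∷ 14 ∷
     79 ∷ 12 ∷ 81 ∷ 10 ∷ 82 ∷ 83 ∷ 9 ∷ 85 ∷ []) ∷ []) ∷
   ((0 ∷ 3 ∷ 2 ∷ 86 ∷ 9 ∷ 80 ∷ 14 ∷ 74 ∷ 20 ∷ 68 ∷ 26 ∷ 62 ∷ 29 ∷ 65 ∷ 27 ∷ 66 ∷ 67 ∷ 24 ∷ 69 ∷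
     23 ∷ 22 ∷ 71 ∷ 21 ∷ 73 ∷ 72 ∷ 18 ∷ 75 ∷ 16 ∷ 17 ∷ 76 ∷ 15 ∷ 78 ∷ 79 ∷ 13 ∷ 81 ∷ 11 ∷ 10 ∷
     83 ∷ 8 ∷ 85 ∷ 84 ∷ 6 ∷ 87 ∷ 5 ∷ 4 ∷ []) ∷
    (1 ∷ 7 ∷ 82 ∷ 12 ∷ 77 ∷ 19 ∷ 70 ∷ 25 ∷ 64 ∷ 31 ∷ 30 ∷ 63 ∷ 28 ∷ 60 ∷ 61 ∷ 34 ∷ 58 ∷ 59 ∷ 33 ∷
     32 ∷ 56 ∷ 35 ∷ 55 ∷ 54 ∷ 37 ∷ 36 ∷ 57 ∷ 38 ∷ 39 ∷ 51 ∷ 45 ∷ 44 ∷ 49 ∷ 48 ∷ 42 ∷ 50 ∷ 41 ∷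
     40 ∷ 53 ∷ 52 ∷ 43 ∷ 46 ∷ 47 ∷ 88 ∷ 89 ∷ []) ∷ []) ∷
   ((0 ∷ 7 ∷ 6 ∷ 82 ∷ 9 ∷ 8 ∷ 84 ∷ 10 ∷ 79 ∷ 17 ∷ 73 ∷ 23 ∷ 66 ∷ 25 ∷ 68 ∷ 69 ∷ 27 ∷ 63 ∷ 32 ∷
     33 ∷ 61 ∷ 31 ∷ 62 ∷ 28 ∷ 64 ∷ 26 ∷ 67 ∷ 29 ∷ 60 ∷ 34 ∷ 35 ∷ 54 ∷ 41 ∷ 52 ∷ 53 ∷ 38 ∷ 51 ∷
     50 ∷ 45 ∷ 48 ∷ 47 ∷ 89 ∷ 2 ∷ 5 ∷ 1 ∷ []) ∷
    (3 ∷ 86 ∷ 87 ∷ 4 ∷ 85 ∷ 11 ∷ 83 ∷ 12 ∷ 13 ∷ 80 ∷ 81 ∷ 15 ∷ 14 ∷ 78 ∷ 16 ∷ 76 ∷ 77 ∷ 18 ∷ 19 ∷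
     75 ∷ 74 ∷ 21 ∷ 20 ∷ 72 ∷ 22 ∷ 70 ∷ 71 ∷ 24 ∷ 65 ∷ 30 ∷ 59 ∷ 58 ∷ 36 ∷ 37 ∷ 57 ∷ 56 ∷ 39 ∷
     55 ∷ 40 ∷ 49 ∷ 43 ∷ 42 ∷ 46 ∷ 44 ∷ 88 ∷ []) ∷ []) ∷
   ((0 ∷ 6 ∷ 7 ∷ 83 ∷ 13 ∷ 12 ∷ 80 ∷ 11 ∷ 82 ∷ 8 ∷ 9 ∷ 81 ∷ 14 ∷ 15 ∷ 79 ∷ 16 ∷ 72 ∷ 23 ∷ 67 ∷
     25 ∷ 24 ∷ 64 ∷ 65 ∷ 26 ∷ 27 ∷ 62 ∷ 32 ∷ 60 ∷ 31 ∷ 63 ∷ 33 ∷ 57 ∷ 35 ∷ 59 ∷ 36 ∷ 53 ∷ 39 ∷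
     54 ∷ 40 ∷ 52 ∷ 38 ∷ 50 ∷ 51 ∷ 44 ∷ 89 ∷ []) ∷
    (1 ∷ 3 ∷ 5 ∷ 84 ∷ 85 ∷ 10 ∷ 78 ∷ 17 ∷ 77 ∷ 76 ∷ 19 ∷ 71 ∷ 70 ∷ 20 ∷ 73 ∷ 18 ∷ 74 ∷ 75 ∷ 21 ∷
     69 ∷ 68 ∷ 22 ∷ 66 ∷ 28 ∷ 29 ∷ 61 ∷ 30 ∷ 58 ∷ 37 ∷ 56 ∷ 34 ∷ 55 ∷ 41 ∷ 48 ∷ 49 ∷ 42 ∷ 43 ∷
     47 ∷ 46 ∷ 45 ∷ 88 ∷ 2 ∷ 87 ∷ 86 ∷ 4 ∷ []) ∷ []) ∷
   [])
  (((0 ∷ 2 ∷ 86 ∷ 5 ∷ 85 ∷ 7 ∷ 87 ∷ 8 ∷ 81 ∷ 15 ∷ 78 ∷ 13 ∷ 77 ∷ 18 ∷ 70 ∷ 21 ∷ 72 ∷ 23 ∷ 71 ∷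
     24 ∷ 69 ∷ 22 ∷ 66 ∷ 29 ∷ 64 ∷ 27 ∷ 67 ∷ 25 ∷ 65 ∷ 31 ∷ 63 ∷ 28 ∷ 61 ∷ 34 ∷ 58 ∷ 37 ∷ 56 ∷
     38 ∷ 50 ∷ 40 ∷ 52 ∷ 42 ∷ 46 ∷ 45 ∷ 89 ∷ []) ∷
    (1 ∷ 6 ∷ 83 ∷ 9 ∷ 84 ∷ 11 ∷ 82 ∷ 12 ∷ 80 ∷ 10 ∷ 79 ∷ 16 ∷ 73 ∷ 19 ∷ 74 ∷ 17 ∷ 76 ∷ 14 ∷ 75 ∷
     20 ∷ 68 ∷ 26 ∷ 62 ∷ 33 ∷ 60 ∷ 30 ∷ 59 ∷ 32 ∷ 57 ∷ 35 ∷ 55 ∷ 36 ∷ 53 ∷ 39 ∷ 54 ∷ 41 ∷ 49 ∷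
     43 ∷ 51 ∷ 44 ∷ 48 ∷ 47 ∷ 88 ∷ 3 ∷ 4 ∷ []) ∷ []) ∷
   ((0 ∷ 6 ∷ 82 ∷ 8 ∷ 84 ∷ 7 ∷ 86 ∷ 4 ∷ 85 ∷ 11 ∷ 83 ∷ 13 ∷ 76 ∷ 18 ∷ 75 ∷ 16 ∷ 77 ∷ 14 ∷ 79 ∷
     12 ∷ 81 ∷ 10 ∷ 78 ∷ 17 ∷ 73 ∷ 22 ∷ 71 ∷ 20 ∷ 72 ∷ 19 ∷ 70 ∷ 24 ∷ 68 ∷ 27 ∷ 62 ∷ 32 ∷ 60 ∷
     34 ∷ 54 ∷ 40 ∷ 53 ∷ 42 ∷ 51 ∷ 45 ∷ 88 ∷ []) ∷
    (1 ∷ 2 ∷ 87 ∷ 9 ∷ 80 ∷ 15 ∷ 74 ∷ 21 ∷ 69 ∷ 23 ∷ 66 ∷ 25 ∷ 64 ∷ 26 ∷ 67 ∷ 28 ∷ 65 ∷ 30 ∷ 63 ∷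
     29 ∷ 61 ∷ 31 ∷ 58 ∷ 36 ∷ 56 ∷ 35 ∷ 59 ∷ 33 ∷ 57 ∷ 38 ∷ 55 ∷ 37 ∷ 52 ∷ 39 ∷ 50 ∷ 41 ∷ 48 ∷
     43 ∷ 46 ∷ 44 ∷ 49 ∷ 47 ∷ 89 ∷ 3 ∷ 5 ∷ []) ∷ []) ∷
   ((0 ∷ 3 ∷ 86 ∷ 9 ∷ 81 ∷ 11 ∷ 78 ∷ 12 ∷ 77 ∷ 15 ∷ 79 ∷ 17 ∷ 72 ∷ 22 ∷ 67 ∷ 24 ∷ 65 ∷ 26 ∷ 63 ∷
     32 ∷ 61 ∷ 30 ∷ 58 ∷ 33 ∷ 56 ∷ 34 ∷ 59 ∷ 37 ∷ 53 ∷ 43 ∷ 47 ∷ 45 ∷ 49 ∷ 42 ∷ 50 ∷ 44 ∷ 89 ∷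
     1 ∷ 7 ∷ 83 ∷ 8 ∷ 85 ∷ 6 ∷ 87 ∷ 5 ∷ []) ∷
    (2 ∷ 4 ∷ 84 ∷ 10 ∷ 82 ∷ 13 ∷ 80 ∷ 14 ∷ 74 ∷ 16 ∷ 76 ∷ 19 ∷ 75 ∷ 21 ∷ 73 ∷ 18 ∷ 71 ∷ 25 ∷ 68 ∷
     23 ∷ 70 ∷ 20 ∷ 69 ∷ 27 ∷ 66 ∷ 28 ∷ 64 ∷ 31 ∷ 62 ∷ 29 ∷ 60 ∷ 35 ∷ 54 ∷ 36 ∷ 57 ∷ 39 ∷ 55 ∷
     41 ∷ 52 ∷ 38 ∷ 51 ∷ 40 ∷ 48 ∷ 46 ∷ 88 ∷ []) ∷ []) ∷
   ((0 ∷ 7 ∷ 82 ∷ 9 ∷ 85 ∷ 10 ∷ 83 ∷ 12 ∷ 76 ∷ 15 ∷ 75 ∷ 17 ∷ 77 ∷ 19 ∷ 71 ∷ 21 ∷ 68 ∷ 22 ∷ 70 ∷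
     25 ∷ 69 ∷ 26 ∷ 66 ∷ 24 ∷ 64 ∷ 30 ∷ 62 ∷ 28 ∷ 60 ∷ 31 ∷ 59 ∷ 36 ∷ 52 ∷ 43 ∷ 50 ∷ 45 ∷ 48 ∷
     42 ∷ 47 ∷ 44 ∷ 88 ∷ 1 ∷ 3 ∷ 87 ∷ 4 ∷ []) ∷
    (2 ∷ 5 ∷ 84 ∷ 6 ∷ 86 ∷ 8 ∷ 80 ∷ 11 ∷ 79 ∷ 13 ∷ 81 ∷ 14 ∷ 78 ∷ 16 ∷ 72 ∷ 18 ∷ 74 ∷ 20 ∷ 73 ∷
     23 ∷ 67 ∷ 29 ∷ 65 ∷ 27 ∷ 63 ∷ 33 ∷ 61 ∷ 35 ∷ 58 ∷ 32 ∷ 56 ∷ 39 ∷ 51 ∷ 41 ∷ 53 ∷ 38 ∷ 54 ∷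
     37 ∷ 57 ∷ 34 ∷ 55 ∷ 40 ∷ 49 ∷ 46 ∷ 89 ∷ []) ∷ []) ∷
   [])
  refl

K*94 : ResolvableCycleDecomposition 94 47
K*94 = resolve 46
  (((0 ∷ 7 ∷ 86 ∷ 13 ∷ 81 ∷ 18 ∷ 75 ∷ 25 ∷ 68 ∷ 31 ∷ 66 ∷ 33 ∷ 60 ∷ 35 ∷ 62 ∷ 63 ∷ 32 ∷ 61 ∷ 34 ∷
     59 ∷ 40 ∷ 41 ∷ 57 ∷ 39 ∷ 38 ∷ 58 ∷ 36 ∷ 37 ∷ 56 ∷ 43 ∷ 42 ∷ 54 ∷ 55 ∷ 44 ∷ 45 ∷ 53 ∷ 52 ∷
     47 ∷ 51 ∷ 50 ∷ 48 ∷ 49 ∷ 46 ∷ 93 ∷ 92 ∷ 2 ∷ 5 ∷ []) ∷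
    (1 ∷ 3 ∷ 90 ∷ 9 ∷ 85 ∷ 15 ∷ 79 ∷ 17 ∷ 77 ∷ 23 ∷ 71 ∷ 28 ∷ 64 ∷ 65 ∷ 30 ∷ 67 ∷ 29 ∷ 69 ∷ 26 ∷
     27 ∷ 70 ∷ 24 ∷ 73 ∷ 72 ∷ 22 ∷ 74 ∷ 21 ∷ 20 ∷ 76 ∷ 19 ∷ 78 ∷ 16 ∷ 80 ∷ 14 ∷ 82 ∷ 83 ∷ 12 ∷
     84 ∷ 10 ∷ 11 ∷ 87 ∷ 8 ∷ 88 ∷ 89 ∷ 6 ∷ 91 ∷ 4 ∷ []) ∷ []) ∷
   ((0 ∷ 2 ∷ 3 ∷ 4 ∷ 5 ∷ 88 ∷ 10 ∷ 86 ∷ 9 ∷ 84 ∷ 15 ∷ 82 ∷ 12 ∷ 85 ∷ 11 ∷ 83 ∷ 16 ∷ 77 ∷ 19 ∷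
     18 ∷ 78 ∷ 17 ∷ 76 ∷ 22 ∷ 75 ∷ 74 ∷ 25 ∷ 69 ∷ 30 ∷ 31 ∷ 62 ∷ 36 ∷ 57 ∷ 38 ∷ 59 ∷ 58 ∷ 40 ∷
     56 ∷ 42 ∷ 43 ∷ 55 ∷ 41 ∷ 53 ∷ 47 ∷ 50 ∷ 49 ∷ 93 ∷ []) ∷
    (1 ∷ 6 ∷ 90 ∷ 91 ∷ 8 ∷ 89 ∷ 7 ∷ 87 ∷ 13 ∷ 80 ∷ 81 ∷ 14 ∷ 79 ∷ 20 ∷ 21 ∷ 73 ∷ 26 ∷ 71 ∷ 24 ∷
     72 ∷ 23 ∷ 70 ∷ 28 ∷ 29 ∷ 68 ∷ 27 ∷ 66 ∷ 67 ∷ 33 ∷ 32 ∷ 65 ∷ 64 ∷ 35 ∷ 34 ∷ 63 ∷ 37 ∷ 61 ∷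
     60 ∷ 39 ∷ 54 ∷ 44 ∷ 52 ∷ 46 ∷ 51 ∷ 45 ∷ 48 ∷ 92 ∷ []) ∷ []) ∷
   ((0 ∷ 1 ∷ 7 ∷ 90 ∷ 8 ∷ 9 ∷ 88 ∷ 6 ∷ 86 ∷ 87 ∷ 12 ∷ 13 ∷ 84 ∷ 85 ∷ 14 ∷ 15 ∷ 78 ∷ 20 ∷ 73 ∷
     23 ∷ 74 ∷ 75 ∷ 24 ∷ 25 ∷ 72 ∷ 27 ∷ 26 ∷ 67 ∷ 32 ∷ 60 ∷ 61 ∷ 35 ∷ 59 ∷ 36 ∷ 56 ∷ 38 ∷ 39 ∷
     55 ∷ 45 ∷ 52 ∷ 42 ∷ 51 ∷ 48 ∷ 47 ∷ 93 ∷ 2 ∷ 4 ∷ []) ∷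
    (3 ∷ 91 ∷ 5 ∷ 89 ∷ 11 ∷ 10 ∷ 83 ∷ 82 ∷ 16 ∷ 17 ∷ 81 ∷ 80 ∷ 18 ∷ 19 ∷ 79 ∷ 21 ∷ 76 ∷ 77 ∷ 22 ∷
     70 ∷ 71 ∷ 29 ∷ 64 ∷ 30 ∷ 66 ∷ 28 ∷ 68 ∷ 69 ∷ 31 ∷ 63 ∷ 62 ∷ 33 ∷ 65 ∷ 34 ∷ 58 ∷ 37 ∷ 57 ∷
     43 ∷ 54 ∷ 41 ∷ 40 ∷ 53 ∷ 46 ∷ 50 ∷ 44 ∷ 49 ∷ 92 ∷ []) ∷ []) ∷
   ((0 ∷ 3 ∷ 2 ∷ 91 ∷ 90 ∷ 5 ∷ 4 ∷ 89 ∷ 88 ∷ 7 ∷ 6 ∷ 87 ∷ 9 ∷ 8 ∷ 84 ∷ 11 ∷ 86 ∷ 12 ∷ 80 ∷ 15 ∷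
     14 ∷ 83 ∷ 13 ∷ 85 ∷ 10 ∷ 82 ∷ 17 ∷ 16 ∷ 81 ∷ 19 ∷ 74 ∷ 24 ∷ 68 ∷ 30 ∷ 63 ∷ 36 ∷ 61 ∷ 38 ∷
     54 ∷ 45 ∷ 49 ∷ 48 ∷ 46 ∷ 47 ∷ 92 ∷ 93 ∷ 1 ∷ []) ∷
    (18 ∷ 79 ∷ 78 ∷ 21 ∷ 72 ∷ 26 ∷ 66 ∷ 29 ∷ 65 ∷ 35 ∷ 58 ∷ 41 ∷ 52 ∷ 43 ∷ 50 ∷ 51 ∷ 44 ∷ 53 ∷
     42 ∷ 55 ∷ 40 ∷ 57 ∷ 56 ∷ 39 ∷ 59 ∷ 37 ∷ 60 ∷ 34 ∷ 62 ∷ 32 ∷ 33 ∷ 64 ∷ 31 ∷ 67 ∷ 28 ∷ 69 ∷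
     27 ∷ 71 ∷ 70 ∷ 25 ∷ 73 ∷ 22 ∷ 23 ∷ 75 ∷ 20 ∷ 77 ∷ 76 ∷ []) ∷ []) ∷
   ((0 ∷ 6 ∷ 7 ∷ 91 ∷ 9 ∷ 89 ∷ 10 ∷ 87 ∷ 86 ∷ 8 ∷ 85 ∷ 84 ∷ 14 ∷ 78 ∷ 79 ∷ 16 ∷ 76 ∷ 23 ∷ 22 ∷
     71 ∷ 25 ∷ 24 ∷ 69 ∷ 68 ∷ 26 ∷ 70 ∷ 29 ∷ 28 ∷ 65 ∷ 31 ∷ 30 ∷ 62 ∷ 37 ∷ 36 ∷ 60 ∷ 38 ∷ 55 ∷
     54 ∷ 40 ∷ 52 ∷ 53 ∷ 43 ∷ 51 ∷ 49 ∷ 47 ∷ 46 ∷ 92 ∷ []) ∷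
    (1 ∷ 2 ∷ 90 ∷ 4 ∷ 88 ∷ 11 ∷ 82 ∷ 13 ∷ 12 ∷ 81 ∷ 15 ∷ 83 ∷ 17 ∷ 80 ∷ 19 ∷ 75 ∷ 21 ∷ 77 ∷ 18 ∷
     74 ∷ 20 ∷ 72 ∷ 73 ∷ 27 ∷ 67 ∷ 66 ∷ 32 ∷ 64 ∷ 34 ∷ 35 ∷ 63 ∷ 33 ∷ 61 ∷ 39 ∷ 58 ∷ 59 ∷ 41 ∷
     56 ∷ 57 ∷ 42 ∷ 50 ∷ 45 ∷ 44 ∷ 48 ∷ 93 ∷ 3 ∷ 5 ∷ []) ∷ []) ∷
   [])
  (((0 ∷ 3 ∷ 91 ∷ 5 ∷ 1 ∷ 6 ∷ 86 ∷ 9 ∷ 84 ∷ 11 ∷ 83 ∷ 12 ∷ 85 ∷ 15 ∷ 82 ∷ 16 ∷ 77 ∷ 18 ∷ 74 ∷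
     20 ∷ 73 ∷ 27 ∷ 70 ∷ 29 ∷ 68 ∷ 26 ∷ 67 ∷ 33 ∷ 65 ∷ 35 ∷ 58 ∷ 36 ∷ 60 ∷ 34 ∷ 62 ∷ 32 ∷ 61 ∷
     39 ∷ 54 ∷ 45 ∷ 49 ∷ 46 ∷ 51 ∷ 44 ∷ 53 ∷ 47 ∷ 93 ∷ []) ∷
    (2 ∷ 4 ∷ 89 ∷ 7 ∷ 90 ∷ 8 ∷ 88 ∷ 10 ∷ 87 ∷ 13 ∷ 81 ∷ 14 ∷ 79 ∷ 17 ∷ 80 ∷ 19 ∷ 78 ∷ 21 ∷ 76 ∷
     23 ∷ 75 ∷ 24 ∷ 72 ∷ 22 ∷ 71 ∷ 25 ∷ 69 ∷ 31 ∷ 66 ∷ 28 ∷ 64 ∷ 30 ∷ 63 ∷ 37 ∷ 57 ∷ 38 ∷ 59 ∷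
     41 ∷ 52 ∷ 43 ∷ 55 ∷ 40 ∷ 56 ∷ 42 ∷ 50 ∷ 48 ∷ 92 ∷ []) ∷ []) ∷
   ((0 ∷ 7 ∷ 87 ∷ 9 ∷ 89 ∷ 10 ∷ 82 ∷ 12 ∷ 81 ∷ 18 ∷ 79 ∷ 16 ∷ 80 ∷ 14 ∷ 78 ∷ 20 ∷ 72 ∷ 27 ∷ 66 ∷
     32 ∷ 65 ∷ 31 ∷ 67 ∷ 28 ∷ 69 ∷ 26 ∷ 71 ∷ 29 ∷ 64 ∷ 34 ∷ 59 ∷ 36 ∷ 56 ∷ 39 ∷ 55 ∷ 41 ∷ 53 ∷
     42 ∷ 51 ∷ 49 ∷ 92 ∷ 3 ∷ 4 ∷ 88 ∷ 6 ∷ 90 ∷ 5 ∷ []) ∷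
    (1 ∷ 2 ∷ 91 ∷ 8 ∷ 85 ∷ 11 ∷ 86 ∷ 13 ∷ 84 ∷ 15 ∷ 83 ∷ 17 ∷ 76 ∷ 19 ∷ 75 ∷ 21 ∷ 77 ∷ 23 ∷ 74 ∷
     24 ∷ 73 ∷ 22 ∷ 70 ∷ 25 ∷ 68 ∷ 30 ∷ 62 ∷ 37 ∷ 60 ∷ 35 ∷ 63 ∷ 33 ∷ 61 ∷ 38 ∷ 58 ∷ 40 ∷ 57 ∷
     43 ∷ 54 ∷ 44 ∷ 52 ∷ 47 ∷ 50 ∷ 45 ∷ 48 ∷ 46 ∷ 93 ∷ []) ∷ []) ∷
   ((0 ∷ 6 ∷ 87 ∷ 8 ∷ 84 ∷ 14 ∷ 83 ∷ 16 ∷ 76 ∷ 22 ∷ 75 ∷ 20 ∷ 77 ∷ 19 ∷ 74 ∷ 25 ∷ 72 ∷ 23 ∷ 70 ∷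
     28 ∷ 65 ∷ 30 ∷ 67 ∷ 32 ∷ 64 ∷ 35 ∷ 62 ∷ 33 ∷ 60 ∷ 39 ∷ 59 ∷ 37 ∷ 56 ∷ 38 ∷ 55 ∷ 45 ∷ 52 ∷
     46 ∷ 92 ∷ 1 ∷ 3 ∷ 90 ∷ 9 ∷ 88 ∷ 7 ∷ 91 ∷ 4 ∷ []) ∷
    (2 ∷ 5 ∷ 89 ∷ 11 ∷ 82 ∷ 13 ∷ 85 ∷ 10 ∷ 86 ∷ 12 ∷ 80 ∷ 18 ∷ 78 ∷ 17 ∷ 81 ∷ 15 ∷ 79 ∷ 21 ∷ 73 ∷
     26 ∷ 66 ∷ 29 ∷ 69 ∷ 27 ∷ 71 ∷ 24 ∷ 68 ∷ 31 ∷ 63 ∷ 36 ∷ 61 ∷ 34 ∷ 58 ∷ 41 ∷ 57 ∷ 42 ∷ 54 ∷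
     40 ∷ 53 ∷ 43 ∷ 50 ∷ 44 ∷ 49 ∷ 47 ∷ 51 ∷ 48 ∷ 93 ∷ []) ∷ []) ∷
   ((0 ∷ 2 ∷ 90 ∷ 4 ∷ 1 ∷ 7 ∷ 86 ∷ 8 ∷ 89 ∷ 6 ∷ 91 ∷ 9 ∷ 85 ∷ 14 ∷ 82 ∷ 17 ∷ 77 ∷ 22 ∷ 74 ∷ 21 ∷
     72 ∷ 26 ∷ 70 ∷ 24 ∷ 69 ∷ 30 ∷ 66 ∷ 33 ∷ 64 ∷ 31 ∷ 62 ∷ 36 ∷ 57 ∷ 39 ∷ 58 ∷ 37 ∷ 61 ∷ 35 ∷
     59 ∷ 40 ∷ 52 ∷ 42 ∷ 55 ∷ 44 ∷ 48 ∷ 47 ∷ 92 ∷ []) ∷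
    (3 ∷ 5 ∷ 88 ∷ 11 ∷ 87 ∷ 12 ∷ 84 ∷ 10 ∷ 83 ∷ 13 ∷ 80 ∷ 15 ∷ 78 ∷ 16 ∷ 81 ∷ 19 ∷ 79 ∷ 20 ∷ 76 ∷
     18 ∷ 75 ∷ 25 ∷ 73 ∷ 23 ∷ 71 ∷ 28 ∷ 68 ∷ 27 ∷ 67 ∷ 29 ∷ 65 ∷ 34 ∷ 63 ∷ 32 ∷ 60 ∷ 38 ∷ 54 ∷
     41 ∷ 56 ∷ 43 ∷ 51 ∷ 45 ∷ 53 ∷ 46 ∷ 50 ∷ 49 ∷ 93 ∷ []) ∷ []) ∷
   [])
  refl

K*98 : ResolvableCycleDecomposition 98 49
K*98 = resolve 48
  (((0 ∷ 1 ∷ 3 ∷ 5 ∷ 93 ∷ 92 ∷ 7 ∷ 6 ∷ 91 ∷ 9 ∷ 8 ∷ 88 ∷ 14 ∷ 86 ∷ 16 ∷ 81 ∷ 23 ∷ 74 ∷ 25 ∷ 73 ∷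
     30 ∷ 66 ∷ 37 ∷ 65 ∷ 38 ∷ 58 ∷ 59 ∷ 44 ∷ 45 ∷ 56 ∷ 57 ∷ 43 ∷ 42 ∷ 55 ∷ 54 ∷ 49 ∷ 48 ∷ 53 ∷
     52 ∷ 46 ∷ 47 ∷ 50 ∷ 51 ∷ 97 ∷ 96 ∷ 2 ∷ 94 ∷ 95 ∷ 4 ∷ []) ∷
    (10 ∷ 11 ∷ 90 ∷ 13 ∷ 84 ∷ 18 ∷ 82 ∷ 21 ∷ 76 ∷ 27 ∷ 70 ∷ 28 ∷ 69 ∷ 35 ∷ 63 ∷ 41 ∷ 40 ∷ 61 ∷
     60 ∷ 39 ∷ 62 ∷ 36 ∷ 64 ∷ 34 ∷ 67 ∷ 32 ∷ 33 ∷ 68 ∷ 31 ∷ 71 ∷ 29 ∷ 72 ∷ 26 ∷ 75 ∷ 24 ∷ 77 ∷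
     22 ∷ 79 ∷ 78 ∷ 20 ∷ 80 ∷ 19 ∷ 83 ∷ 17 ∷ 85 ∷ 15 ∷ 87 ∷ 12 ∷ 89 ∷ []) ∷ []) ∷
   ((0 ∷ 2 ∷ 4 ∷ 1 ∷ 6 ∷ 90 ∷ 12 ∷ 85 ∷ 19 ∷ 79 ∷ 24 ∷ 72 ∷ 31 ∷ 70 ∷ 32 ∷ 68 ∷ 30 ∷ 71 ∷ 28 ∷
     73 ∷ 26 ∷ 27 ∷ 75 ∷ 25 ∷ 77 ∷ 23 ∷ 78 ∷ 21 ∷ 80 ∷ 81 ∷ 18 ∷ 83 ∷ 16 ∷ 17 ∷ 84 ∷ 14 ∷ 87 ∷
     86 ∷ 13 ∷ 88 ∷ 11 ∷ 10 ∷ 91 ∷ 8 ∷ 92 ∷ 93 ∷ 7 ∷ 94 ∷ 5 ∷ []) ∷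
    (3 ∷ 95 ∷ 9 ∷ 89 ∷ 15 ∷ 82 ∷ 20 ∷ 76 ∷ 22 ∷ 74 ∷ 29 ∷ 69 ∷ 34 ∷ 35 ∷ 66 ∷ 67 ∷ 33 ∷ 64 ∷ 65 ∷
     39 ∷ 58 ∷ 41 ∷ 61 ∷ 38 ∷ 62 ∷ 63 ∷ 36 ∷ 37 ∷ 60 ∷ 43 ∷ 54 ∷ 44 ∷ 56 ∷ 42 ∷ 59 ∷ 40 ∷ 57 ∷
     47 ∷ 55 ∷ 45 ∷ 53 ∷ 46 ∷ 51 ∷ 49 ∷ 52 ∷ 50 ∷ 48 ∷ 96 ∷ 97 ∷ []) ∷ []) ∷
   ((0 ∷ 6 ∷ 7 ∷ 95 ∷ 8 ∷ 9 ∷ 93 ∷ 10 ∷ 90 ∷ 91 ∷ 13 ∷ 12 ∷ 88 ∷ 89 ∷ 14 ∷ 15 ∷ 83 ∷ 21 ∷ 77 ∷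
     76 ∷ 23 ∷ 75 ∷ 74 ∷ 24 ∷ 73 ∷ 31 ∷ 66 ∷ 33 ∷ 65 ∷ 34 ∷ 63 ∷ 62 ∷ 37 ∷ 64 ∷ 38 ∷ 39 ∷ 59 ∷
     58 ∷ 40 ∷ 41 ∷ 57 ∷ 56 ∷ 43 ∷ 55 ∷ 44 ∷ 53 ∷ 51 ∷ 48 ∷ 97 ∷ []) ∷
    (1 ∷ 2 ∷ 3 ∷ 94 ∷ 4 ∷ 5 ∷ 92 ∷ 11 ∷ 86 ∷ 87 ∷ 16 ∷ 85 ∷ 84 ∷ 19 ∷ 82 ∷ 17 ∷ 80 ∷ 18 ∷ 79 ∷
     20 ∷ 81 ∷ 22 ∷ 78 ∷ 25 ∷ 72 ∷ 27 ∷ 26 ∷ 71 ∷ 32 ∷ 69 ∷ 30 ∷ 70 ∷ 29 ∷ 28 ∷ 68 ∷ 35 ∷ 67 ∷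
     36 ∷ 60 ∷ 61 ∷ 42 ∷ 54 ∷ 45 ∷ 52 ∷ 47 ∷ 46 ∷ 50 ∷ 49 ∷ 96 ∷ []) ∷ []) ∷
   ((0 ∷ 7 ∷ 90 ∷ 9 ∷ 92 ∷ 6 ∷ 94 ∷ 8 ∷ 89 ∷ 88 ∷ 10 ∷ 87 ∷ 13 ∷ 85 ∷ 14 ∷ 83 ∷ 82 ∷ 16 ∷ 80 ∷
     22 ∷ 23 ∷ 79 ∷ 21 ∷ 20 ∷ 77 ∷ 27 ∷ 74 ∷ 75 ∷ 28 ∷ 29 ∷ 73 ∷ 72 ∷ 30 ∷ 31 ∷ 67 ∷ 37 ∷ 36 ∷
     61 ∷ 39 ∷ 63 ∷ 40 ∷ 56 ∷ 46 ∷ 54 ∷ 55 ∷ 48 ∷ 49 ∷ 97 ∷ 1 ∷ []) ∷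
    (2 ∷ 95 ∷ 5 ∷ 4 ∷ 93 ∷ 11 ∷ 91 ∷ 12 ∷ 84 ∷ 15 ∷ 86 ∷ 17 ∷ 81 ∷ 19 ∷ 18 ∷ 78 ∷ 24 ∷ 25 ∷ 76 ∷
     26 ∷ 70 ∷ 71 ∷ 33 ∷ 69 ∷ 68 ∷ 34 ∷ 66 ∷ 32 ∷ 65 ∷ 64 ∷ 35 ∷ 62 ∷ 41 ∷ 60 ∷ 38 ∷ 59 ∷ 45 ∷
     57 ∷ 42 ∷ 43 ∷ 58 ∷ 44 ∷ 52 ∷ 53 ∷ 47 ∷ 51 ∷ 50 ∷ 96 ∷ 3 ∷ []) ∷ []) ∷
   ((0 ∷ 3 ∷ 4 ∷ 92 ∷ 10 ∷ 86 ∷ 12 ∷ 13 ∷ 89 ∷ 11 ∷ 87 ∷ 17 ∷ 16 ∷ 84 ∷ 85 ∷ 18 ∷ 19 ∷ 78 ∷ 79 ∷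
     25 ∷ 24 ∷ 76 ∷ 77 ∷ 26 ∷ 74 ∷ 28 ∷ 72 ∷ 73 ∷ 27 ∷ 71 ∷ 70 ∷ 33 ∷ 32 ∷ 64 ∷ 39 ∷ 38 ∷ 63 ∷
     37 ∷ 61 ∷ 43 ∷ 59 ∷ 41 ∷ 56 ∷ 47 ∷ 54 ∷ 48 ∷ 52 ∷ 51 ∷ 96 ∷ []) ∷
    (1 ∷ 7 ∷ 91 ∷ 90 ∷ 8 ∷ 93 ∷ 6 ∷ 95 ∷ 94 ∷ 9 ∷ 88 ∷ 15 ∷ 14 ∷ 82 ∷ 83 ∷ 20 ∷ 21 ∷ 81 ∷ 80 ∷
     23 ∷ 22 ∷ 75 ∷ 29 ∷ 68 ∷ 69 ∷ 31 ∷ 30 ∷ 67 ∷ 66 ∷ 36 ∷ 65 ∷ 35 ∷ 34 ∷ 62 ∷ 40 ∷ 60 ∷ 42 ∷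
     58 ∷ 45 ∷ 44 ∷ 57 ∷ 46 ∷ 55 ∷ 49 ∷ 53 ∷ 50 ∷ 97 ∷ 2 ∷ 5 ∷ []) ∷ []) ∷
   [])
  -- Under the shifts 2, 4, ..., 46 these four starters stand for 92 of the 97 classes.
  (((0 ∷ 6 ∷ 91 ∷ 9 ∷ 92 ∷ 7 ∷ 94 ∷ 8 ∷ 88 ∷ 15 ∷ 82 ∷ 20 ∷ 76 ∷ 27 ∷ 74 ∷ 28 ∷ 69 ∷ 35 ∷ 66 ∷
     33 ∷ 68 ∷ 30 ∷ 70 ∷ 29 ∷ 72 ∷ 26 ∷ 71 ∷ 32 ∷ 64 ∷ 39 ∷ 63 ∷ 36 ∷ 61 ∷ 38 ∷ 58 ∷ 44 ∷ 56 ∷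
     43 ∷ 55 ∷ 49 ∷ 52 ∷ 47 ∷ 54 ∷ 45 ∷ 53 ∷ 51 ∷ 97 ∷ 2 ∷ 5 ∷ []) ∷
    (1 ∷ 3 ∷ 95 ∷ 4 ∷ 93 ∷ 10 ∷ 90 ∷ 13 ∷ 89 ∷ 11 ∷ 87 ∷ 12 ∷ 84 ∷ 19 ∷ 83 ∷ 17 ∷ 85 ∷ 14 ∷ 86 ∷
     16 ∷ 81 ∷ 18 ∷ 79 ∷ 21 ∷ 80 ∷ 22 ∷ 78 ∷ 25 ∷ 77 ∷ 23 ∷ 75 ∷ 24 ∷ 73 ∷ 31 ∷ 67 ∷ 37 ∷ 65 ∷
     34 ∷ 62 ∷ 41 ∷ 60 ∷ 42 ∷ 59 ∷ 40 ∷ 57 ∷ 46 ∷ 50 ∷ 48 ∷ 96 ∷ []) ∷ []) ∷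
   ((0 ∷ 7 ∷ 90 ∷ 12 ∷ 88 ∷ 10 ∷ 91 ∷ 8 ∷ 92 ∷ 6 ∷ 94 ∷ 9 ∷ 89 ∷ 15 ∷ 83 ∷ 20 ∷ 80 ∷ 18 ∷ 78 ∷
     21 ∷ 76 ∷ 22 ∷ 75 ∷ 29 ∷ 69 ∷ 30 ∷ 71 ∷ 28 ∷ 73 ∷ 26 ∷ 74 ∷ 24 ∷ 77 ∷ 27 ∷ 70 ∷ 32 ∷ 68 ∷
     34 ∷ 63 ∷ 40 ∷ 61 ∷ 43 ∷ 59 ∷ 41 ∷ 57 ∷ 47 ∷ 50 ∷ 49 ∷ 97 ∷ []) ∷
    (1 ∷ 2 ∷ 95 ∷ 5 ∷ 93 ∷ 11 ∷ 86 ∷ 13 ∷ 85 ∷ 19 ∷ 82 ∷ 16 ∷ 84 ∷ 14 ∷ 87 ∷ 17 ∷ 81 ∷ 23 ∷ 79 ∷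
     25 ∷ 72 ∷ 31 ∷ 66 ∷ 36 ∷ 64 ∷ 35 ∷ 67 ∷ 33 ∷ 65 ∷ 38 ∷ 62 ∷ 37 ∷ 60 ∷ 39 ∷ 58 ∷ 45 ∷ 56 ∷
     42 ∷ 55 ∷ 44 ∷ 53 ∷ 46 ∷ 54 ∷ 48 ∷ 52 ∷ 51 ∷ 96 ∷ 3 ∷ 4 ∷ []) ∷ []) ∷
   ((0 ∷ 2 ∷ 94 ∷ 4 ∷ 92 ∷ 11 ∷ 90 ∷ 9 ∷ 93 ∷ 6 ∷ 95 ∷ 8 ∷ 89 ∷ 10 ∷ 87 ∷ 16 ∷ 80 ∷ 23 ∷ 78 ∷
     20 ∷ 81 ∷ 19 ∷ 79 ∷ 24 ∷ 76 ∷ 26 ∷ 75 ∷ 28 ∷ 72 ∷ 30 ∷ 67 ∷ 32 ∷ 65 ∷ 35 ∷ 63 ∷ 41 ∷ 61 ∷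
     39 ∷ 62 ∷ 36 ∷ 60 ∷ 43 ∷ 58 ∷ 40 ∷ 56 ∷ 47 ∷ 51 ∷ 49 ∷ 96 ∷ []) ∷
    (1 ∷ 7 ∷ 91 ∷ 13 ∷ 88 ∷ 14 ∷ 82 ∷ 17 ∷ 84 ∷ 15 ∷ 86 ∷ 12 ∷ 85 ∷ 18 ∷ 83 ∷ 21 ∷ 77 ∷ 22 ∷ 74 ∷
     25 ∷ 73 ∷ 27 ∷ 71 ∷ 29 ∷ 68 ∷ 31 ∷ 70 ∷ 33 ∷ 69 ∷ 34 ∷ 66 ∷ 37 ∷ 64 ∷ 38 ∷ 59 ∷ 45 ∷ 57 ∷
     42 ∷ 54 ∷ 44 ∷ 52 ∷ 46 ∷ 55 ∷ 48 ∷ 53 ∷ 50 ∷ 97 ∷ 3 ∷ 5 ∷ []) ∷ []) ∷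
   ((0 ∷ 3 ∷ 94 ∷ 5 ∷ 92 ∷ 10 ∷ 86 ∷ 17 ∷ 80 ∷ 19 ∷ 78 ∷ 24 ∷ 72 ∷ 27 ∷ 75 ∷ 25 ∷ 76 ∷ 23 ∷ 74 ∷
     29 ∷ 73 ∷ 30 ∷ 66 ∷ 32 ∷ 69 ∷ 31 ∷ 71 ∷ 33 ∷ 64 ∷ 34 ∷ 67 ∷ 36 ∷ 65 ∷ 39 ∷ 59 ∷ 44 ∷ 57 ∷
     43 ∷ 54 ∷ 49 ∷ 53 ∷ 47 ∷ 55 ∷ 45 ∷ 52 ∷ 50 ∷ 96 ∷ 2 ∷ 4 ∷ []) ∷
    (1 ∷ 6 ∷ 90 ∷ 8 ∷ 93 ∷ 7 ∷ 95 ∷ 9 ∷ 88 ∷ 11 ∷ 91 ∷ 12 ∷ 89 ∷ 14 ∷ 83 ∷ 16 ∷ 85 ∷ 15 ∷ 87 ∷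
     13 ∷ 84 ∷ 18 ∷ 82 ∷ 21 ∷ 81 ∷ 22 ∷ 79 ∷ 20 ∷ 77 ∷ 26 ∷ 70 ∷ 28 ∷ 68 ∷ 35 ∷ 62 ∷ 40 ∷ 60 ∷
     38 ∷ 63 ∷ 37 ∷ 61 ∷ 42 ∷ 58 ∷ 41 ∷ 56 ∷ 46 ∷ 51 ∷ 48 ∷ 97 ∷ []) ∷ []) ∷
   [])
  refl

-- Selecting the design for a given odd m.

-- The index is h = m / 2, so that the odd m below 50 become an initial segment of ℕ; h = 0 and h =
-- 1, that is m = 1 and m = 3, are vacuous entries that keep the list aligned with `upTo`. At a
-- numeral h, the form `1 + h * 2` computes to the order in the type of the design.
designs : All (λ h → 2 ≤ h → ResolvableCycleDecomposition (2 * (1 + h * 2)) (1 + h * 2)) (upTo 25)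
designs =
  (λ ()) ∷ (λ { (s≤s ()) }) ∷
  const K*10 ∷ const K*14 ∷ const K*18 ∷ const K*22 ∷ const K*26 ∷
  const K*30 ∷ const K*34 ∷ const K*38 ∷ const K*42 ∷ const K*46 ∷
  const K*50 ∷ const K*54 ∷ const K*58 ∷ const K*62 ∷ const K*66 ∷
  const K*70 ∷ const K*74 ∷ const K*78 ∷ const K*82 ∷ const K*86 ∷
  const K*90 ∷ const K*94 ∷ const K*98 ∷ []

theorem1p4 : (m : ℕ) → 5 ≤ m → m ≤ 49 → m % 2 ≡ 1 →
    ResolvableCycleDecomposition (2 * m) m
theorem1p4 m 5≤m m≤49 odd =
  subst (λ m → ResolvableCycleDecomposition (2 * m) m) (sym m≡1+h*2)
    -- From m < 50 = 25 · 2 follows m / 2 < 25, and from 5 ≤ m follows 2 = 5 / 2 ≤ m / 2.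
    (All.lookup designs (∈-upTo⁺ (m<n*o⇒m/o<n (s≤s m≤49))) (/-monoˡ-≤ 2 5≤m))
  where
  m≡1+h*2 : m ≡ 1 + m / 2 * 2
  m≡1+h*2 = trans (m≡m%n+[m/n]*n m 2) (cong (_+ m / 2 * 2) odd)
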